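{- Let $p$ be a prime with $p\equiv5\pmod 6$, and let $m\ge0$, $\alpha\ge0$, $n\ge0$ be integers. Then for every integer $i$ with $1\le i\le p-1$, \begin{align*} &\overline{S}_3\big(24p^{2\alpha+2}n+(24i+7p)p^{2\alpha+1}\big)\equiv0\pmod{32},\\ &\overline{S}_3^{\,16m+1}\big(24p^{2\alpha+2}n+(24i+19p)p^{2\alpha+1}\big)\equiv0\pmod{32}. \end{align*}
   Context: For $|q|<1$ and a positive integer $k$, write $f_k=\prod_{j\ge1}(1-q^{kj})$. For a positive integer $r$, $\overline{S}_3^{\,r}(n)$ (number of $3$-Schur overpartitions of $n$ with $r$-tuples) is defined by $\sum_{n\ge0}\overline{S}_3^{\,r}(n)q^n=\prod_{n\ge1}\frac{(1+q^{2n-1})^r(1-q^{3(2n-1)})^r}{(1+q^{3(2n-1)})^r(1-q^{2n-1})^r}=\frac{f_2^{3r}f_3^{2r}f_{12}^r}{f_1^{2r}f_4^rf_6^{3r}}$, and $\overline{S}_3(n)=\overline{S}_3^{\,1}(n)$. -}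

module Defs where

open import Data.Nat as ℕ using (ℕ; zero; suc; _∸_; _%_)
open import Data.Integer as ℤ using (ℤ; +_; -_; _+_; _*_)
open import Data.Bool using (Bool; true; false; if_then_else_)
open import Data.Nat using (_≡ᵇ_)

Series : Set
Series = ℕ → ℤ

sumTo : (ℕ → ℤ) → ℕ → ℤ
sumTo f zero    = f zero
sumTo f (suc n) = sumTo f n + f (suc n)

_⊛_ : Series → Series → Series
(f ⊛ g) n = sumTo (λ k → f k * g (n ∸ k)) n

one : Series
one zero    = + 1
one (suc _) = + 0

_^ˢ_ : Series → ℕ → Series
f ^ˢ zero  = one
f ^ˢ suc r = f ⊛ (f ^ˢ r)

binom : ℤ → ℕ → Series
binom c d zero    = + 1
binom c d (suc n) = if (suc n ≡ᵇ d) then c else + 0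

-- 1/(1 - q^(suc k)) = Σ_j q^{(k+1) j}
invOneMinus : ℕ → Series
invOneMinus k n = if (n % suc k ≡ᵇ 0) then + 1 else + 0

-- 1/(1 + q^(suc k)) = Σ_j (-1)^j q^{(k+1) j}
invOnePlus : ℕ → Series
invOnePlus k n =
  if (n % suc k ≡ᵇ 0)
  then (if ((n ℕ./ suc k) % 2 ≡ᵇ 0) then + 1 else - (+ 1))
  else + 0

factor : ℕ → Series
factor j =
  binom (+ 1) d ⊛ (binom (- (+ 1)) (3 ℕ.* d)
    ⊛ (invOnePlus (3 ℕ.* d ∸ 1) ⊛ invOneMinus (d ∸ 1)))
  where d = suc (2 ℕ.* j)

partialProd : ℕ → ℕ → Series
partialProd r zero    = one
partialProd r (suc N) = (factor N ^ˢ r) ⊛ partialProd r N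

-- S̄_3^r(n): coefficient of q^n in ∏_{n≥1} [(1+q^{2n-1})(1-q^{3(2n-1)})/((1+q^{3(2n-1)})(1-q^{2n-1}))]^r.
-- Factors with 2j+1 > n are ≡ 1 mod q^{n+1}, so the product over j < n
-- (covering all odd d ≤ n) has the same n-th coefficient as the infinite product.
S3bar : ℕ → ℕ → ℤ
S3bar r n = partialProd r n n

{-# OPTIONS --safe #-}
module Submission where

-- Gauss's product for φ(-q) = Σ (-q)^{n²} gives S(q) = φ(q) φ(-q³) / (φ(-q²) φ(-q⁶)). Identities between
-- binary theta series, each a change of variables on a sublattice of ℤ², dissect this into
-- Σ S(12n+7) qⁿ ≡ 8 ψ(q²) φ(-q) E(q⁴)² (mod 32), where E is the pentagonal series, i.e. Euler's product.
-- With E(q)² = φ(-q) E(q²), ψ(q) E(q) = E(q²)² and φ(-q)² ≡ 1 (mod 4), the two halves become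
-- 8 ψ(q) E(q⁴) at 24n+7 and 16 ψ(q) E(q¹⁶) at 24n+19, modulo 32, which live on the numbers 3x² + 4y².
-- A prime p ≡ 2 (mod 3) divides such a number to an even power, since -3 is not a square mod p.
-- Finally S ≡ 1 (mod 2) gives S^{16m} ≡ 1 (mod 32), which reduces the exponent 16m+1 to 1.

open import Defs
open import Data.Nat using (ℕ; _+_; _*_; _^_; _%_; _∸_; _≤_)
open import Data.Nat.Primality using (Prime)
open import Data.Integer using (+_)
open import Data.Integer.Divisibility using (_∣_)
open import Data.Product using (_×_)
open import Relation.Binary.PropositionalEquality using (_≡_)

open import Algebra.Bundles using (CommutativeRing)
import Algebra.Solver.Ring
import Algebra.Solver.Ring.AlmostCommutativeRing as ACR
open import Data.Bool using (true; false; if_then_else_)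
open import Data.Empty using (⊥-elim)
open import Data.Integer as ℤ using (ℤ; -_; -[1+_]; ∣_∣)
import Data.Integer.DivMod as ℤDM
open import Data.Integer.Divisibility.Signed as Sgn using (divides) renaming (_∣_ to _∣ˢ_)
import Data.Integer.Properties as ℤₚ
open import Data.Integer.Tactic.RingSolver using () renaming (solve-∀ to ℤ-ring)
open import Data.Maybe using (Maybe; just; nothing)
open import Data.Nat as ℕ using (zero; suc; z≤n; s≤s; NonZero; _≡ᵇ_; _<_)
open import Data.Nat.Combinatorics using (nCn≡1; nC1≡n; nCk+nC[k+1]≡[n+1]C[k+1]) renaming (_C_ to choose)
open import Data.Nat.Combinatorics.Specification using (k>n⇒nCk≡0)
import Data.Nat.Divisibility as ℕ∣
import Data.Nat.DivMod as DM
open import Data.Nat.Induction using (<-rec)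
open import Data.Nat.Primality using (euclidsLemma; ¬prime[0])
import Data.Nat.Properties as ℕₚ
open import Data.Nat.Tactic.RingSolver using () renaming (solve-∀ to ℕ-ring)
open import Data.Product using (_,_; proj₁; proj₂; ∃)
open import Data.Sum using (_⊎_; inj₁; inj₂; [_,_]′)
open import Defs using () renaming (_⊛_ to infixl 7 _·_)
open import Relation.Binary.Bundles using (Setoid)
open import Relation.Binary.PropositionalEquality using (_≢_; refl; sym; trans; cong; cong₂; subst; module ≡-Reasoning)
import Relation.Binary.Reasoning.Setoid as SetoidReasoning
open import Relation.Nullary using (¬_; yes; no)

-- The ring of formal power series

-- The obstacle is that `U d r` respects multiplication by a series in q^d but not division, while S
-- is a quotient. So before each dissection the relation for S is multiplied out and rearranged
-- until the cofactor of S is a series in q^d: φ(q)φ(-q) = φ(-q²)² and ψ(-q)φ(-q²) = ψ(q)φ(-q)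
-- achieve this for d = 2, and the norm p³ - 8q³w³ of φ(-q) = p - 2qw achieves it for d = 3. No
-- theta series is ever inverted: an identity is proved after multiplication by a series with
-- nonzero constant term, which is then cancelled. The modulus is 32 = 8 · 4. The 8 is an exact
-- divisor over ℤ: one factor 2 comes from the odd parts of the theta functions, one from the
-- 3-dissection, one from the symmetrised identity `φΩ-E²`. The 4 is a congruence for `S₇` / 8,
-- resting on φ(-q)² ≡ 1 (mod 4).

infixl 6 _⊕_
infix 8 ⊖_
infix 4 _≈_

_⊕_ : Series → Series → Series
(f ⊕ g) n = f n ℤ.+ g n

⊖_ : Series → Series
(⊖ f) n = ℤ.- f n

const : ℤ → Series
const c zero    = c
const c (suc _) = + 0

tail : Series → Series
tail f n = f (suc n)

-- A record rather than a bare Π-type, so that unification can recover `f` and `g` from a proof.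
record _≈_ (f g : Series) : Set where
  constructor mk
  field at : ∀ n → f n ≡ g n
open _≈_ public

≈-refl : ∀ {f} → f ≈ f
≈-refl = mk λ _ → refl

≈-sym : ∀ {f g} → f ≈ g → g ≈ f
≈-sym p = mk λ n → sym (at p n)

≈-trans : ∀ {f g h} → f ≈ g → g ≈ h → f ≈ h
≈-trans p q = mk λ n → trans (at p n) (at q n)

sumTo-cong : ∀ {f g} n → (∀ k → k ≤ n → f k ≡ g k) → sumTo f n ≡ sumTo g n
sumTo-cong zero    h = h 0 z≤n
sumTo-cong (suc n) h =
  cong₂ ℤ._+_ (sumTo-cong n λ k k≤n → h k (ℕₚ.m≤n⇒m≤1+n k≤n)) (h (suc n) ℕₚ.≤-refl)

sumTo-0 : ∀ {f} n → (∀ k → k ≤ n → f k ≡ + 0) → sumTo f n ≡ + 0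
sumTo-0 zero    h = h 0 z≤n
sumTo-0 (suc n) h =
  cong₂ ℤ._+_ (sumTo-0 n λ k k≤n → h k (ℕₚ.m≤n⇒m≤1+n k≤n)) (h (suc n) ℕₚ.≤-refl)

sumTo-+ : ∀ f g n → sumTo (λ k → f k ℤ.+ g k) n ≡ sumTo f n ℤ.+ sumTo g n
sumTo-+ f g zero    = refl
sumTo-+ f g (suc n) = trans (cong (ℤ._+ (f (suc n) ℤ.+ g (suc n))) (sumTo-+ f g n)) (lem (sumTo f n) _ _ _)
  where lem : ∀ a b c d → a ℤ.+ b ℤ.+ (c ℤ.+ d) ≡ a ℤ.+ c ℤ.+ (b ℤ.+ d)
        lem = ℤ-ring

sumTo-* : ∀ c f n → sumTo (λ k → c ℤ.* f k) n ≡ c ℤ.* sumTo f n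
sumTo-* c f zero    = refl
sumTo-* c f (suc n) = trans (cong (ℤ._+ (c ℤ.* f (suc n))) (sumTo-* c f n)) (sym (ℤₚ.*-distribˡ-+ c _ _))

sumTo-first : ∀ f n → sumTo f (suc n) ≡ f 0 ℤ.+ sumTo (λ k → f (suc k)) n
sumTo-first f zero    = refl
sumTo-first f (suc n) =
  trans (cong (ℤ._+ f (suc (suc n))) (sumTo-first f n)) (ℤₚ.+-assoc (f 0) _ _)

-- With `·-sucʳ` this turns the convolution into a recursion on the coefficient index, so that
-- commutativity and associativity follow by induction, without reindexing double sums.
·-suc : ∀ f g n → (f · g) (suc n) ≡ f 0 ℤ.* g (suc n) ℤ.+ (tail f · g) n
·-suc f g n = sumTo-first (λ k → f k ℤ.* g (suc n ∸ k)) n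

·-sucʳ : ∀ f g n → (f · g) (suc n) ≡ (f · tail g) n ℤ.+ f (suc n) ℤ.* g 0
·-sucʳ f g n = cong₂ ℤ._+_
  (sumTo-cong n λ k k≤n → cong (λ i → f k ℤ.* g i) (ℕₚ.+-∸-assoc 1 k≤n))
  (cong (λ i → f (suc n) ℤ.* g i) (ℕₚ.n∸n≡0 n))

-- The modulus M = 0 gives equality.
·-mod : ∀ M {f f′ g g′} n →
  (∀ k → k ≤ n → M ∣ˢ (f k ℤ.- f′ k)) → (∀ k → k ≤ n → M ∣ˢ (g k ℤ.- g′ k)) →
  M ∣ˢ ((f · g) n ℤ.- (f′ · g′) n)
·-mod M {f} {f′} {g} {g′} n p q = go n n ℕₚ.≤-refl
  where
  lem : ∀ a b c d → a ℤ.* c ℤ.- b ℤ.* d ≡ (a ℤ.- b) ℤ.* c ℤ.+ b ℤ.* (c ℤ.- d)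
  lem = ℤ-ring
  lem₂ : ∀ a b c d → (a ℤ.+ b) ℤ.- (c ℤ.+ d) ≡ (a ℤ.- c) ℤ.+ (b ℤ.- d)
  lem₂ = ℤ-ring
  term : ∀ k → k ≤ n → M ∣ˢ (f k ℤ.* g (n ∸ k) ℤ.- f′ k ℤ.* g′ (n ∸ k))
  term k k≤n = subst (M ∣ˢ_) (sym (lem (f k) (f′ k) _ _))
    (Sgn.∣m∣n⇒∣m+n (Sgn.∣m⇒∣m*n (g (n ∸ k)) (p k k≤n))
                   (Sgn.∣n⇒∣m*n (f′ k) (q (n ∸ k) (ℕₚ.m∸n≤m n k))))
  go : ∀ m j → j ≤ n → M ∣ˢ (sumTo (λ k → f k ℤ.* g (n ∸ k)) j ℤ.- sumTo (λ k → f′ k ℤ.* g′ (n ∸ k)) j)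
  go m zero    j≤n = term 0 j≤n
  go m (suc j) j≤n = subst (M ∣ˢ_)
    (sym (lem₂ (sumTo (λ k → f k ℤ.* g (n ∸ k)) j) _ (sumTo (λ k → f′ k ℤ.* g′ (n ∸ k)) j) _))
    (Sgn.∣m∣n⇒∣m+n (go m j (ℕₚ.<⇒≤ j≤n)) (term (suc j) j≤n))

·-cong-≤ : ∀ {f f′ g g′} n → (∀ k → k ≤ n → f k ≡ f′ k) → (∀ k → k ≤ n → g k ≡ g′ k) →
  (f · g) n ≡ (f′ · g′) n
·-cong-≤ n p q = sumTo-cong n λ k k≤n → cong₂ ℤ._*_ (p k k≤n) (q (n ∸ k) (ℕₚ.m∸n≤m n k))

·-cong : ∀ {f f′ g g′} → f ≈ f′ → g ≈ g′ → f · g ≈ f′ · g′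
·-cong p q = mk λ n → ·-cong-≤ n (λ k _ → at p k) (λ k _ → at q k)

⊕-cong : ∀ {f f′ g g′} → f ≈ f′ → g ≈ g′ → f ⊕ g ≈ f′ ⊕ g′
⊕-cong p q = mk λ n → cong₂ ℤ._+_ (at p n) (at q n)

·-congˡ : ∀ g {f f′} → f ≈ f′ → f · g ≈ f′ · g
·-congˡ g p = ·-cong {g = g} p ≈-refl

·-congʳ : ∀ f {g g′} → g ≈ g′ → f · g ≈ f · g′
·-congʳ f p = ·-cong {f = f} ≈-refl p

⊕-congˡ : ∀ g {f f′} → f ≈ f′ → f ⊕ g ≈ f′ ⊕ g
⊕-congˡ g p = ⊕-cong {g = g} p ≈-refl

⊕-congʳ : ∀ f {g g′} → g ≈ g′ → f ⊕ g ≈ f ⊕ g′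
⊕-congʳ f p = ⊕-cong {f = f} ≈-refl p

⊖-cong : ∀ {f g} → f ≈ g → ⊖ f ≈ ⊖ g
⊖-cong p = mk λ n → cong ℤ.-_ (at p n)

·-comm : ∀ f g → f · g ≈ g · f
·-comm f g = mk (go f g)
  where
  go : ∀ f g n → (f · g) n ≡ (g · f) n
  go f g zero    = ℤₚ.*-comm (f 0) (g 0)
  go f g (suc n) = begin
    (f · g) (suc n)                            ≡⟨ ·-suc f g n ⟩
    f 0 ℤ.* g (suc n) ℤ.+ (tail f · g) n       ≡⟨ cong₂ ℤ._+_ (ℤₚ.*-comm (f 0) _) (go (tail f) g n) ⟩
    g (suc n) ℤ.* f 0 ℤ.+ (g · tail f) n       ≡⟨ ℤₚ.+-comm (g (suc n) ℤ.* f 0) _ ⟩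
    (g · tail f) n ℤ.+ g (suc n) ℤ.* f 0       ≡⟨ ·-sucʳ g f n ⟨
    (g · f) (suc n)                            ∎
    where open ≡-Reasoning

·-distribʳ : ∀ h f g → (f ⊕ g) · h ≈ f · h ⊕ g · h
·-distribʳ h f g = mk λ n → trans
  (sumTo-cong n λ k _ → ℤₚ.*-distribʳ-+ (h (n ∸ k)) (f k) (g k)) (sumTo-+ _ _ n)

·-distribˡ : ∀ h f g → h · (f ⊕ g) ≈ h · f ⊕ h · g
·-distribˡ h f g = ≈-trans (·-comm h (f ⊕ g))
  (≈-trans (·-distribʳ h f g) (⊕-cong (·-comm f h) (·-comm g h)))

·-assoc : ∀ f g h → (f · g) · h ≈ f · (g · h)
·-assoc f g h = mk (go f g h)
  where
  scale : ∀ c f g n → ((λ k → c ℤ.* f k) · g) n ≡ c ℤ.* (f · g) n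
  scale c f g n = trans (sumTo-cong n λ k _ → ℤₚ.*-assoc c (f k) _) (sumTo-* c _ n)
  lem : ∀ a b c d e → a ℤ.* b ℤ.* c ℤ.+ (a ℤ.* d ℤ.+ e) ≡ a ℤ.* (b ℤ.* c ℤ.+ d) ℤ.+ e
  lem = ℤ-ring
  go : ∀ f g h n → ((f · g) · h) n ≡ (f · (g · h)) n
  go f g h zero    = ℤₚ.*-assoc (f 0) (g 0) (h 0)
  go f g h (suc n) = begin
    ((f · g) · h) (suc n)
      ≡⟨ ·-suc (f · g) h n ⟩
    f 0 ℤ.* g 0 ℤ.* h (suc n) ℤ.+ (tail (f · g) · h) n
      ≡⟨ cong (λ z → f 0 ℤ.* g 0 ℤ.* h (suc n) ℤ.+ z) (begin
        (tail (f · g) · h) n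
          ≡⟨ at (·-cong {g = h} (mk (·-suc f g)) ≈-refl) n ⟩
        (((λ k → f 0 ℤ.* tail g k) ⊕ tail f · g) · h) n
          ≡⟨ at (·-distribʳ h (λ k → f 0 ℤ.* tail g k) (tail f · g)) n ⟩
        ((λ k → f 0 ℤ.* tail g k) · h) n ℤ.+ ((tail f · g) · h) n
          ≡⟨ cong₂ ℤ._+_ (scale (f 0) (tail g) h n) (go (tail f) g h n) ⟩
        f 0 ℤ.* (tail g · h) n ℤ.+ (tail f · (g · h)) n ∎) ⟩
    f 0 ℤ.* g 0 ℤ.* h (suc n) ℤ.+ (f 0 ℤ.* (tail g · h) n ℤ.+ (tail f · (g · h)) n)
      ≡⟨ lem (f 0) (g 0) (h (suc n)) _ _ ⟩
    f 0 ℤ.* (g 0 ℤ.* h (suc n) ℤ.+ (tail g · h) n) ℤ.+ (tail f · (g · h)) n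
      ≡⟨ cong (λ z → f 0 ℤ.* z ℤ.+ (tail f · (g · h)) n) (·-suc g h n) ⟨
    f 0 ℤ.* (g · h) (suc n) ℤ.+ (tail f · (g · h)) n
      ≡⟨ ·-suc f (g · h) n ⟨
    (f · (g · h)) (suc n) ∎
    where open ≡-Reasoning

const-· : ∀ c f n → (const c · f) n ≡ c ℤ.* f n
const-· c f zero    = refl
const-· c f (suc n) = trans (·-suc (const c) f n) (trans
  (cong (λ z → c ℤ.* f (suc n) ℤ.+ z) (sumTo-0 n λ _ _ → refl)) (ℤₚ.+-identityʳ _))

one≈const1 : one ≈ const (+ 1)
one≈const1 = mk λ { zero → refl ; (suc _) → refl }

·-identityˡ : ∀ f → const (+ 1) · f ≈ f
·-identityˡ f = mk λ n → trans (const-· (+ 1) f n) (ℤₚ.*-identityˡ (f n))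

seriesRing : CommutativeRing _ _
seriesRing = record
  { Carrier = Series ; _≈_ = _≈_ ; _+_ = _⊕_ ; _*_ = _·_ ; -_ = ⊖_
  ; 0# = const (+ 0) ; 1# = const (+ 1)
  ; isCommutativeRing = record
    { isRing = record
      { +-isAbelianGroup = record
        { isGroup = record
          { isMonoid = record
            { isSemigroup = record
              { isMagma = record
                { isEquivalence = record { refl = ≈-refl ; sym = ≈-sym ; trans = ≈-trans }
                ; ∙-cong = ⊕-cong }
              ; assoc = λ f g h → mk λ n → ℤₚ.+-assoc (f n) (g n) (h n) }
            ; identity = (λ f → mk λ n → trans (cong (λ z → z ℤ.+ f n) (const0 n)) (ℤₚ.+-identityˡ (f n)))
                       , (λ f → mk λ n → trans (cong (λ z → f n ℤ.+ z) (const0 n)) (ℤₚ.+-identityʳ (f n))) }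
          ; inverse = (λ f → mk λ n → trans (ℤₚ.+-inverseˡ (f n)) (sym (const0 n)))
                    , (λ f → mk λ n → trans (ℤₚ.+-inverseʳ (f n)) (sym (const0 n)))
          ; ⁻¹-cong = ⊖-cong }
        ; comm = λ f g → mk λ n → ℤₚ.+-comm (f n) (g n) }
      ; *-cong = ·-cong
      ; *-assoc = ·-assoc
      ; *-identity = ·-identityˡ , (λ f → ≈-trans (·-comm f (const (+ 1))) (·-identityˡ f))
      ; distrib = ·-distribˡ , ·-distribʳ }
    ; *-comm = ·-comm } }
  where
  const0 : ∀ n → const (+ 0) n ≡ + 0
  const0 zero    = refl
  const0 (suc _) = refl

module RingSeries = CommutativeRing seriesRing

-- Lets the ring solver take coefficients in ℤ, so that numerals such as `con (+ 8)` are computed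
-- with.
const-homo : ℤ.+-*-rawRing ACR.-Raw-AlmostCommutative⟶ ACR.fromCommutativeRing seriesRing
const-homo = record
  { ⟦_⟧    = const
  ; +-homo = λ _ _ → mk λ { zero → refl ; (suc _) → refl }
  ; *-homo = λ x y → mk λ { zero → refl ; (suc n) → sym (trans (const-· x (const y) (suc n)) (ℤₚ.*-zeroʳ x)) }
  ; -‿homo = λ _ → mk λ { zero → refl ; (suc _) → refl }
  ; 0-homo = ≈-refl
  ; 1-homo = ≈-refl
  }

const-≟ : ∀ x y → Maybe (const x ≈ const y)
const-≟ x y with x ℤₚ.≟ y
... | yes refl = just ≈-refl
... | no  _    = nothing

module SeriesSolver = Algebra.Solver.Ring ℤ.+-*-rawRing (ACR.fromCommutativeRing seriesRing) const-homo const-≟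

open SeriesSolver using (solve; _:*_; _:+_; :-_; con; _:=_)

module ≈-Reasoning = SetoidReasoning RingSeries.setoid

-- Congruences, cancellation and dissection

infix 4 _≈_[mod_]

record _≈_[mod_] (f g : Series) (M : ℤ) : Set where
  constructor mkMod
  field atMod : ∀ n → M ∣ˢ (f n ℤ.- g n)
open _≈_[mod_] public

∣0 : ∀ {M} → M ∣ˢ + 0
∣0 = divides (+ 0) refl

≡⇒∣- : ∀ {M a b} → a ≡ b → M ∣ˢ (a ℤ.- b)
≡⇒∣- {a = a} refl = subst (_ ∣ˢ_) (sym (ℤₚ.+-inverseʳ a)) ∣0

≈⇒mod : ∀ {M f g} → f ≈ g → f ≈ g [mod M ]
≈⇒mod p = mkMod λ n → ≡⇒∣- (at p n)

modSetoid : ℤ → Setoid _ _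
modSetoid M = record
  { Carrier = Series ; _≈_ = λ f g → f ≈ g [mod M ]
  ; isEquivalence = record
    { refl  = ≈⇒mod ≈-refl
    ; sym   = λ {f} {g} p → mkMod λ n → subst (M ∣ˢ_) (lem (f n) (g n)) (Sgn.∣m⇒∣-m (atMod p n))
    ; trans = λ {f} {g} {h} p q → mkMod λ n →
        subst (M ∣ˢ_) (lem₂ (f n) (g n) (h n)) (Sgn.∣m∣n⇒∣m+n (atMod p n) (atMod q n)) } }
  where
  lem : ∀ a b → - (a ℤ.- b) ≡ b ℤ.- a
  lem = ℤ-ring
  lem₂ : ∀ a b c → (a ℤ.- b) ℤ.+ (b ℤ.- c) ≡ a ℤ.- c
  lem₂ = ℤ-ring

mod-trans : ∀ {M f g h} → f ≈ g [mod M ] → g ≈ h [mod M ] → f ≈ h [mod M ]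
mod-trans {M} = Setoid.trans (modSetoid M)

mod-refl : ∀ {M f} → f ≈ f [mod M ]
mod-refl = ≈⇒mod ≈-refl

·-cong-mod : ∀ {M f f′ g g′} → f ≈ f′ [mod M ] → g ≈ g′ [mod M ] → f · g ≈ f′ · g′ [mod M ]
·-cong-mod {M} {f} {f′} {g} {g′} p q = mkMod λ n → ·-mod M {f} {f′} {g} {g′} n (λ k _ → atMod p k) (λ k _ → atMod q k)

multiple⇒mod : ∀ {f g} M h → f ≈ g ⊕ const M · h → f ≈ g [mod M ]
multiple⇒mod {f} {g} M h p = mkMod λ n → divides (h n) (trans
  (cong (ℤ._- g n) (trans (at p n) (cong (λ z → g n ℤ.+ z) (const-· M h n)))) (lem (g n) M (h n)))
  where lem : ∀ a b c → a ℤ.+ b ℤ.* c ℤ.- a ≡ c ℤ.* b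
        lem = ℤ-ring

mod⇒multiple : ∀ {M f g} → f ≈ g [mod M ] → ∃ λ h → f ≈ g ⊕ const M · h
mod⇒multiple {M} {f} {g} p = h , mk λ n →
  trans (lem (f n) (g n) (Sgn._∣_.equality (atMod p n))) (cong (λ z → g n ℤ.+ z) (sym (const-· M h n)))
  where
  h : Series
  h n = Sgn._∣_.quotient (atMod p n)
  lem₁ : ∀ a b → a ≡ b ℤ.+ (a ℤ.- b)
  lem₁ = ℤ-ring
  lem : ∀ a b {x} → a ℤ.- b ≡ x ℤ.* M → a ≡ b ℤ.+ M ℤ.* x
  lem a b {x} e = trans (lem₁ a b) (cong (λ z → b ℤ.+ z) (trans e (ℤₚ.*-comm x M)))

const-zero : ∀ n → const (+ 0) n ≡ + 0
const-zero zero    = refl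
const-zero (suc _) = refl

-- Every other summand of the convolution contains a coefficient of `f` below `n`. This is the
-- inductive step of all the cancellation lemmas; `M = + 0` makes it exact.
·-leading : ∀ M {f} D n → (∀ k → k < n → M ∣ˢ f k) → M ∣ˢ ((f · D) n ℤ.- f n ℤ.* D 0)
·-leading M {f} D zero    h = ≡⇒∣- {a = f 0 ℤ.* D 0} refl
·-leading M {f} D (suc n) h = subst (M ∣ˢ_)
  (sym (trans (cong (ℤ._- f (suc n) ℤ.* D 0) (·-sucʳ f D n)) (lem ((f · tail D) n) _)))
  (subst (M ∣ˢ_) (trans (cong (λ z → (f · tail D) n ℤ.- z) zeros) (ℤₚ.+-identityʳ ((f · tail D) n)))
    (·-mod M {f} {const (+ 0)} {tail D} {tail D} n (λ k k≤n → subst (M ∣ˢ_) (lem₀ k) (h k (s≤s k≤n))) (λ k _ → ≡⇒∣- {a = tail D k} refl)))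
  where
  lem : ∀ a b → a ℤ.+ b ℤ.- b ≡ a
  lem = ℤ-ring
  lem₀ : ∀ k → f k ≡ f k ℤ.- const (+ 0) k
  lem₀ k = sym (trans (cong (λ z → f k ℤ.- z) (const-zero k)) (ℤₚ.+-identityʳ (f k)))
  zeros : (const (+ 0) · tail D) n ≡ + 0
  zeros = trans (const-· (+ 0) (tail D) n) refl

-- A series with constant term 1 is a unit of ℤ[[q]]; strong induction on the coefficient stands in
-- for its inverse.
∣-unit-cancel : ∀ M {f} D → D 0 ≡ + 1 → (∀ n → M ∣ˢ (f · D) n) → ∀ n → M ∣ˢ f n
∣-unit-cancel M {f} D D0 h = <-rec (λ n → M ∣ˢ f n) step
  where
  lem : ∀ a b → a ℤ.- (a ℤ.- b ℤ.* + 1) ≡ b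
  lem = ℤ-ring
  step : ∀ n → (∀ {k} → k < n → M ∣ˢ f k) → M ∣ˢ f n
  step n ih = subst (M ∣ˢ_) (lem ((f · D) n) (f n))
    (Sgn.∣m∣n⇒∣m-n (h n) (subst (λ d → M ∣ˢ ((f · D) n ℤ.- f n ℤ.* d)) D0 (·-leading M D n λ k k<n → ih k<n)))

mod-cancel : ∀ {M f g} D → D 0 ≡ + 1 → f · D ≈ g · D [mod M ] → f ≈ g [mod M ]
mod-cancel {M} {f} {g} D D0 p = mkMod (∣-unit-cancel M {f ⊕ ⊖ g} D D0 λ n →
  subst (M ∣ˢ_) (sym (at (solve 3 (λ f g D → (f :+ (:- g)) :* D := f :* D :+ (:- (g :* D))) ≈-refl f g D) n)) (atMod p n))

-- Over ℤ any nonzero constant term will do, as ℤ has no zero divisors; `square-injective` uses this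
-- with constant term 2.
·-zero-cancel : ∀ {f} D → D 0 ≢ + 0 → (∀ n → (f · D) n ≡ + 0) → ∀ n → f n ≡ + 0
·-zero-cancel {f} D D0 h = <-rec (λ n → f n ≡ + 0) step
  where
  step : ∀ n → (∀ {k} → k < n → f k ≡ + 0) → f n ≡ + 0
  step n ih with ℤₚ.i*j≡0⇒i≡0∨j≡0 (f n) (trans (sym (ℤₚ.i-j≡0⇒i≡j _ _
        (Sgn.0∣⇒≡0 (·-leading (+ 0) {f} D n λ k k<n → subst (+ 0 ∣ˢ_) (sym (ih k<n)) ∣0)))) (h n))
  ... | inj₁ e = e
  ... | inj₂ e = ⊥-elim (D0 e)

·-cancel : ∀ {f g} D → D 0 ≢ + 0 → f · D ≈ g · D → f ≈ g
·-cancel {f} {g} D D0 p = mk λ n → ℤₚ.i-j≡0⇒i≡j _ _ (·-zero-cancel {f ⊕ ⊖ g} D D0 (λ n → trans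
  (at (solve 3 (λ f g D → (f :+ (:- g)) :* D := f :* D :+ (:- (g :* D))) ≈-refl f g D) n)
  (trans (cong (ℤ._- (g · D) n) (at p n)) (ℤₚ.+-inverseʳ ((g · D) n)))) n)

X : Series
X (suc zero) = + 1
X _          = + 0

X·-suc : ∀ f n → (X · f) (suc n) ≡ f n
X·-suc f n = trans (·-suc X f n) (trans (ℤₚ.+-identityˡ ((tail X · f) n))
  (trans (·-cong-≤ {tail X} {const (+ 1)} {f} {f} n (λ { zero _ → refl ; (suc _) _ → refl }) (λ _ _ → refl))
    (at (·-identityˡ f) n)))

-- U d r extracts the coefficients at the exponents r + d n, and dil d is q ↦ q^d.
U : ℕ → ℕ → Series → Series
U d r f n = f (r + n * d)

U-cong : ∀ d r {f g} → f ≈ g → U d r f ≈ U d r g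
U-cong d r p = mk λ n → at p (r + n * d)

U-cong-mod : ∀ {M} d r {f g} → f ≈ g [mod M ] → U d r f ≈ U d r g [mod M ]
U-cong-mod d r p = mkMod λ n → atMod p (r + n * d)

U-ext : ∀ d .{{_ : NonZero d}} {f g} → (∀ r → r < d → U d r f ≈ U d r g) → f ≈ g
U-ext d {f} {g} h = mk λ n → subst (λ m → f m ≡ g m) (sym (DM.m≡m%n+[m/n]*n n d))
  (at (h (n DM.% d) (DM.m%n<n n d)) (n DM./ d))

dil : (d : ℕ) → .{{_ : NonZero d}} → Series → Series
dil d f n = if n DM.% d ≡ᵇ 0 then f (n DM./ d) else + 0

U₀-dil : ∀ d .{{_ : NonZero d}} f → U d 0 (dil d f) ≈ f
U₀-dil d f = mk λ n → trans
  (cong (λ b → if b ≡ᵇ 0 then f (n * d DM./ d) else + 0) (DM.m*n%n≡0 n d))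
  (cong f (DM.m*n/n≡m n d))

dil-off : ∀ d .{{_ : NonZero d}} f {r} → r < d → r ≢ 0 → ∀ n → dil d f (r + n * d) ≡ + 0
dil-off d f {zero}  r<d r≢0 n = ⊥-elim (r≢0 refl)
dil-off d f {suc r} r<d r≢0 n = cong (λ b → if b ≡ᵇ 0 then f ((suc r + n * d) DM./ d) else + 0)
  (trans (DM.[m+kn]%n≡m%n (suc r) n d) (DM.m<n⇒m%n≡m r<d))

Uᵣ-dil : ∀ d .{{_ : NonZero d}} f {r} → r < d → r ≢ 0 → U d r (dil d f) ≈ const (+ 0)
Uᵣ-dil d f r<d r≢0 = mk λ n → trans (dil-off d f r<d r≢0 n) (sym (const-zero n))

sumTo-multiples : ∀ d .{{_ : NonZero d}} (g : ℕ → ℤ) →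
  (∀ r → r < d → r ≢ 0 → ∀ n → g (r + n * d) ≡ + 0) →
  ∀ r n → r < d → sumTo g (r + n * d) ≡ sumTo (λ j → g (j * d)) n
sumTo-multiples d       g off (suc r) n       r<d =
  trans (cong₂ ℤ._+_ (sumTo-multiples d g off r n (ℕₚ.<⇒≤ r<d)) (off (suc r) r<d (λ ()) n)) (ℤₚ.+-identityʳ _)
sumTo-multiples d       g off zero    zero    r<d = refl
-- The index just below `suc n * suc d` is `d + n * suc d`, the top remainder of the preceding
-- block.
sumTo-multiples (suc d) g off zero    (suc n) r<d =
  cong (ℤ._+ g (suc n * suc d)) (sumTo-multiples (suc d) g off d n ℕₚ.≤-refl)

-- The left factor has only exponents divisible by `d`, so it does not mix residue classes. This is
-- what lets a denominator in q^d pass through a dissection.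
U-dil· : ∀ d .{{_ : NonZero d}} g f {r} → r < d → U d r (dil d g · f) ≈ g · U d r f
U-dil· d g f {r} r<d = mk λ n → trans
  (sumTo-multiples d (λ k → dil d g k ℤ.* f (r + n * d ∸ k))
    (λ s s<d s≢0 m → cong (ℤ._* f (r + n * d ∸ (s + m * d))) (dil-off d g s<d s≢0 m)) r n r<d)
  (sumTo-cong n λ j j≤n → cong₂ ℤ._*_ (at (U₀-dil d g) j) (cong f (idx n j j≤n)))
  where
  idx : ∀ n j → j ≤ n → r + n * d ∸ j * d ≡ r + (n ∸ j) * d
  idx n j j≤n = trans (ℕₚ.+-∸-assoc r (ℕₚ.*-monoˡ-≤ d j≤n)) (cong (r ℕ.+_) (sym (ℕₚ.*-distribʳ-∸ d n j)))

·-zeroʳ : ∀ f → f · const (+ 0) ≈ const (+ 0)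
·-zeroʳ f = RingSeries.zeroʳ f

-- A series is determined by its `d` sections. Multiplicativity and composition of `dil` are checked
-- section by section in this way, without unfolding division with remainder.
dil-char : ∀ d .{{_ : NonZero d}} {f h} → U d 0 h ≈ f → (∀ r → r < d → r ≢ 0 → U d r h ≈ const (+ 0)) → h ≈ dil d f
dil-char d {f} {h} p q = U-ext d go
  where
  go : ∀ r → r < d → U d r h ≈ U d r (dil d f)
  go zero    r<d = ≈-trans p (≈-sym (U₀-dil d f))
  go (suc r) r<d = ≈-trans (q (suc r) r<d (λ ())) (≈-sym (Uᵣ-dil d f r<d (λ ())))

dil-cong : ∀ d .{{_ : NonZero d}} {f g} → f ≈ g → dil d f ≈ dil d g
dil-cong d p = mk λ n → cong (λ z → if n DM.% d ≡ᵇ 0 then z else + 0) (at p (n DM./ d))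

dil-· : ∀ d .{{_ : NonZero d}} f g → dil d (f · g) ≈ dil d f · dil d g
dil-· d f g = ≈-sym (dil-char d
  (≈-trans (U-dil· d f (dil d g) (ℕ.>-nonZero⁻¹ d)) (·-cong {f = f} ≈-refl (U₀-dil d g)))
  (λ r r<d r≢0 → ≈-trans (U-dil· d f (dil d g) r<d)
    (≈-trans (·-cong {f = f} ≈-refl (Uᵣ-dil d g r<d r≢0)) (·-zeroʳ f))))

dil-⊕ : ∀ d .{{_ : NonZero d}} f g → dil d (f ⊕ g) ≈ dil d f ⊕ dil d g
dil-⊕ d f g = mk λ n → lem (n DM.% d ≡ᵇ 0) (n DM./ d)
  where lem : ∀ b m → (if b then f m ℤ.+ g m else + 0) ≡ (if b then f m else + 0) ℤ.+ (if b then g m else + 0)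
        lem true  m = refl
        lem false m = refl

dil-⊖ : ∀ d .{{_ : NonZero d}} f → dil d (⊖ f) ≈ ⊖ dil d f
dil-⊖ d f = mk λ n → lem (n DM.% d ≡ᵇ 0) (n DM./ d)
  where lem : ∀ b m → (if b then ℤ.- f m else + 0) ≡ ℤ.- (if b then f m else + 0)
        lem true  m = refl
        lem false m = refl

dil-const : ∀ d .{{_ : NonZero d}} c → dil d (const c) ≈ const c
dil-const d c = ≈-sym (dil-char d {const c} {const c} (mk λ { zero → refl ; (suc n) → lem n })
  λ { zero _ r≢0 → ⊥-elim (r≢0 refl) ; (suc r) _ _ → mk λ n → sym (const-zero n) })
  where
  lem : ∀ n → const c (suc n * d) ≡ + 0
  lem n with suc n * d | ℕₚ.m*n≢0 (suc n) d
  ... | suc _ | _ = refl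

dil-dil : ∀ a b .{{_ : NonZero a}} .{{_ : NonZero b}} .{{_ : NonZero (b * a)}} f → dil a (dil b f) ≈ dil (b * a) f
dil-dil a b f = ≈-sym (dil-char a
  (dil-char b
    (mk λ m → trans (cong (dil (b * a) f) (ℕₚ.*-assoc m b a)) (at (U₀-dil (b * a) f) m))
    (λ s s<b s≢0 → mk λ m → trans (off 0 s (inj₂ s≢0) (ℕ.>-nonZero⁻¹ a) s<b m) (sym (const-zero m))))
  (λ r r<a r≢0 → U-ext b λ s s<b → mk λ m → trans (off r s (inj₁ r≢0) r<a s<b m) (sym (const-zero (s + m * b)))))
  where

  nz : ∀ r s → r ≢ 0 ⊎ s ≢ 0 → r + s * a ≢ 0
  nz r s (inj₁ r≢0) e = r≢0 (ℕₚ.m+n≡0⇒m≡0 r e)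
  nz r s (inj₂ s≢0) e with ℕₚ.m*n≡0⇒m≡0∨n≡0 s (ℕₚ.m+n≡0⇒n≡0 r e)
  ... | inj₁ z = s≢0 z
  ... | inj₂ z = ℕ.≢-nonZero⁻¹ a z
  idx : ∀ r s m a b → r + (s + m * b) * a ≡ r + s * a + m * (b * a)
  idx = ℕ-ring
  lt : ∀ r s → r < a → s < b → r + s * a < b * a
  lt r s r<a s<b = ℕₚ.<-≤-trans (ℕₚ.+-monoˡ-< (s * a) r<a) (ℕₚ.*-monoˡ-≤ a s<b)
  off : ∀ r s → r ≢ 0 ⊎ s ≢ 0 → r < a → s < b → ∀ m → dil (b * a) f (r + (s + m * b) * a) ≡ + 0
  off r s h r<a s<b m = trans (cong (dil (b * a) f) (idx r s m a b)) (dil-off (b * a) f (lt r s r<a s<b) (nz r s h) m)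

sgn : ℕ → ℤ
sgn zero    = + 1
sgn (suc n) = - sgn n

sgn-+ : ∀ m n → sgn (m + n) ≡ sgn m ℤ.* sgn n
sgn-+ zero    n = sym (ℤₚ.*-identityˡ (sgn n))
sgn-+ (suc m) n = trans (cong -_ (sgn-+ m n)) (ℤₚ.neg-distribˡ-* (sgn m) (sgn n))

sgn² : ∀ n → sgn n ℤ.* sgn n ≡ + 1
sgn² zero    = refl
sgn² (suc n) = trans (lem (sgn n)) (sgn² n)
  where lem : ∀ a → - a ℤ.* - a ≡ a ℤ.* a
        lem = ℤ-ring

-- q ↦ -q
neg : Series → Series
neg f n = sgn n ℤ.* f n

neg-cong : ∀ {f g} → f ≈ g → neg f ≈ neg g
neg-cong p = mk λ n → cong (sgn n ℤ.*_) (at p n)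

neg-⊕ : ∀ f g → neg (f ⊕ g) ≈ neg f ⊕ neg g
neg-⊕ f g = mk λ n → ℤₚ.*-distribˡ-+ (sgn n) (f n) (g n)

neg-· : ∀ f g → neg (f · g) ≈ neg f · neg g
neg-· f g = mk λ n → sym (trans (sumTo-cong n λ k k≤n → trans
    (lem (sgn k) (f k) (sgn (n ∸ k)) (g (n ∸ k)))
    (cong (ℤ._* (f k ℤ.* g (n ∸ k))) (trans (sym (sgn-+ k (n ∸ k))) (cong sgn (ℕₚ.m+[n∸m]≡n k≤n)))))
  (sumTo-* (sgn n) _ n))
  where lem : ∀ a b c d → a ℤ.* b ℤ.* (c ℤ.* d) ≡ a ℤ.* c ℤ.* (b ℤ.* d)
        lem = ℤ-ring

neg-const : ∀ c → neg (const c) ≈ const c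
neg-const c = mk λ { zero → ℤₚ.*-identityˡ c ; (suc n) → ℤₚ.*-zeroʳ (sgn (suc n)) }

neg-X : neg X ≈ ⊖ X
neg-X = mk λ { zero → refl ; (suc zero) → refl ; (suc (suc n)) → ℤₚ.*-zeroʳ (sgn (suc (suc n))) }

neg-dil-even : ∀ d .{{_ : NonZero d}} f → (∀ n → sgn (n * d) ≡ + 1) → neg (dil d f) ≈ dil d f
neg-dil-even d f h = dil-char d
  (mk λ n → trans (cong₂ ℤ._*_ (h n) (at (U₀-dil d f) n)) (ℤₚ.*-identityˡ (f n)))
  (λ r r<d r≢0 → mk λ n → trans (cong (sgn (r + n * d) ℤ.*_) (dil-off d f r<d r≢0 n))
    (trans (ℤₚ.*-zeroʳ (sgn (r + n * d))) (sym (const-zero n))))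

neg-dil-odd : ∀ d .{{_ : NonZero d}} f → (∀ n → sgn (n * d) ≡ sgn n) → neg (dil d f) ≈ dil d (neg f)
neg-dil-odd d f h = dil-char d
  (mk λ n → cong₂ ℤ._*_ (h n) (at (U₀-dil d f) n))
  (λ r r<d r≢0 → mk λ n → trans (cong (sgn (r + n * d) ℤ.*_) (dil-off d f r<d r≢0 n))
    (trans (ℤₚ.*-zeroʳ (sgn (r + n * d))) (sym (const-zero n))))

sgn-*2 : ∀ n → sgn (n * 2) ≡ + 1
sgn-*2 zero    = refl
sgn-*2 (suc n) = trans (ℤₚ.neg-involutive (sgn (n * 2))) (sgn-*2 n)

-- Monomials and Shanks' finite identities.

X^ : ℕ → Series
X^ zero    = const (+ 1)
X^ (suc n) = X · X^ n

X^-cong : ∀ {m n} → m ≡ n → X^ m ≈ X^ n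
X^-cong refl = ≈-refl

X^-+ : ∀ m n → X^ (m + n) ≈ X^ m · X^ n
X^-+ zero    n = ≈-sym (·-identityˡ (X^ n))
X^-+ (suc m) n = ≈-trans (·-cong {f = X} ≈-refl (X^-+ m n)) (≈-sym (·-assoc X (X^ m) (X^ n)))

X^·-low : ∀ k f {n} → n < k → (X^ k · f) n ≡ + 0
X^·-low (suc k) f {n} n<k = trans (at (·-assoc X (X^ k) f) n) (go n n<k)
  where
  go : ∀ n → n < suc k → (X · (X^ k · f)) n ≡ + 0
  go zero    _         = refl
  go (suc n) (s≤s n<k) = trans (X·-suc (X^ k · f) n) (X^·-low k f n<k)

X^-diag : ∀ k → X^ k k ≡ + 1
X^-diag zero    = refl
X^-diag (suc k) = trans (X·-suc (X^ k) k) (X^-diag k)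

X^-off : ∀ k n → k ≢ n → X^ k n ≡ + 0
X^-off zero    zero    k≢n = ⊥-elim (k≢n refl)
X^-off zero    (suc n) k≢n = refl
X^-off (suc k) zero    k≢n = refl
X^-off (suc k) (suc n) k≢n = trans (X·-suc (X^ k) n) (X^-off k n λ e → k≢n (cong suc e))

-- The quotient (q;q)_{s+d} / (q;q)_s of q-Pochhammer symbols, indexed by its length `d` so that it
-- is visibly a polynomial.
asc : ℕ → ℕ → Series
asc s zero    = const (+ 1)
asc s (suc d) = asc s d · (const (+ 1) ⊕ ⊖ X^ (s + suc d))

asc-first : ∀ s d → asc s (suc d) ≈ (const (+ 1) ⊕ ⊖ X^ (suc s)) · asc (suc s) d
asc-first s zero    = subst (λ e → const (+ 1) · (const (+ 1) ⊕ ⊖ X^ e) ≈ (const (+ 1) ⊕ ⊖ X^ (suc s)) · const (+ 1))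
  (sym (ℕₚ.+-comm s 1)) (·-comm (const (+ 1)) (const (+ 1) ⊕ ⊖ X^ (suc s)))
asc-first s (suc d) = begin
  asc s (suc d) · (const (+ 1) ⊕ ⊖ X^ (s + suc (suc d)))
    ≈⟨ ·-cong (asc-first s d) (⊕-cong {const (+ 1)} ≈-refl (⊖-cong
         (mk λ n → cong (λ e → X^ e n) (ℕₚ.+-suc s (suc d))))) ⟩
  (const (+ 1) ⊕ ⊖ X^ (suc s)) · asc (suc s) d · (const (+ 1) ⊕ ⊖ X^ (suc s + suc d))
    ≈⟨ ·-assoc (const (+ 1) ⊕ ⊖ X^ (suc s)) (asc (suc s) d) (const (+ 1) ⊕ ⊖ X^ (suc s + suc d)) ⟩
  (const (+ 1) ⊕ ⊖ X^ (suc s)) · asc (suc s) (suc d) ∎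
  where open ≈-Reasoning

-- Shanks' finite forms of the theta product identities, with a parameter x interpolating between
-- the pentagonal number theorem (x = 0) and Gauss's product for φ(-q) (x = 1):
-- shanks n = Σ_{s≤n} (-1)^s q^{s(n+1)} (1-q^{s+1})⋯(1-q^n) (x+1)(x+q)⋯(x+q^{s-1}).
module Shanks (x : ℤ) where

  rising : ℕ → Series
  rising zero    = const (+ 1)
  rising (suc s) = rising s · (const x ⊕ X^ s)

  term : ℕ → ℕ → Series
  term n s = const (sgn s) · X^ (s * suc n) · asc s (n ∸ s) · rising s

  partial : ℕ → ℕ → Series
  partial n zero    = term n zero
  partial n (suc j) = partial n j ⊕ term n (suc j)

  shanks : ℕ → Series
  shanks n = partial n n

  boundary : ℕ → ℕ → Series
  boundary n s = const (sgn s) · X^ (suc s * suc n) · asc s (n ∸ s) · rising (suc s)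

  -- In the step let Y = q^{n+1} and Z = q^{j+1}. The old boundary is -(1 - Z) times the new
  -- summand, and (1 + xY) - (1 - Z) = Z(1 - Y) + Y(x + Z). The first part is the corresponding
  -- summand for `suc n`, the second is the new boundary.
  telescope : ∀ n j → j ≤ n →
    (const (+ 1) ⊕ const x · X^ (suc n)) · partial n j ≈ partial (suc n) j ⊕ boundary n j
  telescope n zero _ = begin
    (const (+ 1) ⊕ const x · X^ (suc n)) · (const (+ 1) · const (+ 1) · A · const (+ 1))
      ≈⟨ solve 3 (λ x y a → (con (+ 1) :+ x :* y) :* (con (+ 1) :* con (+ 1) :* a :* con (+ 1))
           := con (+ 1) :* con (+ 1) :* (a :* (con (+ 1) :+ (:- y))) :* con (+ 1)
              :+ con (+ 1) :* y :* a :* (con (+ 1) :* (x :+ con (+ 1)))) ≈-refl (const x) (X^ (suc n)) A ⟩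
    const (+ 1) · const (+ 1) · (A · (const (+ 1) ⊕ ⊖ X^ (suc n))) · const (+ 1)
      ⊕ const (+ 1) · X^ (suc n) · A · (const (+ 1) · (const x ⊕ const (+ 1)))
      ≈⟨ ⊕-congʳ (const (+ 1) · const (+ 1) · (A · (const (+ 1) ⊕ ⊖ X^ (suc n))) · const (+ 1))
           (·-congˡ (const (+ 1) · (const x ⊕ const (+ 1))) (·-congˡ A (·-congʳ (const (+ 1)) (X^-cong (sym (ℕₚ.*-identityˡ (suc n))))))) ⟩
    partial (suc n) 0 ⊕ boundary n 0 ∎
    where
    A = asc 0 n
    open ≈-Reasoning
  telescope n (suc j) j<n = begin
    (const (+ 1) ⊕ const x · Y) · (partial n j ⊕ const σ · Q · A · C)
      ≈⟨ RingSeries.distribˡ (const (+ 1) ⊕ const x · Y) (partial n j) (const σ · Q · A · C) ⟩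
    (const (+ 1) ⊕ const x · Y) · partial n j ⊕ (const (+ 1) ⊕ const x · Y) · (const σ · Q · A · C)
      ≈⟨ ⊕-cong (telescope n j (ℕₚ.<⇒≤ j<n)) ≈-refl ⟩
    P ⊕ const (sgn j) · Q · asc j (n ∸ j) · C ⊕ (const (+ 1) ⊕ const x · Y) · (const σ · Q · A · C)
      ≈⟨ ⊕-cong (⊕-cong {P} ≈-refl (·-cong {g = C} (·-cong (·-cong {g = Q} sgn-flip ≈-refl) asc-step) ≈-refl)) ≈-refl ⟩
    P ⊕ ⊖ const σ · Q · ((const (+ 1) ⊕ ⊖ Z) · A) · C ⊕ (const (+ 1) ⊕ const x · Y) · (const σ · Q · A · C)
      ≈⟨ solve 8 (λ p s q z a c x y →
           p :+ (:- s) :* q :* ((con (+ 1) :+ (:- z)) :* a) :* c :+ (con (+ 1) :+ x :* y) :* (s :* q :* a :* c)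
           := p :+ s :* (z :* q) :* (a :* (con (+ 1) :+ (:- y))) :* c :+ s :* (y :* q) :* a :* (c :* (x :+ z)))
           ≈-refl P (const σ) Q Z A C (const x) Y ⟩
    P ⊕ const σ · (Z · Q) · (A · (const (+ 1) ⊕ ⊖ Y)) · C ⊕ const σ · (Y · Q) · A · (C · (const x ⊕ Z))
      ≈⟨ ⊕-cong (⊕-cong {P} ≈-refl (·-cong {g = C} (·-cong (·-cong {f = const σ} ≈-refl zq) asc-last) ≈-refl))
           (·-congˡ (C · (const x ⊕ Z)) (·-congˡ A (·-congʳ (const σ) yq))) ⟩
    partial (suc n) (suc j) ⊕ boundary n (suc j) ∎
    where
    σ = sgn (suc j)
    Q = X^ (suc j * suc n)
    A = asc (suc j) (n ∸ suc j)
    C = rising (suc j)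
    Y = X^ (suc n)
    Z = X^ (suc j)
    P = partial (suc n) j
    open ≈-Reasoning
    sgn-flip : const (sgn j) ≈ ⊖ const σ
    sgn-flip = mk λ { zero → sym (ℤₚ.neg-involutive (sgn j)) ; (suc _) → refl }
    gap : n ∸ j ≡ suc (n ∸ suc j)
    gap = ℕₚ.+-∸-assoc 1 j<n
    asc-step : asc j (n ∸ j) ≈ (const (+ 1) ⊕ ⊖ Z) · A
    asc-step = ≈-trans (mk λ k → cong (λ d → asc j d k) gap) (asc-first j (n ∸ suc j))
    asc-last : A · (const (+ 1) ⊕ ⊖ Y) ≈ asc (suc j) (suc n ∸ suc j)
    asc-last = ≈-trans (·-cong {f = A} ≈-refl (⊕-cong {const (+ 1)} ≈-refl (⊖-cong (X^-cong
        (trans (sym (ℕₚ.m+[n∸m]≡n (s≤s (ℕₚ.<⇒≤ j<n)))) (cong (suc j ℕ.+_) gap))))))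
      (mk λ k → cong (λ d → asc (suc j) d k) (sym gap))
    zq : Z · Q ≈ X^ (suc j * suc (suc n))
    zq = ≈-trans (≈-sym (X^-+ (suc j) (suc j * suc n))) (X^-cong (sym (ℕₚ.*-suc (suc j) (suc n))))
    yq : Y · Q ≈ X^ (suc (suc j) * suc n)
    yq = ≈-sym (X^-+ (suc n) (suc j * suc n))

  -- This is `telescope` at j = n, with the last boundary term traded for the missing summand s = n
  -- + 1 of `shanks (suc n)`. The remainder supplies two new pentagonal terms when x = 0, and two
  -- new squares when x = 1.
  shanks-suc : ∀ n → let N = suc n in
    (const (+ 1) ⊕ const x · X^ N) · shanks n
      ≈ shanks N ⊕ const (sgn n) · X^ (N * N) · rising N · (const (+ 1) ⊕ X^ N)
  shanks-suc n = begin
    (const (+ 1) ⊕ const x · Y) · shanks n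
      ≈⟨ telescope n n ℕₚ.≤-refl ⟩
    P ⊕ const (sgn n) · Q · asc n (n ∸ n) · C
      ≈⟨ ⊕-cong {P} ≈-refl (·-cong {g = C} (·-cong {f = const (sgn n) · Q} ≈-refl (asc-0 n)) ≈-refl) ⟩
    P ⊕ const (sgn n) · Q · const (+ 1) · C
      ≈⟨ solve 5 (λ p s q c y → p :+ s :* q :* con (+ 1) :* c
           := p :+ (:- s) :* (y :* q) :* con (+ 1) :* c :+ s :* q :* c :* (con (+ 1) :+ y)) ≈-refl P (const (sgn n)) Q C Y ⟩
    P ⊕ ⊖ const (sgn n) · (Y · Q) · const (+ 1) · C ⊕ const (sgn n) · Q · C · (const (+ 1) ⊕ Y)
      ≈⟨ ⊕-cong (⊕-cong {P} ≈-refl (·-cong {g = C} (·-cong (·-cong sgn-flip yq) (≈-sym (asc-0 (suc n)))) ≈-refl)) ≈-refl ⟩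
    shanks (suc n) ⊕ const (sgn n) · Q · C · (const (+ 1) ⊕ Y) ∎
    where
    Q = X^ (suc n * suc n)
    C = rising (suc n)
    Y = X^ (suc n)
    P = partial (suc n) n
    open ≈-Reasoning
    asc-0 : ∀ m → asc m (m ∸ m) ≈ const (+ 1)
    asc-0 m = mk λ k → cong (λ d → asc m d k) (ℕₚ.n∸n≡0 m)
    sgn-flip : ⊖ const (sgn n) ≈ const (sgn (suc n))
    sgn-flip = mk λ { zero → refl ; (suc _) → refl }
    yq : Y · Q ≈ X^ (suc n * suc (suc n))
    yq = ≈-trans (≈-sym (X^-+ (suc n) (suc n * suc n))) (X^-cong (sym (ℕₚ.*-suc (suc n) (suc n))))

  -- Every summand with s ≥ 1 carries q^{s(n+1)} and vanishes up to q^n.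
  shanks-low : ∀ n {k} → k ≤ n → shanks n k ≡ asc 0 n k
  shanks-low n {k} k≤n = go n
    where
    go : ∀ j → partial n j k ≡ asc 0 n k
    go zero    = at (solve 1 (λ a → con (+ 1) :* con (+ 1) :* a :* con (+ 1) := a) ≈-refl (asc 0 n)) k
    go (suc j) = trans (cong₂ ℤ._+_ (go j) (trans
        (at (solve 4 (λ s q a c → s :* q :* a :* c := q :* (s :* a :* c)) ≈-refl
          (const (sgn (suc j))) (X^ (suc j * suc n)) (asc (suc j) (n ∸ suc j)) (rising (suc j))) k)
        (X^·-low (suc j * suc n) (const (sgn (suc j)) · asc (suc j) (n ∸ suc j) · rising (suc j)) (ℕₚ.≤-trans (s≤s k≤n) (ℕₚ.m≤m+n (suc n) (j * suc n))))))
      (ℤₚ.+-identityʳ _)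

-- Finitely supported sums over ℤ and ℤ²

sumℤ : ℕ → (ℤ → ℤ) → ℤ
sumℤ zero    g = g (+ 0)
sumℤ (suc B) g = sumℤ B g ℤ.+ (g (+ suc B) ℤ.+ g -[1+ B ])

sumℤ-cong : ∀ B {g h} → (∀ m → g m ≡ h m) → sumℤ B g ≡ sumℤ B h
sumℤ-cong zero    e = e (+ 0)
sumℤ-cong (suc B) e = cong₂ ℤ._+_ (sumℤ-cong B e) (cong₂ ℤ._+_ (e (+ suc B)) (e -[1+ B ]))

sumℤ-0 : ∀ B {g} → (∀ m → g m ≡ + 0) → sumℤ B g ≡ + 0
sumℤ-0 zero    e = e (+ 0)
sumℤ-0 (suc B) e = cong₂ ℤ._+_ (sumℤ-0 B e) (cong₂ ℤ._+_ (e (+ suc B)) (e -[1+ B ]))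

sumℤ-+ : ∀ B g h → sumℤ B (λ m → g m ℤ.+ h m) ≡ sumℤ B g ℤ.+ sumℤ B h
sumℤ-+ zero    g h = refl
sumℤ-+ (suc B) g h = trans
  (cong (ℤ._+ (g (+ suc B) ℤ.+ h (+ suc B) ℤ.+ (g -[1+ B ] ℤ.+ h -[1+ B ]))) (sumℤ-+ B g h))
  (lem (sumℤ B g) (sumℤ B h) (g (+ suc B)) (h (+ suc B)) (g -[1+ B ]) (h -[1+ B ]))
  where lem : ∀ a b c d e f → a ℤ.+ b ℤ.+ (c ℤ.+ d ℤ.+ (e ℤ.+ f)) ≡ a ℤ.+ (c ℤ.+ e) ℤ.+ (b ℤ.+ (d ℤ.+ f))
        lem = ℤ-ring

sumℤ-* : ∀ B c g → sumℤ B (λ m → c ℤ.* g m) ≡ c ℤ.* sumℤ B g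
sumℤ-* zero    c g = refl
sumℤ-* (suc B) c g = trans
  (cong (ℤ._+ (c ℤ.* g (+ suc B) ℤ.+ c ℤ.* g -[1+ B ])) (sumℤ-* B c g))
  (lem c (sumℤ B g) (g (+ suc B)) (g -[1+ B ]))
  where lem : ∀ c a d e → c ℤ.* a ℤ.+ (c ℤ.* d ℤ.+ c ℤ.* e) ≡ c ℤ.* (a ℤ.+ (d ℤ.+ e))
        lem = ℤ-ring

sumℤ-swap : ∀ B C (g : ℤ → ℤ → ℤ) → sumℤ B (λ m → sumℤ C (g m)) ≡ sumℤ C (λ n → sumℤ B (λ m → g m n))
sumℤ-swap zero    C g = refl
sumℤ-swap (suc B) C g = sym (trans
  (sumℤ-+ C (λ n → sumℤ B (λ m → g m n)) (λ n → g (+ suc B) n ℤ.+ g -[1+ B ] n))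
  (cong₂ ℤ._+_ (sym (sumℤ-swap B C g)) (sumℤ-+ C (g (+ suc B)) (g -[1+ B ]))))

sumTo-sumℤ : ∀ n B (g : ℕ → ℤ → ℤ) → sumTo (λ k → sumℤ B (g k)) n ≡ sumℤ B (λ m → sumTo (λ k → g k m) n)
sumTo-sumℤ zero    B g = refl
sumTo-sumℤ (suc n) B g = trans (cong (ℤ._+ sumℤ B (g (suc n))) (sumTo-sumℤ n B g))
  (sym (sumℤ-+ B (λ m → sumTo (λ k → g k m) n) (g (suc n))))

sumℤ-neg : ∀ B g → sumℤ B (λ m → g (- m)) ≡ sumℤ B g
sumℤ-neg zero    g = refl
sumℤ-neg (suc B) g = cong₂ ℤ._+_ (sumℤ-neg B g) (ℤₚ.+-comm (g -[1+ B ]) (g (+ suc B)))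

sumℤ-shift : ∀ B g → sumℤ B (λ m → g (+ 1 ℤ.+ m)) ℤ.+ g (- (+ B)) ≡ sumℤ B g ℤ.+ g (+ suc B)
sumℤ-shift zero    g = ℤₚ.+-comm (g (+ 1)) (g (+ 0))
sumℤ-shift (suc B) g = trans
  (cong (λ z → sumℤ B (λ m → g (+ 1 ℤ.+ m)) ℤ.+ (g (+ suc (suc B)) ℤ.+ g z) ℤ.+ g -[1+ B ]) (neg-suc B))
  (trans (lem₁ (sumℤ B (λ m → g (+ 1 ℤ.+ m))) (g (+ suc (suc B))) (g (- (+ B))) (g -[1+ B ]))
  (trans (cong (ℤ._+ (g (+ suc (suc B)) ℤ.+ g -[1+ B ])) (sumℤ-shift B g))
    (lem₂ (sumℤ B g) (g (+ suc B)) (g (+ suc (suc B))) (g -[1+ B ]))))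
  where
  neg-suc : ∀ B → + 1 ℤ.+ -[1+ B ] ≡ - (+ B)
  neg-suc zero    = refl
  neg-suc (suc B) = refl
  lem₁ : ∀ a b c d → a ℤ.+ (b ℤ.+ c) ℤ.+ d ≡ a ℤ.+ c ℤ.+ (b ℤ.+ d)
  lem₁ = ℤ-ring
  lem₂ : ∀ a b c d → a ℤ.+ b ℤ.+ (c ℤ.+ d) ≡ a ℤ.+ (b ℤ.+ d) ℤ.+ c
  lem₂ = ℤ-ring

-- The even numbers 2m run from -2B to 2B but the odd numbers 2m + 1 from -2B + 1 to 2B + 1, hence
-- the stray value at the top.
sumℤ-split₂ : ∀ B g →
  sumℤ B (λ m → g (+ 2 ℤ.* m)) ℤ.+ sumℤ B (λ m → g (+ 2 ℤ.* m ℤ.+ + 1))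
    ≡ sumℤ (B + B) g ℤ.+ g (+ 2 ℤ.* + B ℤ.+ + 1)
sumℤ-split₂ zero    g = refl
sumℤ-split₂ (suc B) g = begin
  E ℤ.+ (a ℤ.+ g (+ 2 ℤ.* -[1+ B ])) ℤ.+ (O ℤ.+ (d ℤ.+ g (+ 2 ℤ.* -[1+ B ] ℤ.+ + 1)))
    ≡⟨ lem₁ E a (g (+ 2 ℤ.* -[1+ B ])) O d (g (+ 2 ℤ.* -[1+ B ] ℤ.+ + 1)) ⟩
  E ℤ.+ O ℤ.+ (a ℤ.+ g (+ 2 ℤ.* -[1+ B ]) ℤ.+ (d ℤ.+ g (+ 2 ℤ.* -[1+ B ] ℤ.+ + 1)))
    ≡⟨ cong (ℤ._+ (a ℤ.+ g (+ 2 ℤ.* -[1+ B ]) ℤ.+ (d ℤ.+ g (+ 2 ℤ.* -[1+ B ] ℤ.+ + 1)))) (sumℤ-split₂ B g) ⟩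
  S ℤ.+ g (+ 2 ℤ.* + B ℤ.+ + 1) ℤ.+ (a ℤ.+ g (+ 2 ℤ.* -[1+ B ]) ℤ.+ (d ℤ.+ g (+ 2 ℤ.* -[1+ B ] ℤ.+ + 1)))
    ≡⟨ cong₂ (λ x y → S ℤ.+ x ℤ.+ (a ℤ.+ g (+ 2 ℤ.* -[1+ B ]) ℤ.+ (d ℤ.+ y)))
         (cong g (trans (e₁ (+ B)) (cong +_ refl))) (cong g e₂) ⟩
  S ℤ.+ g (+ suc (B + B)) ℤ.+ (a ℤ.+ g (+ 2 ℤ.* -[1+ B ]) ℤ.+ (d ℤ.+ g -[1+ B + B ]))
    ≡⟨ cong₂ (λ x y → S ℤ.+ g (+ suc (B + B)) ℤ.+ (x ℤ.+ y ℤ.+ (d ℤ.+ g -[1+ B + B ])))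
         (cong g e₃) (cong g e₄) ⟩
  S ℤ.+ g (+ suc (B + B)) ℤ.+ (g (+ suc (suc (B + B))) ℤ.+ g -[1+ suc (B + B) ] ℤ.+ (d ℤ.+ g -[1+ B + B ]))
    ≡⟨ lem₂ S (g (+ suc (B + B))) (g (+ suc (suc (B + B)))) (g -[1+ suc (B + B) ]) d (g -[1+ B + B ]) ⟩
  sumℤ (suc (suc (B + B))) g ℤ.+ d
    ≡⟨ cong (λ k → sumℤ (suc k) g ℤ.+ d) (ℕₚ.+-suc B B) ⟨
  sumℤ (suc B + suc B) g ℤ.+ d ∎
  where
  open ≡-Reasoning
  E = sumℤ B (λ m → g (+ 2 ℤ.* m))
  O = sumℤ B (λ m → g (+ 2 ℤ.* m ℤ.+ + 1))
  S = sumℤ (B + B) g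
  a = g (+ 2 ℤ.* + suc B)
  d = g (+ 2 ℤ.* + suc B ℤ.+ + 1)
  e₁ : ∀ b → + 2 ℤ.* b ℤ.+ + 1 ≡ + 1 ℤ.+ (b ℤ.+ b)
  e₁ = ℤ-ring
  p₂ : ∀ b → + 2 ℤ.* (- (+ 1 ℤ.+ b)) ℤ.+ + 1 ≡ - (+ 1 ℤ.+ (b ℤ.+ b))
  p₂ = ℤ-ring
  e₂ : + 2 ℤ.* -[1+ B ] ℤ.+ + 1 ≡ -[1+ B + B ]
  e₂ = p₂ (+ B)
  p₃ : ∀ b → + 2 ℤ.* (+ 1 ℤ.+ b) ≡ + 2 ℤ.+ (b ℤ.+ b)
  p₃ = ℤ-ring
  e₃ : + 2 ℤ.* + suc B ≡ + suc (suc (B + B))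
  e₃ = p₃ (+ B)
  p₄ : ∀ b → + 2 ℤ.* (- (+ 1 ℤ.+ b)) ≡ - (+ 2 ℤ.+ (b ℤ.+ b))
  p₄ = ℤ-ring
  e₄ : + 2 ℤ.* -[1+ B ] ≡ -[1+ suc (B + B) ]
  e₄ = p₄ (+ B)
  lem₁ : ∀ E a x O d y → E ℤ.+ (a ℤ.+ x) ℤ.+ (O ℤ.+ (d ℤ.+ y)) ≡ E ℤ.+ O ℤ.+ (a ℤ.+ x ℤ.+ (d ℤ.+ y))
  lem₁ = ℤ-ring
  lem₂ : ∀ S a b c d e → S ℤ.+ a ℤ.+ (b ℤ.+ c ℤ.+ (d ℤ.+ e)) ≡ S ℤ.+ (a ℤ.+ e) ℤ.+ (b ℤ.+ c) ℤ.+ d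
  lem₂ = ℤ-ring

-- The residues 0, 1, -1 tile the symmetric window of radius 3B + 1 exactly.
sumℤ-split₃ : ∀ B g →
  sumℤ B (λ m → g (+ 3 ℤ.* m)) ℤ.+ sumℤ B (λ m → g (+ 3 ℤ.* m ℤ.+ + 1)) ℤ.+ sumℤ B (λ m → g (+ 3 ℤ.* m ℤ.- + 1))
    ≡ sumℤ (suc (B + B + B)) g
sumℤ-split₃ zero    g = ℤₚ.+-assoc (g (+ 0)) (g (+ 1)) (g -[1+ 0 ])
sumℤ-split₃ (suc B) g = begin
  sumℤ (suc B) (λ m → g (+ 3 ℤ.* m)) ℤ.+ sumℤ (suc B) (λ m → g (+ 3 ℤ.* m ℤ.+ + 1)) ℤ.+ sumℤ (suc B) (λ m → g (+ 3 ℤ.* m ℤ.- + 1))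
    ≡⟨ cong₂ (λ x y → x ℤ.+ y) (cong₂ (λ x y → x ℤ.+ y)
         (cong₂ (λ x y → S₀ ℤ.+ (g x ℤ.+ g y)) (p₁ (+ B)) (p₂ (+ B)))
         (cong₂ (λ x y → S₁ ℤ.+ (g x ℤ.+ g y)) (p₃ (+ B)) (p₄ (+ B))))
         (cong₂ (λ x y → S₂ ℤ.+ (g x ℤ.+ g y)) (p₅ (+ B)) (p₆ (+ B))) ⟩
  S₀ ℤ.+ (g (+ suc (suc (suc T))) ℤ.+ g -[1+ suc (suc T) ])
    ℤ.+ (S₁ ℤ.+ (g (+ suc (suc (suc (suc T)))) ℤ.+ g -[1+ suc T ]))
    ℤ.+ (S₂ ℤ.+ (g (+ suc (suc T)) ℤ.+ g -[1+ suc (suc (suc T)) ]))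
    ≡⟨ lem S₀ S₁ S₂ (g (+ suc (suc (suc T)))) (g -[1+ suc (suc T) ]) (g (+ suc (suc (suc (suc T))))) (g -[1+ suc T ]) (g (+ suc (suc T))) (g -[1+ suc (suc (suc T)) ]) ⟩
  S₀ ℤ.+ S₁ ℤ.+ S₂ ℤ.+ (g (+ suc (suc T)) ℤ.+ g -[1+ suc T ]) ℤ.+ (g (+ suc (suc (suc T))) ℤ.+ g -[1+ suc (suc T) ])
    ℤ.+ (g (+ suc (suc (suc (suc T)))) ℤ.+ g -[1+ suc (suc (suc T)) ])
    ≡⟨ cong (λ z → z ℤ.+ (g (+ suc (suc T)) ℤ.+ g -[1+ suc T ]) ℤ.+ (g (+ suc (suc (suc T))) ℤ.+ g -[1+ suc (suc T) ])
    ℤ.+ (g (+ suc (suc (suc (suc T)))) ℤ.+ g -[1+ suc (suc (suc T)) ])) (sumℤ-split₃ B g) ⟩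
  sumℤ (suc (suc (suc (suc T)))) g
    ≡⟨ cong (λ k → sumℤ (suc k) g) (idx B) ⟨
  sumℤ (suc (suc B + suc B + suc B)) g ∎
  where
  open ≡-Reasoning
  T = B + B + B
  S₀ = sumℤ B (λ m → g (+ 3 ℤ.* m))
  S₁ = sumℤ B (λ m → g (+ 3 ℤ.* m ℤ.+ + 1))
  S₂ = sumℤ B (λ m → g (+ 3 ℤ.* m ℤ.- + 1))
  idx : ∀ B → suc B + suc B + suc B ≡ suc (suc (suc (B + B + B)))
  idx = ℕ-ring
  p₁ : ∀ b → + 3 ℤ.* (+ 1 ℤ.+ b) ≡ + 3 ℤ.+ (b ℤ.+ b ℤ.+ b)
  p₁ = ℤ-ring
  p₂ : ∀ b → + 3 ℤ.* (- (+ 1 ℤ.+ b)) ≡ - (+ 3 ℤ.+ (b ℤ.+ b ℤ.+ b))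
  p₂ = ℤ-ring
  p₃ : ∀ b → + 3 ℤ.* (+ 1 ℤ.+ b) ℤ.+ + 1 ≡ + 4 ℤ.+ (b ℤ.+ b ℤ.+ b)
  p₃ = ℤ-ring
  p₄ : ∀ b → + 3 ℤ.* (- (+ 1 ℤ.+ b)) ℤ.+ + 1 ≡ - (+ 2 ℤ.+ (b ℤ.+ b ℤ.+ b))
  p₄ = ℤ-ring
  p₅ : ∀ b → + 3 ℤ.* (+ 1 ℤ.+ b) ℤ.- + 1 ≡ + 2 ℤ.+ (b ℤ.+ b ℤ.+ b)
  p₅ = ℤ-ring
  p₆ : ∀ b → + 3 ℤ.* (- (+ 1 ℤ.+ b)) ℤ.- + 1 ≡ - (+ 4 ℤ.+ (b ℤ.+ b ℤ.+ b))
  p₆ = ℤ-ring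
  lem : ∀ S₀ S₁ S₂ a b c d e f →
    S₀ ℤ.+ (a ℤ.+ b) ℤ.+ (S₁ ℤ.+ (c ℤ.+ d)) ℤ.+ (S₂ ℤ.+ (e ℤ.+ f))
    ≡ S₀ ℤ.+ S₁ ℤ.+ S₂ ℤ.+ (e ℤ.+ d) ℤ.+ (a ℤ.+ b) ℤ.+ (c ℤ.+ f)
  lem = ℤ-ring

Supp : ℕ → (ℤ → ℤ) → Set
Supp B g = ∀ m → B < ∣ m ∣ → g m ≡ + 0

sumℤ-stable : ∀ {B g} → Supp B g → ∀ C → B ≤ C → sumℤ C g ≡ sumℤ B g
sumℤ-stable {B} {g} supp C B≤C = subst (λ C → sumℤ C g ≡ sumℤ B g) (ℕₚ.m∸n+n≡m B≤C) (go (C ∸ B))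
  where
  go : ∀ k → sumℤ (k + B) g ≡ sumℤ B g
  go zero    = refl
  go (suc k) = trans (cong₂ ℤ._+_ (go k) (cong₂ ℤ._+_
    (supp (+ suc (k + B)) (s≤s (ℕₚ.m≤n+m B k))) (supp -[1+ k + B ] (s≤s (ℕₚ.m≤n+m B k))))) (ℤₚ.+-identityʳ _)

sumℤ-bounds : ∀ {B C g} → Supp B g → Supp C g → sumℤ B g ≡ sumℤ C g
sumℤ-bounds {B} {C} p q with ℕₚ.≤-total B C
... | inj₁ B≤C = sym (sumℤ-stable p C B≤C)
... | inj₂ C≤B = sumℤ-stable q B C≤B

-- A sum over all of ℤ, packaged with a window containing the support. By `HasSum-unique` the value
-- does not depend on the window, so a change of variables may alter the bound freely.
record HasSum (g : ℤ → ℤ) (s : ℤ) : Set where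
  constructor hasSum
  field
    bound   : ℕ
    support : Supp bound g
    value   : sumℤ bound g ≡ s

HasSum-unique : ∀ {g s t} → HasSum g s → HasSum g t → s ≡ t
HasSum-unique (hasSum _ p v) (hasSum _ q w) = trans (sym v) (trans (sumℤ-bounds p q) w)

HasSum-cong : ∀ {g h s} → (∀ m → g m ≡ h m) → HasSum g s → HasSum h s
HasSum-cong e (hasSum B p v) = hasSum B (λ m B<m → trans (sym (e m)) (p m B<m)) (trans (sym (sumℤ-cong B e)) v)

HasSum-neg : ∀ {g s} → HasSum g s → HasSum (λ m → g (- m)) s
HasSum-neg {g} (hasSum B p v) =
  hasSum B (λ m B<m → p (- m) (subst (B ℕ.<_) (sym (ℤₚ.∣-i∣≡∣i∣ m)) B<m)) (trans (sumℤ-neg B g) v)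

∣∣-shrink : ∀ c m → ∣ m ∣ ≤ ∣ c ℤ.+ m ∣ + ∣ c ∣
∣∣-shrink c m = subst (λ z → ∣ z ∣ ≤ ∣ c ℤ.+ m ∣ + ∣ c ∣) (lem c m) (ℤₚ.∣i-j∣≤∣i∣+∣j∣ (c ℤ.+ m) c)
  where lem : ∀ c m → c ℤ.+ m ℤ.- c ≡ m
        lem = ℤ-ring

Supp-shift : ∀ {B C g} c → ∣ c ∣ ≤ C → Supp B g → Supp (B + C) (λ m → g (c ℤ.+ m))
Supp-shift {B} {C} c c≤C p m lt = p (c ℤ.+ m)
  (ℕₚ.+-cancelʳ-< C B ∣ c ℤ.+ m ∣ (ℕₚ.<-≤-trans lt (ℕₚ.≤-trans (∣∣-shrink c m) (ℕₚ.+-monoʳ-≤ ∣ c ℤ.+ m ∣ c≤C))))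

HasSum-suc : ∀ {g s} → HasSum g s → HasSum (λ m → g (+ 1 ℤ.+ m)) s
HasSum-suc {g} {s} (hasSum B p v) = hasSum (B + 1) (Supp-shift (+ 1) ℕₚ.≤-refl p)
  (subst (λ C → sumℤ C (λ m → g (+ 1 ℤ.+ m)) ≡ s) (ℕₚ.+-comm 1 B)
    (trans (sym (ℤₚ.+-identityʳ (sumℤ (suc B) (λ m → g (+ 1 ℤ.+ m)))))
    (trans (cong (λ z → sumℤ (suc B) (λ m → g (+ 1 ℤ.+ m)) ℤ.+ z) (sym (p -[1+ B ] ℕₚ.≤-refl)))
    (trans (sumℤ-shift (suc B) g)
    (trans (cong₂ ℤ._+_ (sumℤ-stable p (suc B) (ℕₚ.n≤1+n B)) (p (+ suc (suc B)) (ℕₚ.m≤n⇒m≤1+n ℕₚ.≤-refl)))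
    (trans (ℤₚ.+-identityʳ (sumℤ B g)) v))))))

HasSum-shift⁺ : ∀ {g s} n → HasSum g s → HasSum (λ m → g (+ n ℤ.+ m)) s
HasSum-shift⁺ {g} zero    h = HasSum-cong (λ m → cong g (sym (ℤₚ.+-identityˡ m))) h
HasSum-shift⁺ {g} (suc n) h = HasSum-cong (λ m → cong g (lem (+ n) m)) (HasSum-suc (HasSum-shift⁺ n h))
  where lem : ∀ n m → n ℤ.+ (+ 1 ℤ.+ m) ≡ + 1 ℤ.+ n ℤ.+ m
        lem = ℤ-ring

HasSum-shift : ∀ {g s} c → HasSum g s → HasSum (λ m → g (c ℤ.+ m)) s
HasSum-shift     (+ n)    h = HasSum-shift⁺ n h
HasSum-shift {g} -[1+ n ] h = HasSum-cong (λ m → cong g (lem (+ suc n) m)) (HasSum-neg (HasSum-shift⁺ (suc n) (HasSum-neg h)))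
  where lem : ∀ n m → - (n ℤ.+ - m) ≡ - n ℤ.+ m
        lem = ℤ-ring

HasSum-split₂ : ∀ {g s t} → HasSum (λ m → g (+ 2 ℤ.* m)) s → HasSum (λ m → g (+ 2 ℤ.* m ℤ.+ + 1)) t →
  ∀ {B} → Supp B g → sumℤ B g ≡ s ℤ.+ t
HasSum-split₂ {g} {s} {t} (hasSum B p v) (hasSum C q w) {D} supp = begin
  sumℤ D g                        ≡⟨ sumℤ-stable supp (M + M) (ℕₚ.≤-trans D≤M (ℕₚ.m≤m+n M M)) ⟨
  sumℤ (M + M) g                ≡⟨ ℤₚ.+-identityʳ _ ⟨
  sumℤ (M + M) g ℤ.+ + 0        ≡⟨ cong (λ z → sumℤ (M + M) g ℤ.+ z) (trans (cong g (lem (+ M)))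
                                      (supp (+ suc (M + M)) (s≤s (ℕₚ.≤-trans D≤M (ℕₚ.m≤m+n M M))))) ⟨
  sumℤ (M + M) g ℤ.+ g (+ 2 ℤ.* + M ℤ.+ + 1) ≡⟨ sumℤ-split₂ M g ⟨
  sumℤ M (λ m → g (+ 2 ℤ.* m)) ℤ.+ sumℤ M (λ m → g (+ 2 ℤ.* m ℤ.+ + 1))
    ≡⟨ cong₂ ℤ._+_ (trans (sumℤ-stable p M (ℕₚ.≤-trans (ℕₚ.m≤m+n B C) (ℕₚ.m≤m+n (B + C) D))) v)
                   (trans (sumℤ-stable q M (ℕₚ.≤-trans (ℕₚ.m≤n+m C B) (ℕₚ.m≤m+n (B + C) D))) w) ⟩
  s ℤ.+ t ∎
  where
  open ≡-Reasoning
  M = B + C + D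
  D≤M = ℕₚ.m≤n+m D (B + C)
  lem : ∀ b → + 2 ℤ.* b ℤ.+ + 1 ≡ + 1 ℤ.+ (b ℤ.+ b)
  lem = ℤ-ring

HasSum-split₃ : ∀ {g s t u} → HasSum (λ m → g (+ 3 ℤ.* m)) s → HasSum (λ m → g (+ 3 ℤ.* m ℤ.+ + 1)) t →
  HasSum (λ m → g (+ 3 ℤ.* m ℤ.- + 1)) u → ∀ {B} → Supp B g → sumℤ B g ≡ s ℤ.+ t ℤ.+ u
HasSum-split₃ {g} {s} {t} {u} (hasSum A o a) (hasSum B p v) (hasSum C q w) {D} supp = begin
  sumℤ D g                              ≡⟨ sumℤ-stable supp (suc (M + M + M)) (ℕₚ.≤-trans D≤M (ℕₚ.≤-trans (ℕₚ.m≤n+m M (M + M)) (ℕₚ.n≤1+n _))) ⟨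
  sumℤ (suc (M + M + M)) g          ≡⟨ sumℤ-split₃ M g ⟨
  sumℤ M (λ m → g (+ 3 ℤ.* m)) ℤ.+ sumℤ M (λ m → g (+ 3 ℤ.* m ℤ.+ + 1)) ℤ.+ sumℤ M (λ m → g (+ 3 ℤ.* m ℤ.- + 1))
    ≡⟨ cong₂ ℤ._+_ (cong₂ ℤ._+_
         (trans (sumℤ-stable o M (ℕₚ.≤-trans (ℕₚ.m≤m+n A B) (ℕₚ.≤-trans (ℕₚ.m≤m+n (A + B) C) (ℕₚ.m≤m+n (A + B + C) D)))) a)
         (trans (sumℤ-stable p M (ℕₚ.≤-trans (ℕₚ.m≤n+m B A) (ℕₚ.≤-trans (ℕₚ.m≤m+n (A + B) C) (ℕₚ.m≤m+n (A + B + C) D)))) v))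
         (trans (sumℤ-stable q M (ℕₚ.≤-trans (ℕₚ.m≤n+m C (A + B)) (ℕₚ.m≤m+n (A + B + C) D))) w) ⟩
  s ℤ.+ t ℤ.+ u ∎
  where
  open ≡-Reasoning
  M = A + B + C + D
  D≤M = ℕₚ.m≤n+m D (A + B + C)

record HasSum₂ (g : ℤ → ℤ → ℤ) (s : ℤ) : Set where
  constructor hasSum₂
  field
    bound   : ℕ
    support : ∀ m n → bound < ∣ m ∣ ⊎ bound < ∣ n ∣ → g m n ≡ + 0
    value   : sumℤ bound (λ m → sumℤ bound (g m)) ≡ s

HasSum₂-window : ∀ {g s} (h : HasSum₂ g s) → ∀ C D → HasSum₂.bound h ≤ C → HasSum₂.bound h ≤ D →
  sumℤ C (λ m → sumℤ D (g m)) ≡ s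
HasSum₂-window {g} (hasSum₂ B p v) C D B≤C B≤D = trans
  (sumℤ-cong C λ m → sumℤ-stable (λ n B<n → p m n (inj₂ B<n)) D B≤D)
  (trans (sumℤ-stable (λ m B<m → sumℤ-0 B λ n → p m n (inj₁ B<m)) C B≤C) v)

HasSum₂-unique : ∀ {g s t} → HasSum₂ g s → HasSum₂ g t → s ≡ t
HasSum₂-unique h k = trans (sym (HasSum₂-window h M M (ℕₚ.m≤m+n _ _) (ℕₚ.m≤m+n _ _)))
  (HasSum₂-window k M M (ℕₚ.m≤n+m _ (HasSum₂.bound h)) (ℕₚ.m≤n+m _ (HasSum₂.bound h)))
  where M = HasSum₂.bound h + HasSum₂.bound k

HasSum₂-cong : ∀ {g h s} → (∀ m n → g m n ≡ h m n) → HasSum₂ g s → HasSum₂ h s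
HasSum₂-cong e (hasSum₂ B p v) = hasSum₂ B (λ m n o → trans (sym (e m n)) (p m n o))
  (trans (sym (sumℤ-cong B λ m → sumℤ-cong B (e m))) v)

HasSum₂-swap : ∀ {g s} → HasSum₂ g s → HasSum₂ (λ m n → g n m) s
HasSum₂-swap {g} (hasSum₂ B p v) = hasSum₂ B
  (λ m n → [ (λ o → p n m (inj₂ o)) , (λ o → p n m (inj₁ o)) ]′)
  (trans (sumℤ-swap B B (λ m n → g n m)) v)

HasSum₂-neg : ∀ {g s} → HasSum₂ g s → HasSum₂ (λ m n → g (- m) n) s
HasSum₂-neg {g} (hasSum₂ B p v) = hasSum₂ B
  (λ m n → [ (λ o → p (- m) n (inj₁ (subst (B ℕ.<_) (sym (ℤₚ.∣-i∣≡∣i∣ m)) o))) , (λ o → p (- m) n (inj₂ o)) ]′)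
  (trans (sumℤ-neg B (λ m → sumℤ B (g m))) v)

HasSum₂-+ : ∀ {g h s t} → HasSum₂ g s → HasSum₂ h t → HasSum₂ (λ m n → g m n ℤ.+ h m n) (s ℤ.+ t)
HasSum₂-+ {g} {h} G@(hasSum₂ B p _) H@(hasSum₂ C q _) = hasSum₂ (B + C)
  (λ m n o → cong₂ ℤ._+_ (p m n (weaken (ℕₚ.m≤m+n B C) o)) (q m n (weaken (ℕₚ.m≤n+m C B) o)))
  (trans (sumℤ-cong (B + C) λ m → sumℤ-+ (B + C) (g m) (h m))
  (trans (sumℤ-+ (B + C) (λ m → sumℤ (B + C) (g m)) (λ m → sumℤ (B + C) (h m)))
    (cong₂ ℤ._+_ (HasSum₂-window G _ _ (ℕₚ.m≤m+n B C) (ℕₚ.m≤m+n B C))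
                 (HasSum₂-window H _ _ (ℕₚ.m≤n+m C B) (ℕₚ.m≤n+m C B)))))
  where
  weaken : ∀ {b c m n} → b ≤ c → c < m ⊎ c < n → b < m ⊎ b < n
  weaken b≤c (inj₁ o) = inj₁ (ℕₚ.≤-<-trans b≤c o)
  weaken b≤c (inj₂ o) = inj₂ (ℕₚ.≤-<-trans b≤c o)

-- A shear whose displacement depends on the row `n`. The growth condition keeps the support
-- bounded: rows inside the bound are translated by `HasSum-shift`, rows outside vanish on both
-- sides.
HasSum₂-shift : ∀ {g s} (c : ℤ → ℤ) → (∀ n → ∣ c n ∣ ≤ suc ∣ n ∣) → HasSum₂ g s → HasSum₂ (λ m n → g (c n ℤ.+ m) n) s
HasSum₂-shift {g} {s} c small (hasSum₂ B p v) = hasSum₂ M supp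
  (trans (sumℤ-swap M M (λ m n → g (c n ℤ.+ m) n))
  (trans (sumℤ-cong M row)
  (trans (sym (sumℤ-swap M M g))
    (HasSum₂-window (hasSum₂ B p v) M M (ℕₚ.m≤m+n B (suc B)) (ℕₚ.m≤m+n B (suc B))))))
  where
  M = B + suc B
  supp-inner : ∀ n → ∣ n ∣ ≤ B → Supp M (λ m → g (c n ℤ.+ m) n)
  supp-inner n n≤B = Supp-shift {B} {suc B} {λ m → g m n} (c n) (ℕₚ.≤-trans (small n) (s≤s n≤B)) (λ m o → p m n (inj₁ o))
  supp : ∀ m n → M < ∣ m ∣ ⊎ M < ∣ n ∣ → g (c n ℤ.+ m) n ≡ + 0
  supp m n (inj₂ o) = p (c n ℤ.+ m) n (inj₂ (ℕₚ.≤-<-trans (ℕₚ.m≤m+n B (suc B)) o))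
  supp m n (inj₁ o) with ∣ n ∣ ℕₚ.≤? B
  ... | yes n≤B = supp-inner n n≤B m o
  ... | no  n≰B = p (c n ℤ.+ m) n (inj₂ (ℕₚ.≰⇒> n≰B))
  row : ∀ n → sumℤ M (λ m → g (c n ℤ.+ m) n) ≡ sumℤ M (λ m → g m n)
  row n with ∣ n ∣ ℕₚ.≤? B
  ... | yes n≤B = HasSum-unique {λ m → g (c n ℤ.+ m) n} (hasSum M (supp-inner n n≤B) refl)
        (HasSum-shift {λ m → g m n} (c n) (hasSum M (λ m o → p m n (inj₁ (ℕₚ.≤-<-trans (ℕₚ.m≤m+n B (suc B)) o))) refl))
  ... | no  n≰B = trans (sumℤ-0 M λ m → p (c n ℤ.+ m) n (inj₂ (ℕₚ.≰⇒> n≰B)))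
        (sym (sumℤ-0 M λ m → p m n (inj₂ (ℕₚ.≰⇒> n≰B))))

parity : ∀ m → ∃ λ k → (m ≡ + 2 ℤ.* k ⊎ m ≡ + 2 ℤ.* k ℤ.+ + 1)
parity m = m ℤDM./ℕ 2 , cases (m ℤDM.%ℕ 2) (ℤDM.n%ℕd<d m 2) (ℤDM.a≡a%ℕn+[a/ℕn]*n m 2)
  where
  k = m ℤDM./ℕ 2
  cases : ∀ r → r < 2 → m ≡ + r ℤ.+ k ℤ.* + 2 → m ≡ + 2 ℤ.* k ⊎ m ≡ + 2 ℤ.* k ℤ.+ + 1
  cases zero       _ e = inj₁ (trans e (trans (ℤₚ.+-identityˡ (k ℤ.* + 2)) (ℤₚ.*-comm k (+ 2))))
  cases (suc zero) _ e = inj₂ (trans e (trans (ℤₚ.+-comm (+ 1) (k ℤ.* + 2)) (cong (ℤ._+ + 1) (ℤₚ.*-comm k (+ 2)))))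
  cases (suc (suc _)) (s≤s (s≤s ())) e

∣2k+r∣≤ : ∀ r k → ∣ + 2 ℤ.* k ℤ.+ + r ∣ ≤ ∣ k ∣ + ∣ k ∣ + r
∣2k+r∣≤ r k = subst (λ z → ∣ z ℤ.+ + r ∣ ≤ ∣ k ∣ + ∣ k ∣ + r) (lem k)
  (ℕₚ.≤-trans (ℤₚ.∣i+j∣≤∣i∣+∣j∣ (k ℤ.+ k) (+ r)) (ℕₚ.+-monoˡ-≤ r (ℤₚ.∣i+j∣≤∣i∣+∣j∣ k k)))
  where lem : ∀ k → k ℤ.+ k ≡ + 2 ℤ.* k
        lem = ℤ-ring

half-large : ∀ {B} r k → r ≤ 1 → suc (B + B) < ∣ + 2 ℤ.* k ℤ.+ + r ∣ → B < ∣ k ∣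
half-large {B} r k r≤1 lt = ℕₚ.≰⇒> λ k≤B → ℕₚ.<-irrefl refl (ℕₚ.<-≤-trans lt (ℕₚ.≤-trans (∣2k+r∣≤ r k)
  (ℕₚ.≤-trans (ℕₚ.+-mono-≤ (ℕₚ.+-mono-≤ k≤B k≤B) r≤1) (ℕₚ.≤-reflexive (ℕₚ.+-comm (B + B) 1)))))

HasSum₂-split₂ : ∀ {g s t} → HasSum₂ (λ m n → g (+ 2 ℤ.* m) n) s → HasSum₂ (λ m n → g (+ 2 ℤ.* m ℤ.+ + 1) n) t →
  HasSum₂ g (s ℤ.+ t)
HasSum₂-split₂ {g} {s} {t} G@(hasSum₂ B p v) H@(hasSum₂ C q w) = hasSum₂ D supp
  (HasSum-split₂ {λ m → sumℤ D (g m)}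
    (hasSum M (λ m o → sumℤ-0 D λ n → p m n (inj₁ (ℕₚ.≤-<-trans B≤M o))) (HasSum₂-window G M D B≤M (ℕₚ.≤-trans B≤M M≤D)))
    (hasSum M (λ m o → sumℤ-0 D λ n → q m n (inj₁ (ℕₚ.≤-<-trans C≤M o))) (HasSum₂-window H M D C≤M (ℕₚ.≤-trans C≤M M≤D)))
    {D} (λ m o → sumℤ-0 D λ n → supp m n (inj₁ o)))
  where
  M = B + C
  D = suc (M + M)
  B≤M = ℕₚ.m≤m+n B C
  C≤M = ℕₚ.m≤n+m C B
  M≤D : M ≤ D
  M≤D = ℕₚ.≤-trans (ℕₚ.m≤m+n M M) (ℕₚ.n≤1+n (M + M))
  supp : ∀ m n → D < ∣ m ∣ ⊎ D < ∣ n ∣ → g m n ≡ + 0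
  supp m n o with parity m
  supp m n (inj₁ o) | k , inj₁ refl = p k n (inj₁ (ℕₚ.≤-<-trans B≤M (half-large 0 k z≤n
    (subst (λ z → D < ∣ z ∣) (sym (ℤₚ.+-identityʳ (+ 2 ℤ.* k))) o))))
  supp m n (inj₁ o) | k , inj₂ refl = q k n (inj₁ (ℕₚ.≤-<-trans C≤M (half-large 1 k ℕₚ.≤-refl o)))
  supp m n (inj₂ o) | k , inj₁ refl = p k n (inj₂ (ℕₚ.≤-<-trans (ℕₚ.≤-trans B≤M M≤D) o))
  supp m n (inj₂ o) | k , inj₂ refl = q k n (inj₂ (ℕₚ.≤-<-trans (ℕₚ.≤-trans C≤M M≤D) o))

-- The sublattice {m ≡ n mod 2} and its complement, parametrised by (u + v , u - v) and (u + v + 1 , u - v).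
HasSum₂-rotate : ∀ {g s t} → HasSum₂ (λ u v → g (u ℤ.+ v) (u ℤ.- v)) s →
  HasSum₂ (λ u v → g (u ℤ.+ v ℤ.+ + 1) (u ℤ.- v)) t → HasSum₂ g (s ℤ.+ t)
HasSum₂-rotate {g} G H = HasSum₂-cong (λ m n → cong₂ g (e₃ m n) refl)
  (HasSum₂-shift -_ (λ n → ℕₚ.≤-trans (ℕₚ.≤-reflexive (ℤₚ.∣-i∣≡∣i∣ n)) (ℕₚ.n≤1+n _))
    -- Here w = m - n. Its parity separates the two cosets, with w = 2v or 2v + 1 and n = u - v;
    -- shears convert (u, v) to (w, n) and (w, n) to (m, n).
    (HasSum₂-split₂ {λ w n → g (n ℤ.+ w) n}
      (HasSum₂-swap (HasSum₂-cong (λ u v → cong₂ g (e₁ u v) (e₂ u v)) (HasSum₂-shift (λ v → v) (λ n → ℕₚ.n≤1+n _) G)))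
      (HasSum₂-swap (HasSum₂-cong (λ u v → cong₂ g (e₄ u v) (e₂ u v)) (HasSum₂-shift (λ v → v) (λ n → ℕₚ.n≤1+n _) H)))))
  where
  e₁ : ∀ u v → v ℤ.+ u ℤ.+ v ≡ u ℤ.+ + 2 ℤ.* v
  e₁ = ℤ-ring
  e₂ : ∀ u v → v ℤ.+ u ℤ.- v ≡ u
  e₂ = ℤ-ring
  e₃ : ∀ m n → n ℤ.+ (- n ℤ.+ m) ≡ m
  e₃ = ℤ-ring
  e₄ : ∀ u v → v ℤ.+ u ℤ.+ v ℤ.+ + 1 ≡ u ℤ.+ (+ 2 ℤ.* v ℤ.+ + 1)
  e₄ = ℤ-ring

-- Theta series and their products.

Θ : (ℤ → ℤ) → (ℤ → ℕ) → Series
Θ w e n = sumℤ n (λ m → w m ℤ.* X^ (e m) n)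

-- The bound that makes the cut at `∣ m ∣ ≤ n` in `Θ` lossless: an index beyond the cut has an
-- exponent larger than n.
Proper : (ℤ → ℕ) → Set
Proper e = ∀ m → ∣ m ∣ ≤ e m

Θ-support : ∀ (w : ℤ → ℤ) {e} → Proper e → ∀ n → Supp n (λ m → w m ℤ.* X^ (e m) n)
Θ-support w {e} proper n m n<m = trans
  (cong (w m ℤ.*_) (X^-off (e m) n (λ eq → ℕₚ.<-irrefl (sym eq) (ℕₚ.<-≤-trans n<m (proper m)))))
  (ℤₚ.*-zeroʳ (w m))

Θ-HasSum : ∀ (w : ℤ → ℤ) {e} → Proper e → ∀ n → HasSum (λ m → w m ℤ.* X^ (e m) n) (Θ w e n)
Θ-HasSum w proper n = hasSum n (Θ-support w proper n) refl

Θ-cong : ∀ {w w′ e e′} → (∀ m → w m ≡ w′ m) → (∀ m → e m ≡ e′ m) → Θ w e ≈ Θ w′ e′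
Θ-cong p q = mk λ n → sumℤ-cong n λ m → cong₂ (λ c k → c ℤ.* X^ k n) (p m) (q m)

-- Opens a product of theta series into a lattice sum, so that a quadratic identity becomes a change
-- of variables in ℤ².
Θ·Θ : ∀ (w w′ : ℤ → ℤ) {e e′} → Proper e → Proper e′ → ∀ N →
  HasSum₂ (λ m n → w m ℤ.* w′ n ℤ.* X^ (e m + e′ n) N) ((Θ w e · Θ w′ e′) N)
Θ·Θ w w′ {e} {e′} pr pr′ N = hasSum₂ N supp (sym (begin
  sumTo (λ k → Θ w e k ℤ.* Θ w′ e′ (N ∸ k)) N
    ≡⟨ sumTo-cong N (λ k k≤N → trans
         (cong₂ ℤ._*_ (sym (sumℤ-stable (Θ-support w pr k) N k≤N))
                      (sym (sumℤ-stable (Θ-support w′ pr′ (N ∸ k)) N (ℕₚ.m∸n≤m N k))))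
         (product (λ m → w m ℤ.* X^ (e m) k) (λ n → w′ n ℤ.* X^ (e′ n) (N ∸ k)))) ⟩
  sumTo (λ k → sumℤ N λ m → sumℤ N λ n → w m ℤ.* X^ (e m) k ℤ.* (w′ n ℤ.* X^ (e′ n) (N ∸ k))) N
    ≡⟨ sumTo-sumℤ N N (λ k m → sumℤ N λ n → w m ℤ.* X^ (e m) k ℤ.* (w′ n ℤ.* X^ (e′ n) (N ∸ k))) ⟩
  (sumℤ N λ m → sumTo (λ k → sumℤ N λ n → w m ℤ.* X^ (e m) k ℤ.* (w′ n ℤ.* X^ (e′ n) (N ∸ k))) N)
    ≡⟨ sumℤ-cong N (λ m → trans
         (sumTo-sumℤ N N (λ k n → w m ℤ.* X^ (e m) k ℤ.* (w′ n ℤ.* X^ (e′ n) (N ∸ k))))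
         (sumℤ-cong N λ n → trans (sumTo-cong N λ k _ → lem (w m) (X^ (e m) k) (w′ n) (X^ (e′ n) (N ∸ k)))
           (trans (sumTo-* (w m ℤ.* w′ n) (λ k → X^ (e m) k ℤ.* X^ (e′ n) (N ∸ k)) N)
             (cong (λ z → w m ℤ.* w′ n ℤ.* z) (sym (at (X^-+ (e m) (e′ n)) N)))))) ⟩
  (sumℤ N λ m → sumℤ N λ n → w m ℤ.* w′ n ℤ.* X^ (e m + e′ n) N) ∎))
  where
  open ≡-Reasoning
  lem : ∀ a b c d → a ℤ.* b ℤ.* (c ℤ.* d) ≡ a ℤ.* c ℤ.* (b ℤ.* d)
  lem = ℤ-ring
  product : ∀ f g → sumℤ N f ℤ.* sumℤ N g ≡ sumℤ N λ m → sumℤ N λ n → f m ℤ.* g n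
  product f g = trans (ℤₚ.*-comm (sumℤ N f) (sumℤ N g)) (trans (sym (sumℤ-* N (sumℤ N g) f))
    (sumℤ-cong N λ m → trans (ℤₚ.*-comm (sumℤ N g) (f m)) (sym (sumℤ-* N (f m) g))))
  supp : ∀ m n → N < ∣ m ∣ ⊎ N < ∣ n ∣ → w m ℤ.* w′ n ℤ.* X^ (e m + e′ n) N ≡ + 0
  supp m n o = trans (cong (λ z → w m ℤ.* w′ n ℤ.* z) (X^-off _ N (λ eq → ℕₚ.<-irrefl (sym eq) (large o))))
    (ℤₚ.*-zeroʳ (w m ℤ.* w′ n))
    where
    large : N < ∣ m ∣ ⊎ N < ∣ n ∣ → N < e m + e′ n
    large (inj₁ o) = ℕₚ.<-≤-trans o (ℕₚ.≤-trans (pr m) (ℕₚ.m≤m+n (e m) (e′ n)))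
    large (inj₂ o) = ℕₚ.<-≤-trans o (ℕₚ.≤-trans (pr′ n) (ℕₚ.m≤n+m (e′ n) (e m)))

X^-scale : ∀ d .{{_ : NonZero d}} k n → X^ (k * d) (n * d) ≡ X^ k n
X^-scale d k n with k ℕₚ.≟ n
... | yes refl = trans (X^-diag (k * d)) (sym (X^-diag k))
... | no  k≢n  = trans (X^-off (k * d) (n * d) (λ e → k≢n (ℕₚ.*-cancelʳ-≡ k n d e))) (sym (X^-off k n k≢n))

Θ-dil : ∀ d .{{_ : NonZero d}} w {e} → Proper e → dil d (Θ w e) ≈ Θ w (λ m → e m * d)
Θ-dil d w {e} proper = ≈-sym (dil-char d
  (mk λ n → HasSum-unique (Θ-HasSum w proper′ (n * d))
    (HasSum-cong (λ m → cong (w m ℤ.*_) (sym (X^-scale d (e m) n))) (Θ-HasSum w proper n)))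
  (λ r r<d r≢0 → mk λ n → trans (sumℤ-0 (r + n * d) λ m → trans
    (cong (w m ℤ.*_) (X^-off (e m * d) (r + n * d) λ eq → r≢0 (remainder (e m) r n r<d eq)))
    (ℤₚ.*-zeroʳ (w m))) (sym (const-zero n))))
  where
  import Data.Nat.DivMod as DM
  proper′ : Proper (λ m → e m * d)
  proper′ m = ℕₚ.≤-trans (proper m) (ℕₚ.m≤m*n (e m) d)
  remainder : ∀ k r n → r < d → k * d ≡ r + n * d → r ≡ 0
  remainder k r n r<d eq = trans (sym (DM.m<n⇒m%n≡m r<d)) (trans (sym (DM.[m+kn]%n≡m%n r n d))
    (trans (cong (DM._% d) (sym eq)) (DM.m*n%n≡0 k d)))

Θ-neg : ∀ w e → neg (Θ w e) ≈ Θ (λ m → sgn (e m) ℤ.* w m) e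
Θ-neg w e = mk λ n → trans (sym (sumℤ-* n (sgn n) (λ m → w m ℤ.* X^ (e m) n)))
  (sumℤ-cong n λ m → lem n (e m) (w m))
  where
  lem : ∀ n k c → sgn n ℤ.* (c ℤ.* X^ k n) ≡ sgn k ℤ.* c ℤ.* X^ k n
  lem n k c with k ℕₚ.≟ n
  ... | yes refl = sym (ℤₚ.*-assoc (sgn n) c (X^ k n))
  ... | no  k≢n  = trans (cong (λ z → sgn n ℤ.* (c ℤ.* z)) (X^-off k n k≢n))
        (trans (cong (sgn n ℤ.*_) (ℤₚ.*-zeroʳ c)) (trans (ℤₚ.*-zeroʳ (sgn n))
        (sym (trans (cong (sgn k ℤ.* c ℤ.*_) (X^-off k n k≢n)) (ℤₚ.*-zeroʳ (sgn k ℤ.* c))))))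

-- Theta series and their quadratic identities

θ : (ℤ → ℕ) → Series
θ = Θ (λ _ → + 1)

σ : ℤ → ℤ
σ m = sgn ∣ m ∣

infixl 6 _+⁺_
infixl 7 _*⁺_

_+⁺_ : ∀ {a b x y} → + a ≡ x → + b ≡ y → + (a + b) ≡ x ℤ.+ y
p +⁺ q = cong₂ ℤ._+_ p q

_*⁺_ : ∀ {a x} → + a ≡ x → ∀ d → + (a * d) ≡ x ℤ.* + d
_*⁺_ {a} p d = trans (ℤₚ.pos-* a d) (cong (ℤ._* + d) p)

-- Exponents are naturals, whereas the changes of variables are polynomial identities over ℤ. The
-- arguments `p` and `q`, assembled with `_+⁺_` and `_*⁺_`, translate between the two.
X^-≡ : ∀ {a b x y} → + a ≡ x → x ≡ y → + b ≡ y → ∀ N → X^ a N ≡ X^ b N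
X^-≡ p e q N = cong (λ k → X^ k N) (ℤₚ.+-injective (trans p (trans e (sym q))))

n≤n*1+ : ∀ n k → n ≤ n * suc k
n≤n*1+ n k = ℕₚ.m≤m*n n (suc k)

n≤n*n : ∀ n → n ≤ n * n
n≤n*n zero    = z≤n
n≤n*n (suc n) = n≤n*1+ (suc n) n

sq : ℤ → ℕ
sq m = ∣ m ∣ * ∣ m ∣

+sq : ∀ m → + sq m ≡ m ℤ.* m
+sq (+ n)    = ℤₚ.pos-* n n
+sq -[1+ n ] = refl

ψe : ℤ → ℕ
ψe (+ n)    = n * suc (n + n)
ψe -[1+ n ] = suc n * suc (n + n)

+ψe : ∀ m → + ψe m ≡ m ℤ.* (+ 2 ℤ.* m ℤ.+ + 1)
+ψe (+ n)    = trans (ℤₚ.pos-* n (suc (n + n))) (lem (+ n))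
  where lem : ∀ n → n ℤ.* (+ 1 ℤ.+ (n ℤ.+ n)) ≡ n ℤ.* (+ 2 ℤ.* n ℤ.+ + 1)
        lem = ℤ-ring
+ψe -[1+ n ] = trans (ℤₚ.pos-* (suc n) (suc (n + n))) (lem (+ n))
  where lem : ∀ n → (+ 1 ℤ.+ n) ℤ.* (+ 1 ℤ.+ (n ℤ.+ n)) ≡ (- (+ 1 ℤ.+ n)) ℤ.* (+ 2 ℤ.* (- (+ 1 ℤ.+ n)) ℤ.+ + 1)
        lem = ℤ-ring

-- The generalised octagonal numbers m(3m - 2). They enter through (3m - 1)² = 1 + 3m(3m - 2), that
-- is, through the 3-dissection of φ.
Ωe : ℤ → ℕ
Ωe (+ zero)  = 0
Ωe (+ suc n) = suc n * suc (n * 3)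
Ωe -[1+ n ]  = suc n * suc (4 + n * 3)

+Ωe : ∀ m → + Ωe m ≡ + 3 ℤ.* (m ℤ.* m) ℤ.- + 2 ℤ.* m
+Ωe (+ zero)  = refl
+Ωe (+ suc n) = trans (ℤₚ.pos-* (suc n) (suc (n * 3))) (trans (cong (λ z → (+ 1 ℤ.+ + n) ℤ.* (+ 1 ℤ.+ z)) (ℤₚ.pos-* n 3)) (lem (+ n)))
  where lem : ∀ n → (+ 1 ℤ.+ n) ℤ.* (+ 1 ℤ.+ n ℤ.* + 3) ≡ + 3 ℤ.* ((+ 1 ℤ.+ n) ℤ.* (+ 1 ℤ.+ n)) ℤ.- + 2 ℤ.* (+ 1 ℤ.+ n)
        lem = ℤ-ring
+Ωe -[1+ n ] = trans (ℤₚ.pos-* (suc n) (suc (4 + n * 3))) (trans (cong (λ z → (+ 1 ℤ.+ + n) ℤ.* (+ 5 ℤ.+ z)) (ℤₚ.pos-* n 3)) (lem (+ n)))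
  where lem : ∀ n → (+ 1 ℤ.+ n) ℤ.* (+ 5 ℤ.+ n ℤ.* + 3) ≡ + 3 ℤ.* ((- (+ 1 ℤ.+ n)) ℤ.* (- (+ 1 ℤ.+ n))) ℤ.- + 2 ℤ.* (- (+ 1 ℤ.+ n))
        lem = ℤ-ring

-- Indexed as n(n - 1)/2: then n² + `tri n` is the pentagonal number n(3n - 1)/2, and `tri` is the
-- exponent of `rising` at x = 0.
tri : ℕ → ℕ
tri zero    = 0
tri (suc n) = n + tri n

2tri : ∀ n → + 2 ℤ.* + tri n ≡ + n ℤ.* + n ℤ.- + n
2tri zero    = refl
2tri (suc n) = trans (ℤₚ.*-distribˡ-+ (+ 2) (+ n) (+ tri n)) (trans (cong (λ z → + 2 ℤ.* + n ℤ.+ z) (2tri n)) (lem (+ n)))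
  where lem : ∀ n → + 2 ℤ.* n ℤ.+ (n ℤ.* n ℤ.- n) ≡ (+ 1 ℤ.+ n) ℤ.* (+ 1 ℤ.+ n) ℤ.- (+ 1 ℤ.+ n)
        lem = ℤ-ring

pent : ℤ → ℕ
pent (+ n)    = n * n + tri n
pent -[1+ n ] = suc n * suc n + tri (suc n) + suc n

2pent : ∀ m → + 2 ℤ.* + pent m ≡ + 3 ℤ.* (m ℤ.* m) ℤ.- m
2pent (+ n)    = trans (cong (λ z → + 2 ℤ.* (z ℤ.+ + tri n)) (ℤₚ.pos-* n n)) (trans (ℤₚ.*-distribˡ-+ (+ 2) (+ n ℤ.* + n) (+ tri n))
  (trans (cong (λ z → + 2 ℤ.* (+ n ℤ.* + n) ℤ.+ z) (2tri n)) (lem (+ n))))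
  where lem : ∀ n → + 2 ℤ.* (n ℤ.* n) ℤ.+ (n ℤ.* n ℤ.- n) ≡ + 3 ℤ.* (n ℤ.* n) ℤ.- n
        lem = ℤ-ring
2pent -[1+ n ] = trans (cong (λ z → + 2 ℤ.* (z ℤ.+ + tri (suc n) ℤ.+ + suc n)) (ℤₚ.pos-* (suc n) (suc n)))
  (trans (lem₁ (+ suc n ℤ.* + suc n) (+ tri (suc n)) (+ suc n))
  (trans (cong (λ z → + 2 ℤ.* (+ suc n ℤ.* + suc n) ℤ.+ z ℤ.+ + 2 ℤ.* + suc n) (2tri (suc n))) (lem (+ suc n))))
  where
  lem₁ : ∀ a b c → + 2 ℤ.* (a ℤ.+ b ℤ.+ c) ≡ + 2 ℤ.* a ℤ.+ + 2 ℤ.* b ℤ.+ + 2 ℤ.* c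
  lem₁ = ℤ-ring
  lem : ∀ n → + 2 ℤ.* (n ℤ.* n) ℤ.+ (n ℤ.* n ℤ.- n) ℤ.+ + 2 ℤ.* n ≡ + 3 ℤ.* ((- n) ℤ.* (- n)) ℤ.- (- n)
  lem = ℤ-ring

4pent : ∀ m → + (pent m * 4) ≡ + 6 ℤ.* (m ℤ.* m) ℤ.- + 2 ℤ.* m
4pent m = trans (ℤₚ.pos-* (pent m) 4) (trans (lem₁ (+ pent m)) (trans (cong (λ z → + 2 ℤ.* z) (2pent m)) (lem₂ m)))
  where
  lem₁ : ∀ a → a ℤ.* + 4 ≡ + 2 ℤ.* (+ 2 ℤ.* a)
  lem₁ = ℤ-ring
  lem₂ : ∀ m → + 2 ℤ.* (+ 3 ℤ.* (m ℤ.* m) ℤ.- m) ≡ + 6 ℤ.* (m ℤ.* m) ℤ.- + 2 ℤ.* m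
  lem₂ = ℤ-ring

sq-proper : Proper sq
sq-proper m = n≤n*n ∣ m ∣

ψe-proper : Proper ψe
ψe-proper (+ n)    = n≤n*1+ n (n + n)
ψe-proper -[1+ n ] = n≤n*1+ (suc n) (n + n)

Ωe-proper : Proper Ωe
Ωe-proper (+ zero)  = z≤n
Ωe-proper (+ suc n) = n≤n*1+ (suc n) (n * 3)
Ωe-proper -[1+ n ]  = n≤n*1+ (suc n) (4 + n * 3)

pent-proper : Proper pent
pent-proper (+ n)    = ℕₚ.≤-trans (n≤n*n n) (ℕₚ.m≤m+n (n * n) (tri n))
pent-proper -[1+ n ] = ℕₚ.m≤n+m (suc n) (suc n * suc n + tri (suc n))

scale-proper : ∀ {e} d .{{_ : NonZero d}} → Proper e → Proper (λ m → e m * d)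
scale-proper {e} d p m = ℕₚ.≤-trans (p m) (ℕₚ.m≤m*n (e m) d)

suc-proper : ∀ {e} → Proper e → Proper (λ m → suc (e m))
suc-proper p m = ℕₚ.m≤n⇒m≤1+n (p m)

neg-proper : ∀ {e} → Proper e → Proper (λ m → e (- m))
neg-proper {e} p m = subst (ℕ._≤ e (- m)) (ℤₚ.∣-i∣≡∣i∣ m) (p (- m))

∣m∣≤∣lm+r∣ : ∀ l r m → r < suc l → ∣ m ∣ ≤ ∣ + suc l ℤ.* m ℤ.+ + r ∣
∣m∣≤∣lm+r∣ l r (+ n)    _       = ℕₚ.≤-trans (ℕₚ.m≤n*m n (suc l)) (ℕₚ.≤-trans (ℕₚ.m≤m+n (suc l * n) r)
  (ℕₚ.≤-reflexive (cong (λ z → ∣ z ℤ.+ + r ∣) (ℤₚ.pos-* (suc l) n))))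
∣m∣≤∣lm+r∣ l r -[1+ n ] (s≤s r≤l) = subst (suc n ℕ.≤_) (sym (trans (cong ∣_∣ eq) (ℤₚ.∣-i∣≡∣i∣ (+ (suc n + (l * n + (l ∸ r)))))))
    (ℕₚ.m≤m+n (suc n) (l * n + (l ∸ r)))
  where
  lem : ∀ l r n d → l ≡ r ℤ.+ d → (+ 1 ℤ.+ l) ℤ.* (- (+ 1 ℤ.+ n)) ℤ.+ r ≡ - (+ 1 ℤ.+ n ℤ.+ (l ℤ.* n ℤ.+ d))
  lem _ r n d refl = go r n d
    where go : ∀ r n d → (+ 1 ℤ.+ (r ℤ.+ d)) ℤ.* (- (+ 1 ℤ.+ n)) ℤ.+ r ≡ - (+ 1 ℤ.+ n ℤ.+ ((r ℤ.+ d) ℤ.* n ℤ.+ d))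
          go = ℤ-ring
  eq : + suc l ℤ.* -[1+ n ] ℤ.+ + r ≡ - (+ (suc n + (l * n + (l ∸ r))))
  eq = trans (lem (+ l) (+ r) (+ n) (+ (l ∸ r)) (cong +_ (sym (ℕₚ.m+[n∸m]≡n r≤l))))
    (cong (λ z → - (+ suc n ℤ.+ (z ℤ.+ + (l ∸ r)))) (sym (ℤₚ.pos-* l n)))

sq-affine-proper : ∀ l r → r < suc l → Proper (λ m → sq (+ suc l ℤ.* m ℤ.+ + r))
sq-affine-proper l r r<l m = ℕₚ.≤-trans (∣m∣≤∣lm+r∣ l r m r<l) (sq-proper (+ suc l ℤ.* m ℤ.+ + r))

sq-even-proper : Proper (λ m → sq (+ 2 ℤ.* m))
sq-even-proper m = subst (λ z → ∣ m ∣ ≤ sq z) (ℤₚ.+-identityʳ (+ 2 ℤ.* m)) (sq-affine-proper 1 0 (s≤s z≤n) m)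

sq-odd-proper : Proper (λ m → sq (+ 2 ℤ.* m ℤ.+ + 1))
sq-odd-proper = sq-affine-proper 1 1 (s≤s (s≤s z≤n))

sgn-*-odd : ∀ n k → sgn (n * suc (k + k)) ≡ sgn n
sgn-*-odd zero    k = refl
sgn-*-odd (suc n) k = cong -_ (trans (sgn-+ (k + k) (n * suc (k + k)))
  (trans (cong₂ ℤ._*_ (trans (sgn-+ k k) (sgn² k)) (sgn-*-odd n k)) (ℤₚ.*-identityˡ (sgn n))))

sgn-sq : ∀ n → sgn (n * n) ≡ sgn n
sgn-sq zero    = refl
sgn-sq (suc n) = trans (cong (λ k → - sgn k) (lem n)) (cong -_ (trans (sgn-+ (n * n) (n + n))
    (trans (cong₂ ℤ._*_ (sgn-sq n) (trans (sgn-+ n n) (sgn² n))) (ℤₚ.*-identityʳ (sgn n)))))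
  where lem : ∀ n → n + n * suc n ≡ n * n + (n + n)
        lem = ℕ-ring

sgn-Ωe : ∀ m → sgn (Ωe m) ≡ σ m
sgn-Ωe (+ zero)  = refl
sgn-Ωe (+ suc n) = trans (cong sgn (lem n)) (trans (sgn-+ (suc n * suc n) (n * suc n + n * suc n))
    (trans (cong₂ ℤ._*_ (sgn-sq (suc n)) (trans (sgn-+ (n * suc n) (n * suc n)) (sgn² (n * suc n)))) (ℤₚ.*-identityʳ (sgn (suc n)))))
  where lem : ∀ n → suc n * suc (n * 3) ≡ suc n * suc n + (n * suc n + n * suc n)
        lem = ℕ-ring
sgn-Ωe -[1+ n ]  = trans (cong sgn (lem n)) (trans (sgn-+ (suc n * suc n) (k + k))
    (trans (cong₂ ℤ._*_ (sgn-sq (suc n)) (trans (sgn-+ k k) (sgn² k))) (ℤₚ.*-identityʳ (sgn (suc n)))))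
  where k = suc n * (n + 2)
        lem : ∀ n → suc n * suc (4 + n * 3) ≡ suc n * suc n + (suc n * (n + 2) + suc n * (n + 2))
        lem = ℕ-ring

σ-suc : ∀ m → σ (+ 1 ℤ.+ m) ≡ - σ m
σ-suc (+ n)          = refl
σ-suc -[1+ zero ]    = refl
σ-suc -[1+ suc n ]   = sym (ℤₚ.neg-involutive (sgn (suc n)))

σ-neg : ∀ m → σ (- m) ≡ σ m
σ-neg m = cong sgn (ℤₚ.∣-i∣≡∣i∣ m)

σ-+ : ∀ m n → σ (m ℤ.+ n) ≡ σ m ℤ.* σ n
σ-+ (+ m) n = go m
  where
  go : ∀ m → σ (+ m ℤ.+ n) ≡ sgn m ℤ.* σ n
  go zero    = trans (cong σ (ℤₚ.+-identityˡ n)) (sym (ℤₚ.*-identityˡ (σ n)))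
  go (suc m) = trans (cong σ (ℤₚ.+-assoc (+ 1) (+ m) n)) (trans (σ-suc (+ m ℤ.+ n))
    (trans (cong -_ (go m)) (ℤₚ.neg-distribˡ-* (sgn m) (σ n))))
σ-+ m@(-[1+ k ]) n = trans (sym (σ-neg (m ℤ.+ n))) (trans (cong σ (ℤₚ.neg-distrib-+ m n))
  (trans (σ-+ (+ suc k) (- n)) (cong (sgn (suc k) ℤ.*_) (σ-neg n))))

σ-- : ∀ m n → σ (m ℤ.- n) ≡ σ m ℤ.* σ n
σ-- m n = trans (σ-+ m (- n)) (cong (σ m ℤ.*_) (σ-neg n))

-- φ = Σ q^{n²} and ψ = Σ q^{n(n+1)/2}; every triangular number is n(2n+1) for exactly one n ∈ ℤ.
φ ψ Ω E φ⁻ Ω⁻ : Series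
φ  = θ sq
ψ  = θ ψe
Ω  = θ Ωe
E  = Θ σ pent
φ⁻ = neg φ
Ω⁻ = neg Ω

φ⁻-Θ : φ⁻ ≈ Θ σ sq
φ⁻-Θ = ≈-trans (Θ-neg (λ _ → + 1) sq) (Θ-cong {e = sq} (λ m → trans (ℤₚ.*-identityʳ _) (sgn-sq ∣ m ∣)) (λ _ → refl))

Ω⁻-Θ : Ω⁻ ≈ Θ σ Ωe
Ω⁻-Θ = ≈-trans (Θ-neg (λ _ → + 1) Ωe) (Θ-cong {e = Ωe} (λ m → trans (ℤₚ.*-identityʳ _) (sgn-Ωe m)) (λ _ → refl))

θ-dil : ∀ d .{{_ : NonZero d}} {e} → Proper e → dil d (θ e) ≈ θ (λ m → e m * d)
θ-dil d = Θ-dil d (λ _ → + 1)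

θ-HasSum : ∀ {e} → Proper e → ∀ n → HasSum (λ m → + 1 ℤ.* X^ (e m) n) (θ e n)
θ-HasSum = Θ-HasSum (λ _ → + 1)

θ-neg : ∀ {e} → θ (λ m → e (- m)) ≈ θ e
θ-neg {e} = mk λ n → sumℤ-neg n (λ m → + 1 ℤ.* X^ (e m) n)

θ-shift : ∀ {e} c → Proper e → Proper (λ m → e (c ℤ.+ m)) → θ (λ m → e (c ℤ.+ m)) ≈ θ e
θ-shift {e} c p q = mk λ n → HasSum-unique (θ-HasSum q n)
  (HasSum-shift {λ m → + 1 ℤ.* X^ (e m) n} c (θ-HasSum p n))

θ-split₂ : ∀ {e} → Proper e → Proper (λ m → e (+ 2 ℤ.* m)) → Proper (λ m → e (+ 2 ℤ.* m ℤ.+ + 1)) →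
  θ e ≈ θ (λ m → e (+ 2 ℤ.* m)) ⊕ θ (λ m → e (+ 2 ℤ.* m ℤ.+ + 1))
θ-split₂ {e} p q r = mk λ n → HasSum-split₂ {λ m → + 1 ℤ.* X^ (e m) n}
  (θ-HasSum q n) (θ-HasSum r n) (Θ-support (λ _ → + 1) p n)

θ-split₃ : ∀ {e} → Proper e → Proper (λ m → e (+ 3 ℤ.* m)) → Proper (λ m → e (+ 3 ℤ.* m ℤ.+ + 1)) →
  Proper (λ m → e (+ 3 ℤ.* m ℤ.- + 1)) →
  θ e ≈ θ (λ m → e (+ 3 ℤ.* m)) ⊕ θ (λ m → e (+ 3 ℤ.* m ℤ.+ + 1)) ⊕ θ (λ m → e (+ 3 ℤ.* m ℤ.- + 1))
θ-split₃ {e} p q r s = mk λ n → HasSum-split₃ {λ m → + 1 ℤ.* X^ (e m) n}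
  (θ-HasSum q n) (θ-HasSum r n) (θ-HasSum s n) (Θ-support (λ _ → + 1) p n)

X·θ : ∀ {e} → Proper e → X · θ e ≈ θ (λ m → suc (e m))
X·θ {e} p = mk λ
  { zero    → sym (trans (cong (λ z → + 1 ℤ.* z) (X^-off (suc (e (+ 0))) 0 (λ ()))) refl)
  ; (suc n) → trans (X·-suc (θ e) n) (trans (sym (sumℤ-stable (Θ-support (λ _ → + 1) p n) (suc n) (ℕₚ.n≤1+n n)))
      (sumℤ-cong (suc n) λ m → cong (λ z → + 1 ℤ.* z) (sym (X·-suc (X^ (e m)) n)))) }

θ-cong : ∀ {e e′} → (∀ m → e m ≡ e′ m) → θ e ≈ θ e′
θ-cong = Θ-cong {λ _ → + 1} {λ _ → + 1} (λ _ → refl)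

sq-neg : ∀ m → sq (- m) ≡ sq m
sq-neg m = cong (λ k → k * k) (ℤₚ.∣-i∣≡∣i∣ m)

φ-even : θ (λ m → sq (+ 2 ℤ.* m)) ≈ dil 4 φ
φ-even = ≈-sym (≈-trans (θ-dil 4 sq-proper) (θ-cong λ m →
  ℤₚ.+-injective (trans (+sq m *⁺ 4) (trans (lem m) (sym (+sq (+ 2 ℤ.* m)))))))
  where lem : ∀ m → m ℤ.* m ℤ.* + 4 ≡ + 2 ℤ.* m ℤ.* (+ 2 ℤ.* m)
        lem = ℤ-ring

-- Since 4k + 3 = -(4(-1 - k) + 1), the odd numbers are the 4k + 1 and their negatives, and each
-- square (4k + 1)² = 1 + 8k(2k + 1) is counted twice.
φ-odd : θ (λ m → sq (+ 2 ℤ.* m ℤ.+ + 1)) ≈ const (+ 2) · X · dil 8 ψ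
φ-odd = begin
  θ (λ m → sq (+ 2 ℤ.* m ℤ.+ + 1))
    ≈⟨ θ-split₂ sq-odd-proper p₀ p₁ ⟩
  θ e₀ ⊕ θ e₁
    ≈⟨ ⊕-cong (θ-cong eq₀) (≈-trans (≈-sym (θ-neg {e₁})) (≈-trans
         (≈-sym (θ-shift {λ m → e₁ (- m)} (+ 1) (neg-proper {e₁} p₁)
           (λ m → subst (∣ m ∣ ℕ.≤_) (sym (eq₁ m)) (ℕₚ.m≤n⇒m≤1+n (scale-proper 8 ψe-proper m)))))
         (θ-cong eq₁))) ⟩
  θ (λ m → suc (ψe m * 8)) ⊕ θ (λ m → suc (ψe m * 8))
    ≈⟨ ⊕-cong (≈-sym both) (≈-sym both) ⟩
  X · dil 8 ψ ⊕ X · dil 8 ψ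
    ≈⟨ solve 2 (λ x p → x :* p :+ x :* p := con (+ 2) :* x :* p) ≈-refl X (dil 8 ψ) ⟩
  const (+ 2) · X · dil 8 ψ ∎
  where
  open ≈-Reasoning
  e₀ e₁ : ℤ → ℕ
  e₀ m = sq (+ 2 ℤ.* (+ 2 ℤ.* m) ℤ.+ + 1)
  e₁ m = sq (+ 2 ℤ.* (+ 2 ℤ.* m ℤ.+ + 1) ℤ.+ + 1)
  p₀ : Proper e₀
  p₀ m = subst (λ z → ∣ m ∣ ≤ sq z) (lem m) (sq-affine-proper 3 1 (s≤s (s≤s z≤n)) m)
    where lem : ∀ m → + 4 ℤ.* m ℤ.+ + 1 ≡ + 2 ℤ.* (+ 2 ℤ.* m) ℤ.+ + 1
          lem = ℤ-ring
  p₁ : Proper e₁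
  p₁ m = subst (λ z → ∣ m ∣ ≤ sq z) (lem m) (sq-affine-proper 3 3 (s≤s (s≤s (s≤s (s≤s z≤n)))) m)
    where lem : ∀ m → + 4 ℤ.* m ℤ.+ + 3 ≡ + 2 ℤ.* (+ 2 ℤ.* m ℤ.+ + 1) ℤ.+ + 1
          lem = ℤ-ring
  eq₀ : ∀ m → e₀ m ≡ suc (ψe m * 8)
  eq₀ m = ℤₚ.+-injective (trans (+sq (+ 2 ℤ.* (+ 2 ℤ.* m) ℤ.+ + 1)) (trans (lem m) (cong (λ z → + 1 ℤ.+ z) (sym (+ψe m *⁺ 8)))))
    where lem : ∀ m → (+ 2 ℤ.* (+ 2 ℤ.* m) ℤ.+ + 1) ℤ.* (+ 2 ℤ.* (+ 2 ℤ.* m) ℤ.+ + 1) ≡ + 1 ℤ.+ m ℤ.* (+ 2 ℤ.* m ℤ.+ + 1) ℤ.* + 8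
          lem = ℤ-ring
  eq₁ : ∀ m → e₁ (- (+ 1 ℤ.+ m)) ≡ suc (ψe m * 8)
  eq₁ m = ℤₚ.+-injective (trans (+sq (+ 2 ℤ.* (+ 2 ℤ.* (- (+ 1 ℤ.+ m)) ℤ.+ + 1) ℤ.+ + 1)) (trans (lem m) (cong (λ z → + 1 ℤ.+ z) (sym (+ψe m *⁺ 8)))))
    where lem : ∀ m → (+ 2 ℤ.* (+ 2 ℤ.* (- (+ 1 ℤ.+ m)) ℤ.+ + 1) ℤ.+ + 1) ℤ.* (+ 2 ℤ.* (+ 2 ℤ.* (- (+ 1 ℤ.+ m)) ℤ.+ + 1) ℤ.+ + 1) ≡ + 1 ℤ.+ m ℤ.* (+ 2 ℤ.* m ℤ.+ + 1) ℤ.* + 8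
          lem = ℤ-ring
  both : X · dil 8 ψ ≈ θ (λ m → suc (ψe m * 8))
  both = ≈-trans (·-congʳ X (θ-dil 8 ψe-proper)) (X·θ (scale-proper 8 ψe-proper))

φ-dissect₂ : φ ≈ dil 4 φ ⊕ const (+ 2) · X · dil 8 ψ
φ-dissect₂ = ≈-trans (θ-split₂ sq-proper sq-even-proper sq-odd-proper) (⊕-cong φ-even φ-odd)

-- The classes 1 and -1 mod 3 are exchanged by m ↦ -m and contribute equally, whence the 2.
φ-dissect₃ : φ ≈ dil 9 φ ⊕ const (+ 2) · X · dil 3 Ω
φ-dissect₃ = begin
  φ ≈⟨ θ-split₃ sq-proper p₀ (sq-affine-proper 2 1 (s≤s (s≤s z≤n))) p₂ ⟩
  θ (λ m → sq (+ 3 ℤ.* m)) ⊕ θ (λ m → sq (+ 3 ℤ.* m ℤ.+ + 1)) ⊕ θ (λ m → sq (+ 3 ℤ.* m ℤ.- + 1))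
    ≈⟨ ⊕-cong (⊕-cong (≈-sym (≈-trans (θ-dil 9 sq-proper) (θ-cong eq₀)))
         (≈-trans (≈-sym (θ-neg {λ m → sq (+ 3 ℤ.* m ℤ.+ + 1)})) (θ-cong eq₁))) (θ-cong eq₂) ⟩
  dil 9 φ ⊕ θ (λ m → suc (Ωe m * 3)) ⊕ θ (λ m → suc (Ωe m * 3))
    ≈⟨ ⊕-cong (⊕-congʳ (dil 9 φ) (≈-sym both)) (≈-sym both) ⟩
  dil 9 φ ⊕ X · dil 3 Ω ⊕ X · dil 3 Ω
    ≈⟨ solve 3 (λ f x p → f :+ x :* p :+ x :* p := f :+ con (+ 2) :* x :* p) ≈-refl (dil 9 φ) X (dil 3 Ω) ⟩
  dil 9 φ ⊕ const (+ 2) · X · dil 3 Ω ∎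
  where
  open ≈-Reasoning
  p₀ : Proper (λ m → sq (+ 3 ℤ.* m))
  p₀ m = subst (λ z → ∣ m ∣ ≤ sq z) (ℤₚ.+-identityʳ (+ 3 ℤ.* m)) (sq-affine-proper 2 0 (s≤s z≤n) m)
  eq₀ : ∀ m → sq m * 9 ≡ sq (+ 3 ℤ.* m)
  eq₀ m = ℤₚ.+-injective (trans (+sq m *⁺ 9) (trans (lem m) (sym (+sq (+ 3 ℤ.* m)))))
    where lem : ∀ m → m ℤ.* m ℤ.* + 9 ≡ + 3 ℤ.* m ℤ.* (+ 3 ℤ.* m)
          lem = ℤ-ring
  eq₂ : ∀ m → sq (+ 3 ℤ.* m ℤ.- + 1) ≡ suc (Ωe m * 3)
  eq₂ m = ℤₚ.+-injective (trans (+sq (+ 3 ℤ.* m ℤ.- + 1)) (trans (lem m) (cong (λ z → + 1 ℤ.+ z) (sym (+Ωe m *⁺ 3)))))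
    where lem : ∀ m → (+ 3 ℤ.* m ℤ.- + 1) ℤ.* (+ 3 ℤ.* m ℤ.- + 1) ≡ + 1 ℤ.+ (+ 3 ℤ.* (m ℤ.* m) ℤ.- + 2 ℤ.* m) ℤ.* + 3
          lem = ℤ-ring
  eq₁ : ∀ m → sq (+ 3 ℤ.* (- m) ℤ.+ + 1) ≡ suc (Ωe m * 3)
  eq₁ m = trans (cong sq (lem m)) (trans (sq-neg (+ 3 ℤ.* m ℤ.- + 1)) (eq₂ m))
    where lem : ∀ m → + 3 ℤ.* (- m) ℤ.+ + 1 ≡ - (+ 3 ℤ.* m ℤ.- + 1)
          lem = ℤ-ring
  p₂ : Proper (λ m → sq (+ 3 ℤ.* m ℤ.- + 1))
  p₂ m = subst (∣ m ∣ ℕ.≤_) (sym (eq₂ m)) (ℕₚ.m≤n⇒m≤1+n (scale-proper 3 Ωe-proper m))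
  both : X · dil 3 Ω ≈ θ (λ m → suc (Ωe m * 3))
  both = ≈-trans (·-congʳ X (θ-dil 3 Ωe-proper)) (X·θ (scale-proper 3 Ωe-proper))

HasSum₂-0 : ∀ {g} → (∀ m n → g m n ≡ + 0) → HasSum₂ g (+ 0)
HasSum₂-0 e = hasSum₂ 0 (λ m n _ → e m n) (e (+ 0) (+ 0))

θ·θ : ∀ {e e′} → Proper e → Proper e′ → ∀ N → HasSum₂ (λ m n → X^ (e m + e′ n) N) ((θ e · θ e′) N)
θ·θ p q N = HasSum₂-cong (λ m n → ℤₚ.*-identityˡ _) (Θ·Θ (λ _ → + 1) (λ _ → + 1) p q N)

2*-injective : ∀ {x y} → x ℤ.+ x ≡ y ℤ.+ y → x ≡ y
2*-injective {x} {y} e = ℤₚ.*-cancelˡ-≡ (+ 2) x y (trans (lem x) (trans e (sym (lem y))))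
  where lem : ∀ x → + 2 ℤ.* x ≡ x ℤ.+ x
        lem = ℤ-ring

⊕-self-injective : ∀ {f g} → f ⊕ f ≈ g ⊕ g → f ≈ g
⊕-self-injective p = mk λ n → 2*-injective (at p n)

-- The product is added to itself in both orders, which gives the weight σ(m) + σ(n) on q^{m²+n²}.
-- Off the sublattice m ≡ n (mod 2) this weight is 0. On it, m = u + v and n = u - v turn the
-- exponent into 2u² + 2v² and the weight into 2σ(u)σ(v).
φφ⁻ : φ · φ⁻ ≈ dil 2 (φ⁻ · φ⁻)
φφ⁻ = ⊕-self-injective (mk λ N → HasSum₂-unique (both N)
  (HasSum₂-cong {g = λ m n → (σ m ℤ.+ σ n) ℤ.* X^ (sq m + sq n) N} (λ m n → lem (σ m) (σ n) (X^ (sq m + sq n) N))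
    (subst (HasSum₂ _) (ℤₚ.+-identityʳ (R N ℤ.+ R N)) (HasSum₂-rotate {λ m n → (σ m ℤ.+ σ n) ℤ.* X^ (sq m + sq n) N}
      (HasSum₂-cong (on N) (HasSum₂-+ (rhs N) (rhs N)))
      (HasSum₂-0 λ u v → trans (cong (ℤ._* X^ (sq (u ℤ.+ v ℤ.+ + 1) + sq (u ℤ.- v)) N) (off u v)) refl)))))
  where
  R = dil 2 (φ⁻ · φ⁻)
  S : Series
  S = Θ σ (λ m → sq m * 2)
  R-Θ : R ≈ S · S
  R-Θ = ≈-trans (dil-· 2 φ⁻ φ⁻) (·-cong S′ S′)
    where S′ = ≈-trans (dil-cong 2 φ⁻-Θ) (Θ-dil 2 σ sq-proper)
  both : ∀ N → HasSum₂ (λ m n → + 1 ℤ.* σ n ℤ.* X^ (sq m + sq n) N ℤ.+ σ m ℤ.* + 1 ℤ.* X^ (sq m + sq n) N) ((φ · φ⁻ ⊕ φ · φ⁻) N)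
  both N = HasSum₂-+
    (subst (HasSum₂ _) (sym (at (·-congʳ φ φ⁻-Θ) N)) (Θ·Θ (λ _ → + 1) σ sq-proper sq-proper N))
    (subst (HasSum₂ _) (sym (at (≈-trans (·-comm φ φ⁻) (·-congˡ φ φ⁻-Θ)) N)) (Θ·Θ σ (λ _ → + 1) sq-proper sq-proper N))
  rhs : ∀ N → HasSum₂ (λ u v → σ u ℤ.* σ v ℤ.* X^ (sq u * 2 + sq v * 2) N) (R N)
  rhs N = subst (HasSum₂ _) (sym (at R-Θ N)) (Θ·Θ σ σ (scale-proper 2 sq-proper) (scale-proper 2 sq-proper) N)
  lem : ∀ a b x → (a ℤ.+ b) ℤ.* x ≡ + 1 ℤ.* b ℤ.* x ℤ.+ a ℤ.* + 1 ℤ.* x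
  lem = ℤ-ring
  poly : ∀ u v → u ℤ.* u ℤ.* + 2 ℤ.+ v ℤ.* v ℤ.* + 2 ≡ (u ℤ.+ v) ℤ.* (u ℤ.+ v) ℤ.+ (u ℤ.- v) ℤ.* (u ℤ.- v)
  poly = ℤ-ring
  on : ∀ N u v → σ u ℤ.* σ v ℤ.* X^ (sq u * 2 + sq v * 2) N ℤ.+ σ u ℤ.* σ v ℤ.* X^ (sq u * 2 + sq v * 2) N
    ≡ (σ (u ℤ.+ v) ℤ.+ σ (u ℤ.- v)) ℤ.* X^ (sq (u ℤ.+ v) + sq (u ℤ.- v)) N
  on N u v = trans (cong (λ x → σ u ℤ.* σ v ℤ.* x ℤ.+ σ u ℤ.* σ v ℤ.* x)
      (X^-≡ (+sq u *⁺ 2 +⁺ +sq v *⁺ 2) (poly u v) (+sq (u ℤ.+ v) +⁺ +sq (u ℤ.- v)) N))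
    (trans (lem₂ (σ u ℤ.* σ v) _) (cong (ℤ._* X^ (sq (u ℤ.+ v) + sq (u ℤ.- v)) N) (sym (cong₂ ℤ._+_ (σ-+ u v) (σ-- u v)))))
    where lem₂ : ∀ a x → a ℤ.* x ℤ.+ a ℤ.* x ≡ (a ℤ.+ a) ℤ.* x
          lem₂ = ℤ-ring
  off : ∀ u v → σ (u ℤ.+ v ℤ.+ + 1) ℤ.+ σ (u ℤ.- v) ≡ + 0
  off u v = trans (cong₂ ℤ._+_ (trans (cong σ (ℤₚ.+-comm (u ℤ.+ v) (+ 1))) (trans (σ-suc (u ℤ.+ v)) (cong -_ (σ-+ u v)))) (σ-- u v))
    (ℤₚ.+-inverseˡ (σ u ℤ.* σ v))

-- The same parity cancellation for the exponent 3m² - 2m + 3n², which becomes (6u² - 2u) + (6v² -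
-- 2v), four times a sum of two pentagonal numbers. Only the sum of the two products carries the
-- weight σ(m) + σ(n).
φΩ-E² : Ω⁻ · dil 3 φ ⊕ Ω · dil 3 φ⁻ ≈ dil 4 (E · E) ⊕ dil 4 (E · E)
φΩ-E² = mk λ N → HasSum₂-unique (both N)
  (HasSum₂-cong {g = λ m n → (σ m ℤ.+ σ n) ℤ.* X^ (Ωe m + sq n * 3) N} (λ m n → lem (σ m) (σ n) (X^ (Ωe m + sq n * 3) N))
    (subst (HasSum₂ _) (ℤₚ.+-identityʳ (R N ℤ.+ R N)) (HasSum₂-rotate {λ m n → (σ m ℤ.+ σ n) ℤ.* X^ (Ωe m + sq n * 3) N}
      (HasSum₂-cong (on N) (HasSum₂-+ (rhs N) (rhs N)))
      (HasSum₂-0 λ u v → trans (cong (ℤ._* X^ (Ωe (u ℤ.+ v ℤ.+ + 1) + sq (u ℤ.- v) * 3) N) (off u v)) refl))))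
  where
  R = dil 4 (E · E)
  S : Series
  S = Θ σ (λ m → pent m * 4)
  R-Θ : R ≈ S · S
  R-Θ = ≈-trans (dil-· 4 E E) (·-cong S′ S′)
    where S′ = Θ-dil 4 σ pent-proper
  both : ∀ N → HasSum₂ (λ m n → σ m ℤ.* + 1 ℤ.* X^ (Ωe m + sq n * 3) N ℤ.+ + 1 ℤ.* σ n ℤ.* X^ (Ωe m + sq n * 3) N)
    ((Ω⁻ · dil 3 φ ⊕ Ω · dil 3 φ⁻) N)
  both N = HasSum₂-+
    (subst (HasSum₂ _) (sym (at (·-cong Ω⁻-Θ (θ-dil 3 sq-proper)) N))
      (Θ·Θ σ (λ _ → + 1) Ωe-proper (scale-proper 3 sq-proper) N))
    (subst (HasSum₂ _) (sym (at (·-congʳ Ω (≈-trans (dil-cong 3 φ⁻-Θ) (Θ-dil 3 σ sq-proper))) N))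
      (Θ·Θ (λ _ → + 1) σ Ωe-proper (scale-proper 3 sq-proper) N))
  rhs : ∀ N → HasSum₂ (λ u v → σ u ℤ.* σ v ℤ.* X^ (pent u * 4 + pent v * 4) N) (R N)
  rhs N = subst (HasSum₂ _) (sym (at R-Θ N)) (Θ·Θ σ σ (scale-proper 4 pent-proper) (scale-proper 4 pent-proper) N)
  lem : ∀ a b x → (a ℤ.+ b) ℤ.* x ≡ a ℤ.* + 1 ℤ.* x ℤ.+ + 1 ℤ.* b ℤ.* x
  lem = ℤ-ring
  poly : ∀ u v → + 6 ℤ.* (u ℤ.* u) ℤ.- + 2 ℤ.* u ℤ.+ (+ 6 ℤ.* (v ℤ.* v) ℤ.- + 2 ℤ.* v)
    ≡ + 3 ℤ.* ((u ℤ.+ v) ℤ.* (u ℤ.+ v)) ℤ.- + 2 ℤ.* (u ℤ.+ v) ℤ.+ (u ℤ.- v) ℤ.* (u ℤ.- v) ℤ.* + 3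
  poly = ℤ-ring
  on : ∀ N u v → σ u ℤ.* σ v ℤ.* X^ (pent u * 4 + pent v * 4) N ℤ.+ σ u ℤ.* σ v ℤ.* X^ (pent u * 4 + pent v * 4) N
    ≡ (σ (u ℤ.+ v) ℤ.+ σ (u ℤ.- v)) ℤ.* X^ (Ωe (u ℤ.+ v) + sq (u ℤ.- v) * 3) N
  on N u v = trans (cong (λ x → σ u ℤ.* σ v ℤ.* x ℤ.+ σ u ℤ.* σ v ℤ.* x)
      (X^-≡ (4pent u +⁺ 4pent v) (poly u v) (+Ωe (u ℤ.+ v) +⁺ +sq (u ℤ.- v) *⁺ 3) N))
    (trans (lem₂ (σ u ℤ.* σ v) _) (cong (ℤ._* X^ (Ωe (u ℤ.+ v) + sq (u ℤ.- v) * 3) N) (sym (cong₂ ℤ._+_ (σ-+ u v) (σ-- u v)))))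
    where lem₂ : ∀ a x → a ℤ.* x ℤ.+ a ℤ.* x ≡ (a ℤ.+ a) ℤ.* x
          lem₂ = ℤ-ring
  off : ∀ u v → σ (u ℤ.+ v ℤ.+ + 1) ℤ.+ σ (u ℤ.- v) ≡ + 0
  off u v = trans (cong₂ ℤ._+_ (trans (cong σ (ℤₚ.+-comm (u ℤ.+ v) (+ 1))) (trans (σ-suc (u ℤ.+ v)) (cong -_ (σ-+ u v)))) (σ-- u v))
    (ℤₚ.+-inverseˡ (σ u ℤ.* σ v))

φ₀ φ₁ : Series
φ₀ = θ (λ m → sq (+ 2 ℤ.* m))
φ₁ = θ (λ m → sq (+ 2 ℤ.* m ℤ.+ + 1))

φ-parts : φ ≈ φ₀ ⊕ φ₁
φ-parts = θ-split₂ sq-proper sq-even-proper sq-odd-proper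

1+-small : ∀ n → ∣ + 1 ℤ.+ n ∣ ≤ suc ∣ n ∣
1+-small n = ℤₚ.∣i+j∣≤∣i∣+∣j∣ (+ 1) n

-- The rotation of ℤ² again: its two cosets give the even and the odd squares in φ. The odd coset
-- has `ψe` at -(1 + u), reached from u by a reflection and a unit shift.
ψ² : ψ · ψ ≈ dil 2 ψ · φ
ψ² = ≈-trans (mk λ N → HasSum₂-unique (θ·θ ψe-proper ψe-proper N)
    (HasSum₂-rotate {λ m n → X^ (ψe m + ψe n) N} (even N) (odd N)))
  (≈-sym (≈-trans (·-cong (θ-dil 2 ψe-proper) φ-parts)
    (RingSeries.distribˡ ψ₂ φ₀ φ₁)))
  where
  ψ₂ : Series
  ψ₂ = θ (λ m → ψe m * 2)
  even : ∀ N → HasSum₂ (λ u v → X^ (ψe (u ℤ.+ v) + ψe (u ℤ.- v)) N) ((ψ₂ · φ₀) N)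
  even N = HasSum₂-cong (λ u v → X^-≡ (+ψe u *⁺ 2 +⁺ +sq (+ 2 ℤ.* v)) (poly u v) (+ψe (u ℤ.+ v) +⁺ +ψe (u ℤ.- v)) N)
    (θ·θ (scale-proper 2 ψe-proper) sq-even-proper N)
    where
    poly : ∀ u v → u ℤ.* (+ 2 ℤ.* u ℤ.+ + 1) ℤ.* + 2 ℤ.+ + 2 ℤ.* v ℤ.* (+ 2 ℤ.* v)
      ≡ (u ℤ.+ v) ℤ.* (+ 2 ℤ.* (u ℤ.+ v) ℤ.+ + 1) ℤ.+ (u ℤ.- v) ℤ.* (+ 2 ℤ.* (u ℤ.- v) ℤ.+ + 1)
    poly = ℤ-ring
  odd : ∀ N → HasSum₂ (λ u v → X^ (ψe (u ℤ.+ v ℤ.+ + 1) + ψe (u ℤ.- v)) N) ((ψ₂ · φ₁) N)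
  odd N = HasSum₂-cong (λ u v → X^-≡ (+ψe (- (+ 1 ℤ.+ u)) *⁺ 2 +⁺ +sq (+ 2 ℤ.* v ℤ.+ + 1)) (poly u v)
      (+ψe (u ℤ.+ v ℤ.+ + 1) +⁺ +ψe (u ℤ.- v)) N)
    (HasSum₂-shift {λ u v → X^ (ψe (- u) * 2 + sq (+ 2 ℤ.* v ℤ.+ + 1)) N} (λ _ → + 1) (λ _ → s≤s z≤n)
      (HasSum₂-neg {λ u v → X^ (ψe u * 2 + sq (+ 2 ℤ.* v ℤ.+ + 1)) N} (θ·θ (scale-proper 2 ψe-proper) sq-odd-proper N)))
    where
    poly : ∀ u v → (- (+ 1 ℤ.+ u)) ℤ.* (+ 2 ℤ.* (- (+ 1 ℤ.+ u)) ℤ.+ + 1) ℤ.* + 2 ℤ.+ (+ 2 ℤ.* v ℤ.+ + 1) ℤ.* (+ 2 ℤ.* v ℤ.+ + 1)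
      ≡ (u ℤ.+ v ℤ.+ + 1) ℤ.* (+ 2 ℤ.* (u ℤ.+ v ℤ.+ + 1) ℤ.+ + 1) ℤ.+ (u ℤ.- v) ℤ.* (+ 2 ℤ.* (u ℤ.- v) ℤ.+ + 1)
    poly = ℤ-ring

-- With n = m + d, the parity of d separates the two terms and d mod 4 the even and odd parts of φ.
ψψ₃ : ψ · dil 3 ψ ≈ dil 4 ψ · dil 6 φ ⊕ X · (dil 2 φ · dil 12 ψ)
ψψ₃ = ≈-trans (·-congʳ ψ (θ-dil 3 ψe-proper)) (≈-trans
  (mk λ N → HasSum₂-unique (θ·θ ψe-proper (scale-proper 3 ψe-proper) N) (total N)) (≈-sym rhs))
  where
  A F B₀ B₁ D₀ D₁ : Series
  A = θ (λ m → ψe m * 4)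
  F = θ (λ m → ψe m * 12)
  B₀ = θ (λ m → sq (+ 2 ℤ.* m) * 6)
  B₁ = θ (λ m → sq (+ 2 ℤ.* m ℤ.+ + 1) * 6)
  D₀ = θ (λ m → suc (sq (+ 2 ℤ.* m) * 2))
  D₁ = θ (λ m → suc (sq (+ 2 ℤ.* m ℤ.+ + 1) * 2))
  rhs : dil 4 ψ · dil 6 φ ⊕ X · (dil 2 φ · dil 12 ψ) ≈ A · B₀ ⊕ A · B₁ ⊕ (D₁ · F ⊕ D₀ · F)
  rhs = begin
    dil 4 ψ · dil 6 φ ⊕ X · (dil 2 φ · dil 12 ψ)
      ≈⟨ ⊕-cong (·-cong (θ-dil 4 ψe-proper)
           (≈-trans (dil-cong 6 φ-parts) (≈-trans (dil-⊕ 6 φ₀ φ₁)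
             (⊕-cong (θ-dil 6 sq-even-proper) (θ-dil 6 sq-odd-proper)))))
         (·-congʳ X (·-cong (≈-trans (dil-cong 2 φ-parts) (≈-trans (dil-⊕ 2 φ₀ φ₁)
             (⊕-cong (θ-dil 2 sq-even-proper) (θ-dil 2 sq-odd-proper))))
           (θ-dil 12 ψe-proper))) ⟩
    A · (B₀ ⊕ B₁) ⊕ X · ((C₀ ⊕ C₁) · F)
      ≈⟨ solve 7 (λ a b₀ b₁ c₀ c₁ f x → a :* (b₀ :+ b₁) :+ x :* ((c₀ :+ c₁) :* f)
           := a :* b₀ :+ a :* b₁ :+ ((x :* c₁) :* f :+ (x :* c₀) :* f)) ≈-refl A B₀ B₁ C₀ C₁ F X ⟩
    A · B₀ ⊕ A · B₁ ⊕ ((X · C₁) · F ⊕ (X · C₀) · F)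
      ≈⟨ ⊕-congʳ (A · B₀ ⊕ A · B₁) (⊕-cong
           (·-congˡ F (X·θ (scale-proper 2 sq-odd-proper))) (·-congˡ F (X·θ (scale-proper 2 sq-even-proper)))) ⟩
    A · B₀ ⊕ A · B₁ ⊕ (D₁ · F ⊕ D₀ · F) ∎
    where
    open ≈-Reasoning
    C₀ C₁ : Series
    C₀ = θ (λ m → sq (+ 2 ℤ.* m) * 2)
    C₁ = θ (λ m → sq (+ 2 ℤ.* m ℤ.+ + 1) * 2)
  module _ (N : ℕ) where
    g f : ℤ → ℤ → ℤ
    g n m = X^ (ψe n + ψe m * 3) N
    f d m = g (m ℤ.+ d) m
    -- `d0` to `d3` treat d = 4c, 4c + 1, 4c + 2 and 4c + 3. Completing the square splits the
    -- exponent into a part in c + m and a part in c.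
    d0 : HasSum₂ (λ c m → f (+ 2 ℤ.* (+ 2 ℤ.* c)) m) ((A · B₀) N)
    d0 = HasSum₂-cong (λ c m → X^-≡ (+ψe (c ℤ.+ m) *⁺ 4 +⁺ +sq (+ 2 ℤ.* c) *⁺ 6) (poly c m)
        (+ψe (m ℤ.+ + 2 ℤ.* (+ 2 ℤ.* c)) +⁺ +ψe m *⁺ 3) N)
      (HasSum₂-swap {λ m c → X^ (ψe (c ℤ.+ m) * 4 + sq (+ 2 ℤ.* c) * 6) N}
        (HasSum₂-shift {λ a c → X^ (ψe a * 4 + sq (+ 2 ℤ.* c) * 6) N} (λ c → c) (λ c → ℕₚ.n≤1+n _)
          (θ·θ (scale-proper 4 ψe-proper) (scale-proper 6 sq-even-proper) N)))
      where
      poly : ∀ c m → (c ℤ.+ m) ℤ.* (+ 2 ℤ.* (c ℤ.+ m) ℤ.+ + 1) ℤ.* + 4 ℤ.+ + 2 ℤ.* c ℤ.* (+ 2 ℤ.* c) ℤ.* + 6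
        ≡ (m ℤ.+ + 2 ℤ.* (+ 2 ℤ.* c)) ℤ.* (+ 2 ℤ.* (m ℤ.+ + 2 ℤ.* (+ 2 ℤ.* c)) ℤ.+ + 1) ℤ.+ m ℤ.* (+ 2 ℤ.* m ℤ.+ + 1) ℤ.* + 3
      poly = ℤ-ring
    d2 : HasSum₂ (λ c m → f (+ 2 ℤ.* (+ 2 ℤ.* c ℤ.+ + 1)) m) ((A · B₁) N)
    d2 = HasSum₂-cong (λ c m → X^-≡ (+ψe (- (+ 1 ℤ.+ c ℤ.+ m)) *⁺ 4 +⁺ +sq (+ 2 ℤ.* c ℤ.+ + 1) *⁺ 6) (poly c m)
        (+ψe (m ℤ.+ + 2 ℤ.* (+ 2 ℤ.* c ℤ.+ + 1)) +⁺ +ψe m *⁺ 3) N)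
      (HasSum₂-swap {λ m c → X^ (ψe (- (+ 1 ℤ.+ c ℤ.+ m)) * 4 + sq (+ 2 ℤ.* c ℤ.+ + 1) * 6) N}
        (HasSum₂-shift {λ a c → X^ (ψe (- a) * 4 + sq (+ 2 ℤ.* c ℤ.+ + 1) * 6) N} (λ c → + 1 ℤ.+ c) 1+-small
          (HasSum₂-neg {λ a c → X^ (ψe a * 4 + sq (+ 2 ℤ.* c ℤ.+ + 1) * 6) N}
            (θ·θ (scale-proper 4 ψe-proper) (scale-proper 6 sq-odd-proper) N))))
      where
      poly : ∀ c m → (- (+ 1 ℤ.+ c ℤ.+ m)) ℤ.* (+ 2 ℤ.* (- (+ 1 ℤ.+ c ℤ.+ m)) ℤ.+ + 1) ℤ.* + 4 ℤ.+ (+ 2 ℤ.* c ℤ.+ + 1) ℤ.* (+ 2 ℤ.* c ℤ.+ + 1) ℤ.* + 6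
        ≡ (m ℤ.+ + 2 ℤ.* (+ 2 ℤ.* c ℤ.+ + 1)) ℤ.* (+ 2 ℤ.* (m ℤ.+ + 2 ℤ.* (+ 2 ℤ.* c ℤ.+ + 1)) ℤ.+ + 1) ℤ.+ m ℤ.* (+ 2 ℤ.* m ℤ.+ + 1) ℤ.* + 3
      poly = ℤ-ring
    d1 : HasSum₂ (λ c m → f (+ 2 ℤ.* (+ 2 ℤ.* c) ℤ.+ + 1) m) ((D₁ · F) N)
    d1 = HasSum₂-cong (λ c m → X^-≡
        (cong (λ z → + 1 ℤ.+ z) (+sq (+ 2 ℤ.* (c ℤ.+ m) ℤ.+ + 1) *⁺ 2) +⁺ +ψe c *⁺ 12) (poly c m)
        (+ψe (m ℤ.+ (+ 2 ℤ.* (+ 2 ℤ.* c) ℤ.+ + 1)) +⁺ +ψe m *⁺ 3) N)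
      (HasSum₂-swap {λ m c → X^ (suc (sq (+ 2 ℤ.* (c ℤ.+ m) ℤ.+ + 1) * 2) + ψe c * 12) N}
        (HasSum₂-shift {λ a c → X^ (suc (sq (+ 2 ℤ.* a ℤ.+ + 1) * 2) + ψe c * 12) N} (λ c → c) (λ c → ℕₚ.n≤1+n _)
          (θ·θ (suc-proper (scale-proper 2 sq-odd-proper)) (scale-proper 12 ψe-proper) N)))
      where
      poly : ∀ c m → + 1 ℤ.+ (+ 2 ℤ.* (c ℤ.+ m) ℤ.+ + 1) ℤ.* (+ 2 ℤ.* (c ℤ.+ m) ℤ.+ + 1) ℤ.* + 2 ℤ.+ c ℤ.* (+ 2 ℤ.* c ℤ.+ + 1) ℤ.* + 12
        ≡ (m ℤ.+ (+ 2 ℤ.* (+ 2 ℤ.* c) ℤ.+ + 1)) ℤ.* (+ 2 ℤ.* (m ℤ.+ (+ 2 ℤ.* (+ 2 ℤ.* c) ℤ.+ + 1)) ℤ.+ + 1) ℤ.+ m ℤ.* (+ 2 ℤ.* m ℤ.+ + 1) ℤ.* + 3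
      poly = ℤ-ring
    d3 : HasSum₂ (λ c m → f (+ 2 ℤ.* (+ 2 ℤ.* c ℤ.+ + 1) ℤ.+ + 1) m) ((D₀ · F) N)
    d3 = HasSum₂-cong (λ c m → X^-≡
        (cong (λ z → + 1 ℤ.+ z) (+sq (+ 2 ℤ.* (+ 1 ℤ.+ c ℤ.+ m)) *⁺ 2) +⁺ +ψe (- (+ 1 ℤ.+ c)) *⁺ 12) (poly c m)
        (+ψe (m ℤ.+ (+ 2 ℤ.* (+ 2 ℤ.* c ℤ.+ + 1) ℤ.+ + 1)) +⁺ +ψe m *⁺ 3) N)
      (HasSum₂-swap {λ m c → X^ (suc (sq (+ 2 ℤ.* (+ 1 ℤ.+ c ℤ.+ m)) * 2) + ψe (- (+ 1 ℤ.+ c)) * 12) N}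
        (HasSum₂-shift {λ a c → X^ (suc (sq (+ 2 ℤ.* a) * 2) + ψe (- (+ 1 ℤ.+ c)) * 12) N} (λ c → + 1 ℤ.+ c) 1+-small
          (HasSum₂-swap {λ c a → X^ (suc (sq (+ 2 ℤ.* a) * 2) + ψe (- (+ 1 ℤ.+ c)) * 12) N}
            (HasSum₂-shift {λ b a → X^ (suc (sq (+ 2 ℤ.* a) * 2) + ψe (- b) * 12) N} (λ _ → + 1) (λ _ → s≤s z≤n)
              (HasSum₂-neg {λ b a → X^ (suc (sq (+ 2 ℤ.* a) * 2) + ψe b * 12) N}
                (HasSum₂-swap {λ a b → X^ (suc (sq (+ 2 ℤ.* a) * 2) + ψe b * 12) N}
                  (θ·θ (suc-proper (scale-proper 2 sq-even-proper)) (scale-proper 12 ψe-proper) N)))))))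
      where
      poly : ∀ c m → + 1 ℤ.+ + 2 ℤ.* (+ 1 ℤ.+ c ℤ.+ m) ℤ.* (+ 2 ℤ.* (+ 1 ℤ.+ c ℤ.+ m)) ℤ.* + 2 ℤ.+ (- (+ 1 ℤ.+ c)) ℤ.* (+ 2 ℤ.* (- (+ 1 ℤ.+ c)) ℤ.+ + 1) ℤ.* + 12
        ≡ (m ℤ.+ (+ 2 ℤ.* (+ 2 ℤ.* c ℤ.+ + 1) ℤ.+ + 1)) ℤ.* (+ 2 ℤ.* (m ℤ.+ (+ 2 ℤ.* (+ 2 ℤ.* c ℤ.+ + 1) ℤ.+ + 1)) ℤ.+ + 1) ℤ.+ m ℤ.* (+ 2 ℤ.* m ℤ.+ + 1) ℤ.* + 3
      poly = ℤ-ring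
    total : HasSum₂ g ((A · B₀ ⊕ A · B₁ ⊕ (D₁ · F ⊕ D₀ · F)) N)
    total = HasSum₂-cong (λ n m → cong (λ z → g z m) (lem n m))
      (HasSum₂-shift {f} -_ (λ n → ℕₚ.≤-trans (ℕₚ.≤-reflexive (ℤₚ.∣-i∣≡∣i∣ n)) (ℕₚ.n≤1+n _))
        (HasSum₂-split₂ {f} (HasSum₂-split₂ {λ b m → f (+ 2 ℤ.* b) m} d0 d2)
          (HasSum₂-split₂ {λ b m → f (+ 2 ℤ.* b ℤ.+ + 1) m} d1 d3)))
      where lem : ∀ n m → m ℤ.+ (- m ℤ.+ n) ≡ n
            lem = ℤ-ring

-- Product expansions

infix 4 _≈_[upto_]

record _≈_[upto_] (f g : Series) (n : ℕ) : Set where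
  constructor mkUpto
  field atUpto : ∀ k → k ≤ n → f k ≡ g k
open _≈_[upto_] public

uptoSetoid : ℕ → Setoid _ _
uptoSetoid n = record
  { Carrier = Series ; _≈_ = λ f g → f ≈ g [upto n ]
  ; isEquivalence = record
    { refl  = mkUpto λ _ _ → refl
    ; sym   = λ p → mkUpto λ k k≤n → sym (atUpto p k k≤n)
    ; trans = λ p q → mkUpto λ k k≤n → trans (atUpto p k k≤n) (atUpto q k k≤n) } }

≈⇒upto : ∀ {n f g} → f ≈ g → f ≈ g [upto n ]
≈⇒upto p = mkUpto λ k _ → at p k

upto-refl : ∀ {n f} → f ≈ f [upto n ]
upto-refl = mkUpto λ _ _ → refl

upto-sym : ∀ {n f g} → f ≈ g [upto n ] → g ≈ f [upto n ]
upto-sym {n} = Setoid.sym (uptoSetoid n)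

upto-trans : ∀ {n f g h} → f ≈ g [upto n ] → g ≈ h [upto n ] → f ≈ h [upto n ]
upto-trans {n} = Setoid.trans (uptoSetoid n)

upto-≤ : ∀ {m n f g} → m ≤ n → f ≈ g [upto n ] → f ≈ g [upto m ]
upto-≤ m≤n p = mkUpto λ k k≤m → atUpto p k (ℕₚ.≤-trans k≤m m≤n)

·-cong-upto : ∀ {n f f′ g g′} → f ≈ f′ [upto n ] → g ≈ g′ [upto n ] → f · g ≈ f′ · g′ [upto n ]
·-cong-upto {n} {f} {f′} {g} {g′} p q = mkUpto λ k k≤n → ·-cong-≤ {f} {f′} {g} {g′} k
  (λ j j≤k → atUpto p j (ℕₚ.≤-trans j≤k k≤n)) (λ j j≤k → atUpto q j (ℕₚ.≤-trans j≤k k≤n))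

·-congˡ-upto : ∀ {n} g {f f′} → f ≈ f′ [upto n ] → f · g ≈ f′ · g [upto n ]
·-congˡ-upto g p = ·-cong-upto {g = g} p upto-refl

·-congʳ-upto : ∀ {n} f {g g′} → g ≈ g′ [upto n ] → f · g ≈ f · g′ [upto n ]
·-congʳ-upto f p = ·-cong-upto {f = f} upto-refl p

upto-all : ∀ {f g} → (∀ n → f ≈ g [upto n ]) → f ≈ g
upto-all p = mk λ n → atUpto (p n) n ℕₚ.≤-refl

dil-upto : ∀ d .{{_ : NonZero d}} {m n f g} → m < suc n * d → f ≈ g [upto n ] → dil d f ≈ dil d g [upto m ]
dil-upto d {m} {n} m<nd p = mkUpto λ k k≤m → cong (λ z → if k DM.% d ≡ᵇ 0 then z else + 0)
  (atUpto p (k DM./ d) (ℕ.s≤s⁻¹ (DM.m<n*o⇒m/o<n (ℕₚ.≤-<-trans k≤m m<nd))))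

upto-cancel : ∀ {n f g} D → D 0 ≡ + 1 → f · D ≈ g · D [upto n ] → f ≈ g [upto n ]
upto-cancel {n} {f} {g} D D0 p = mkUpto λ k k≤n → ℤₚ.i-j≡0⇒i≡j _ _ (go k k≤n)
  where
  vanish : ∀ k → k ≤ n → ((f ⊕ ⊖ g) · D) k ≡ + 0
  vanish k k≤n = trans (at (solve 3 (λ f g D → (f :+ (:- g)) :* D := f :* D :+ (:- (g :* D))) ≈-refl f g D) k)
    (trans (cong (ℤ._- (g · D) k) (atUpto p k k≤n)) (ℤₚ.+-inverseʳ ((g · D) k)))
  go : ∀ k → k ≤ n → (f ⊕ ⊖ g) k ≡ + 0
  go = <-rec (λ k → k ≤ n → (f ⊕ ⊖ g) k ≡ + 0) λ k ih k≤n →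
    trans (sym (ℤₚ.*-identityʳ _)) (trans (cong ((f ⊕ ⊖ g) k ℤ.*_) (sym D0))
    (trans (sym (ℤₚ.i-j≡0⇒i≡j _ _ (Sgn.0∣⇒≡0 (·-leading (+ 0) {f ⊕ ⊖ g} D k λ j j<k →
      subst (+ 0 ∣ˢ_) (sym (ih j<k (ℕₚ.≤-trans (ℕₚ.<⇒≤ j<k) k≤n))) ∣0)))) (vanish k k≤n)))

X^-remainder : ∀ d .{{_ : NonZero d}} k {r} n → r < d → r ≢ 0 → X^ (k * d) (r + n * d) ≡ + 0
X^-remainder d k {r} n r<d r≢0 = X^-off (k * d) (r + n * d) λ eq → r≢0
  (trans (sym (DM.m<n⇒m%n≡m r<d)) (trans (sym (DM.[m+kn]%n≡m%n r n d))
    (trans (cong (DM._% d) (sym eq)) (DM.m*n%n≡0 k d))))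

dil-X^ : ∀ d .{{_ : NonZero d}} k → dil d (X^ k) ≈ X^ (k * d)
dil-X^ d k = ≈-sym (dil-char d (mk (X^-scale d k))
  λ r r<d r≢0 → mk λ n → trans (X^-remainder d k n r<d r≢0) (sym (const-zero n)))

one± : ℤ → ℕ → Series
one± c d = const (+ 1) ⊕ const c · X^ d

one±-dil : ∀ d .{{_ : NonZero d}} c k → dil d (one± c k) ≈ one± c (k * d)
one±-dil d c k = ≈-trans (dil-⊕ d (const (+ 1)) (const c · X^ k)) (⊕-cong (dil-const d (+ 1))
  (≈-trans (dil-· d (const c) (X^ k)) (·-cong (dil-const d c) (dil-X^ d k))))

one±-low : ∀ {n} c d → n < d → one± c d ≈ const (+ 1) [upto n ]
one±-low {n} c d n<d = mkUpto λ k k≤n → trans (cong (λ z → const (+ 1) k ℤ.+ z)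
    (trans (const-· c (X^ d) k) (trans (cong (c ℤ.*_) (X^-off d k λ eq → ℕₚ.<-irrefl (sym eq) (ℕₚ.≤-<-trans k≤n n<d))) (ℤₚ.*-zeroʳ c))))
  (ℤₚ.+-identityʳ _)

one±-0 : ∀ c d → one± c (suc d) 0 ≡ + 1
one±-0 c d = trans (cong (λ z → + 1 ℤ.+ z) (ℤₚ.*-zeroʳ c)) refl

prod : (ℕ → Series) → ℕ → Series
prod F zero    = const (+ 1)
prod F (suc n) = prod F n · F n

prod-dil : ∀ d .{{_ : NonZero d}} {F G} → (∀ j → dil d (F j) ≈ G j) → ∀ n → dil d (prod F n) ≈ prod G n
prod-dil d h zero    = dil-const d (+ 1)
prod-dil d {F} h (suc n) = ≈-trans (dil-· d (prod F n) (F n)) (·-cong (prod-dil d h n) (h n))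

prod-· : ∀ {F G H} → (∀ j → F j · G j ≈ H j) → ∀ n → prod F n · prod G n ≈ prod H n
prod-· h zero = ·-identityˡ (const (+ 1))
prod-· {F} {G} h (suc n) = ≈-trans
  (solve 4 (λ a b c d → (a :* b) :* (c :* d) := (a :* c) :* (b :* d)) ≈-refl (prod F n) (F n) (prod G n) (G n))
  (·-cong (prod-· h n) (h n))

prod-0 : ∀ {F} → (∀ j → F j 0 ≡ + 1) → ∀ n → prod F n 0 ≡ + 1
prod-0 h zero    = refl
prod-0 h (suc n) = cong₂ ℤ._*_ (prod-0 h n) (h n)

prod-interleave : ∀ F n → prod F (n + n) ≈ prod (λ j → F (j + j)) n · prod (λ j → F (suc (j + j))) n
prod-interleave F zero    = ≈-sym (·-identityˡ (const (+ 1)))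
prod-interleave F (suc n) = begin
  prod F (n + suc n) · F (n + suc n)
    ≈⟨ mk (λ k → cong (λ m → (prod F m · F m) k) (ℕₚ.+-suc n n)) ⟩
  prod F (n + n) · F (n + n) · F (suc (n + n))
    ≈⟨ ·-congˡ (F (suc (n + n))) (·-congˡ (F (n + n)) (prod-interleave F n)) ⟩
  a · b · F (n + n) · F (suc (n + n))
    ≈⟨ solve 4 (λ a b c d → a :* b :* c :* d := (a :* c) :* (b :* d)) ≈-refl a b (F (n + n)) (F (suc (n + n))) ⟩
  a · F (n + n) · (b · F (suc (n + n))) ∎
  where
  open ≈-Reasoning
  a = prod (λ j → F (j + j)) n
  b = prod (λ j → F (suc (j + j))) n

all± odd± : ℤ → ℕ → Series
all± c = prod λ j → one± c (suc j)
odd± c = prod λ j → one± c (suc (j + j))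

asc-all : ∀ n → asc 0 n ≈ all± (- + 1) n
asc-all zero    = ≈-refl
asc-all (suc n) = ·-cong (asc-all n)
  (solve 1 (λ x → con (+ 1) :+ (:- x) := con (+ 1) :+ con (- + 1) :* x) ≈-refl (X^ (suc n)))

all±-split : ∀ c n → all± c (n + n) ≈ odd± c n · dil 2 (all± c n)
all±-split c n = ≈-trans (prod-interleave (λ j → one± c (suc j)) n) (·-congʳ (odd± c n)
  (≈-sym (prod-dil 2 (λ j → ≈-trans (one±-dil 2 c (suc j)) (mk λ k → cong (λ m → one± c m k) (lem j))) n)))
  where lem : ∀ j → suc j * 2 ≡ suc (suc (j + j))
        lem = ℕ-ring

Θ-partial : (ℤ → ℤ) → (ℤ → ℕ) → ℕ → Series
Θ-partial w e B n = sumℤ B (λ m → w m ℤ.* X^ (e m) n)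

Θ-partial-upto : ∀ w {e} → Proper e → ∀ n → Θ-partial w e n ≈ Θ w e [upto n ]
Θ-partial-upto w p n = mkUpto λ k k≤n → sumℤ-stable (Θ-support w p k) n k≤n

Θ-partial-suc : ∀ w e n → Θ-partial w e (suc n) ≈
  Θ-partial w e n ⊕ (const (w (+ suc n)) · X^ (e (+ suc n)) ⊕ const (w -[1+ n ]) · X^ (e -[1+ n ]))
Θ-partial-suc w e n = mk λ k → cong (λ z → Θ-partial w e n k ℤ.+ z) (sym (cong₂ ℤ._+_
  (const-· (w (+ suc n)) (X^ (e (+ suc n))) k) (const-· (w -[1+ n ]) (X^ (e -[1+ n ])) k)))

sgn-const-suc : ∀ n → ⊖ const (sgn n) ≈ const (sgn (suc n))
sgn-const-suc n = mk λ { zero → refl ; (suc _) → refl }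

Θ-partial-0 : ∀ w e → Θ-partial w e 0 ≈ const (w (+ 0)) · X^ (e (+ 0))
Θ-partial-0 w e = mk λ k → sym (const-· (w (+ 0)) (X^ (e (+ 0))) k)

⊕-move : ∀ {f g h} → f ≈ g ⊕ h → g ≈ f ⊕ ⊖ h
⊕-move {f} {g} {h} p = ≈-trans (solve 2 (λ g h → g := g :+ h :+ (:- h)) ≈-refl g h) (⊕-congˡ (⊖ h) (≈-sym p))

module Gauss where
  open Shanks (+ 1)

  rising-all : ∀ n → rising (suc n) ≈ const (+ 2) · all± (+ 1) n
  rising-all zero    = solve 0 (con (+ 1) :* (con (+ 1) :+ con (+ 1)) := con (+ 2) :* con (+ 1)) ≈-refl
  rising-all (suc n) = ≈-trans (·-congˡ (const (+ 1) ⊕ X^ (suc n)) (rising-all n))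
    (solve 2 (λ a x → con (+ 2) :* a :* (con (+ 1) :+ x) := con (+ 2) :* (a :* (con (+ 1) :+ con (+ 1) :* x))) ≈-refl
      (all± (+ 1) n) (X^ (suc n)))

  finite : ∀ n → Θ-partial σ sq n · all± (+ 1) n ≈ shanks n
  finite zero    = ≈-trans (·-congˡ (const (+ 1)) (Θ-partial-0 σ sq))
    (solve 0 (con (+ 1) :* con (+ 1) :* con (+ 1) := con (+ 1) :* con (+ 1) :* con (+ 1) :* con (+ 1)) ≈-refl)
  finite (suc n) = begin
    Θ-partial σ sq N · (B · one± (+ 1) N)
      ≈⟨ ·-congˡ (B · one± (+ 1) N) (≈-trans (Θ-partial-suc σ sq n)
           (⊕-congʳ P (⊕-cong (·-congˡ Q (≈-sym (sgn-const-suc n))) (·-congˡ Q (≈-sym (sgn-const-suc n)))))) ⟩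
    (P ⊕ (⊖ s · Q ⊕ ⊖ s · Q)) · (B · (const (+ 1) ⊕ const (+ 1) · Y))
      ≈⟨ solve 5 (λ p s q b y → (p :+ ((:- s) :* q :+ (:- s) :* q)) :* (b :* (con (+ 1) :+ con (+ 1) :* y))
           := (con (+ 1) :+ con (+ 1) :* y) :* (p :* b) :+ (:- (s :* q :* (con (+ 2) :* b) :* (con (+ 1) :+ y)))) ≈-refl P s Q B Y ⟩
    (const (+ 1) ⊕ const (+ 1) · Y) · (P · B) ⊕ ⊖ (s · Q · (const (+ 2) · B) · (const (+ 1) ⊕ Y))
      ≈⟨ ⊕-cong (·-congʳ (const (+ 1) ⊕ const (+ 1) · Y) (finite n))
           (⊖-cong (·-congˡ (const (+ 1) ⊕ Y) (·-congʳ (s · Q) (≈-sym (rising-all n))))) ⟩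
    (const (+ 1) ⊕ const (+ 1) · Y) · shanks n ⊕ ⊖ (s · Q · rising N · (const (+ 1) ⊕ Y))
      ≈⟨ ⊕-move (shanks-suc n) ⟨
    shanks N ∎
    where
    open ≈-Reasoning
    N = suc n
    P = Θ-partial σ sq n
    B = all± (+ 1) n
    s = const (sgn n)
    Q = X^ (N * N)
    Y = X^ N

  -- The truncated form of φ(-q) = ∏ (1 - q^j)/(1 + q^j), with the denominator kept on the left so
  -- that only polynomials are multiplied.
  φ⁻-product : ∀ n → φ⁻ · all± (+ 1) n ≈ all± (- + 1) n [upto n ]
  φ⁻-product n = begin
    φ⁻ · all± (+ 1) n                    ≈⟨ ≈⇒upto (·-congˡ (all± (+ 1) n) φ⁻-Θ) ⟩
    Θ σ sq · all± (+ 1) n                ≈⟨ ·-congˡ-upto (all± (+ 1) n) (upto-sym (Θ-partial-upto σ sq-proper n)) ⟩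
    Θ-partial σ sq n · all± (+ 1) n      ≈⟨ ≈⇒upto (finite n) ⟩
    shanks n                             ≈⟨ mkUpto (λ k → shanks-low n) ⟩
    asc 0 n                              ≈⟨ ≈⇒upto (asc-all n) ⟩
    all± (- + 1) n                       ∎
    where open SetoidReasoning (uptoSetoid n)

module Euler where
  open Shanks (+ 0)

  rising-X^ : ∀ n → rising n ≈ X^ (tri n)
  rising-X^ zero    = ≈-refl
  rising-X^ (suc n) = ≈-trans (·-congˡ (const (+ 0) ⊕ X^ n) (rising-X^ n)) (≈-trans
    (solve 2 (λ a b → a :* (con (+ 0) :+ b) := b :* a) ≈-refl (X^ (tri n)) (X^ n)) (≈-sym (X^-+ n (tri n))))

  finite : ∀ n → Θ-partial σ pent n ≈ shanks n
  finite zero    = ≈-trans (Θ-partial-0 σ pent)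
    (solve 0 (con (+ 1) :* con (+ 1) := con (+ 1) :* con (+ 1) :* con (+ 1) :* con (+ 1)) ≈-refl)
  finite (suc n) = begin
    Θ-partial σ pent N
      ≈⟨ Θ-partial-suc σ pent n ⟩
    P ⊕ (const (sgn N) · X^ (N * N + tri N) ⊕ const (sgn N) · X^ (N * N + tri N + N))
      ≈⟨ ⊕-congʳ P (⊕-cong (·-cong (≈-sym (sgn-const-suc n)) (X^-+ (N * N) (tri N)))
           (·-cong (≈-sym (sgn-const-suc n)) (≈-trans (X^-+ (N * N + tri N) N) (·-congˡ Y (X^-+ (N * N) (tri N)))))) ⟩
    P ⊕ (⊖ s · (Q · R) ⊕ ⊖ s · (Q · R · Y))
      ≈⟨ solve 5 (λ p s q r y → p :+ ((:- s) :* (q :* r) :+ (:- s) :* (q :* r :* y))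
           := (con (+ 1) :+ con (+ 0) :* y) :* p :+ (:- (s :* q :* r :* (con (+ 1) :+ y)))) ≈-refl P s Q R Y ⟩
    (const (+ 1) ⊕ const (+ 0) · Y) · P ⊕ ⊖ (s · Q · R · (const (+ 1) ⊕ Y))
      ≈⟨ ⊕-cong (·-congʳ (const (+ 1) ⊕ const (+ 0) · Y) (finite n))
           (⊖-cong (·-congˡ (const (+ 1) ⊕ Y) (·-congʳ (s · Q) (≈-sym (rising-X^ N))))) ⟩
    (const (+ 1) ⊕ const (+ 0) · Y) · shanks n ⊕ ⊖ (s · Q · rising N · (const (+ 1) ⊕ Y))
      ≈⟨ ⊕-move (shanks-suc n) ⟨
    shanks N ∎
    where
    open ≈-Reasoning
    N = suc n
    P = Θ-partial σ pent n
    R = X^ (tri N)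
    s = const (sgn n)
    Q = X^ (N * N)
    Y = X^ N

  E-product : ∀ n → E ≈ all± (- + 1) n [upto n ]
  E-product n = begin
    E                    ≈⟨ upto-sym (Θ-partial-upto σ pent-proper n) ⟩
    Θ-partial σ pent n   ≈⟨ ≈⇒upto (finite n) ⟩
    shanks n             ≈⟨ mkUpto (λ k → shanks-low n) ⟩
    asc 0 n              ≈⟨ ≈⇒upto (asc-all n) ⟩
    all± (- + 1) n       ∎
    where open SetoidReasoning (uptoSetoid n)

-- One of the two products ∏ (1 - q^j) is replaced by φ(-q) ∏ (1 + q^j); what remains collapses by
-- (1 + q^j)(1 - q^j) = 1 - q^{2j}.
E² : E · E ≈ φ⁻ · dil 2 E
E² = upto-all λ n → let open SetoidReasoning (uptoSetoid n) in begin
  E · E                                                ≈⟨ ·-cong-upto (Euler.E-product n) (Euler.E-product n) ⟩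
  all± (- + 1) n · all± (- + 1) n                      ≈⟨ ·-congˡ-upto (all± (- + 1) n) (upto-sym (Gauss.φ⁻-product n)) ⟩
  φ⁻ · all± (+ 1) n · all± (- + 1) n                   ≈⟨ ≈⇒upto (·-assoc φ⁻ (all± (+ 1) n) (all± (- + 1) n)) ⟩
  φ⁻ · (all± (+ 1) n · all± (- + 1) n)                 ≈⟨ ≈⇒upto (·-congʳ φ⁻ (prod-· difference-of-squares n)) ⟩
  φ⁻ · prod (λ j → one± (- + 1) (suc j * 2)) n       ≈⟨ ≈⇒upto (·-congʳ φ⁻ (prod-dil 2 (λ j → one±-dil 2 (- + 1) (suc j)) n)) ⟨
  φ⁻ · dil 2 (all± (- + 1) n)                          ≈⟨ ·-congʳ-upto φ⁻
                                                            (dil-upto 2 (s≤s (ℕₚ.≤-trans (ℕₚ.m≤m*n n 2) (ℕₚ.n≤1+n _))) (Euler.E-product n)) ⟨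
  φ⁻ · dil 2 E                                         ∎
  where
  difference-of-squares : ∀ j → one± (+ 1) (suc j) · one± (- + 1) (suc j) ≈ one± (- + 1) (suc j * 2)
  difference-of-squares j = ≈-trans
    (solve 1 (λ x → (con (+ 1) :+ con (+ 1) :* x) :* (con (+ 1) :+ con (- + 1) :* x) := con (+ 1) :+ con (- + 1) :* (x :* x)) ≈-refl (X^ (suc j)))
    (⊕-congʳ (const (+ 1)) (·-congʳ (const (- + 1)) (≈-trans (≈-sym (X^-+ (suc j) (suc j))) (X^-cong (lem j)))))
    where lem : ∀ j → suc j + suc j ≡ suc j * 2
          lem = ℕ-ring

-- ∏ (1 + q^d) / (1 - q^d) over odd d is φ(-q²) / φ(-q).
odd-quotient : ∀ n → dil 2 φ⁻ · odd± (- + 1) n ≈ φ⁻ · odd± (+ 1) n [upto n + n ]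
odd-quotient n = upto-cancel D D0 (begin
  -- Up to q^{2n}, both sides times `D` are ∏ (1 - q^j) over j ≤ 2n: on the left φ(-q²) · `D`
  -- supplies the even j, on the right `D` completes the odd factors to all of ∏ (1 + q^j).
  dil 2 φ⁻ · H · D                          ≈⟨ ≈⇒upto (solve 3 (λ a b c → a :* b :* c := b :* (a :* c)) ≈-refl (dil 2 φ⁻) H D) ⟩
  H · (dil 2 φ⁻ · dil 2 (all± (+ 1) n))     ≈⟨ ≈⇒upto (·-congʳ H (dil-· 2 φ⁻ (all± (+ 1) n))) ⟨
  H · dil 2 (φ⁻ · all± (+ 1) n)             ≈⟨ ·-congʳ-upto H (dil-upto 2 lt (Gauss.φ⁻-product n)) ⟩
  H · dil 2 (all± (- + 1) n)                ≈⟨ ≈⇒upto (all±-split (- + 1) n) ⟨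
  all± (- + 1) (n + n)                    ≈⟨ Gauss.φ⁻-product (n + n) ⟨
  φ⁻ · all± (+ 1) (n + n)                 ≈⟨ ≈⇒upto (·-congʳ φ⁻ (all±-split (+ 1) n)) ⟩
  φ⁻ · (odd± (+ 1) n · D)                   ≈⟨ ≈⇒upto (·-assoc φ⁻ (odd± (+ 1) n) D) ⟨
  φ⁻ · odd± (+ 1) n · D                     ∎)
  where
  open SetoidReasoning (uptoSetoid (n + n))
  H = odd± (- + 1) n
  D = dil 2 (all± (+ 1) n)
  D0 : D 0 ≡ + 1
  D0 = prod-0 (one±-0 (+ 1)) n
  lt : n + n < suc n * 2
  lt = subst (n + n ℕ.<_) (lem n) (ℕₚ.m≤n⇒m≤1+n ℕₚ.≤-refl)
    where lem : ∀ n → suc (suc (n + n)) ≡ suc n * 2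
          lem = ℕ-ring

-- The factors of the defining product, and S as a theta quotient.

alternating : Series
alternating j = if j DM.% 2 ≡ᵇ 0 then + 1 else - (+ 1)

alternating-suc : ∀ j → alternating (suc j) ≡ - alternating j
alternating-suc zero          = refl
alternating-suc (suc zero)    = refl
alternating-suc (suc (suc j)) = trans (period (suc j)) (trans (alternating-suc j) (cong -_ (sym (period j))))
  where
  period : ∀ j → alternating (suc (suc j)) ≡ alternating j
  period j = cong (λ r → if r ≡ᵇ 0 then + 1 else - (+ 1)) (trans (cong (DM._% 2) (ℕₚ.+-comm 2 j)) (DM.[m+n]%n≡m%n j 2))

geometric : ∀ c {f} → f 0 ≡ + 1 → (∀ j → f (suc j) ℤ.+ c ℤ.* f j ≡ + 0) → one± c 1 · f ≈ const (+ 1)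
geometric c {f} f0 step = ≈-trans
  (solve 3 (λ c x f → (con (+ 1) :+ c :* (x :* con (+ 1))) :* f := f :+ c :* (x :* f)) ≈-refl (const c) X f)
  (mk λ { zero → trans (cong₂ (λ a b → a ℤ.+ b) f0 (const-· c (X · f) 0)) (cong (λ z → + 1 ℤ.+ z) (ℤₚ.*-zeroʳ c))
        ; (suc j) → trans (cong (λ z → f (suc j) ℤ.+ z) (trans (const-· c (X · f) (suc j)) (cong (c ℤ.*_) (X·-suc f j)))) (step j) })

dil-inverse : ∀ d .{{_ : NonZero d}} c f → one± c 1 · f ≈ const (+ 1) → one± c d · dil d f ≈ const (+ 1)
dil-inverse d c f p = ≈-trans (·-congˡ (dil d f) (≈-sym (≈-trans (one±-dil d c 1) (mk λ k → cong (λ m → one± c m k) (ℕₚ.*-identityˡ d)))))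
  (≈-trans (≈-sym (dil-· d (one± c 1) f)) (≈-trans (dil-cong d p) (dil-const d (+ 1))))

invOneMinus-inverse : ∀ k → one± (- + 1) (suc k) · invOneMinus k ≈ const (+ 1)
invOneMinus-inverse k = dil-inverse (suc k) (- + 1) (λ _ → + 1) (geometric (- + 1) {λ _ → + 1} refl λ _ → refl)

invOnePlus-inverse : ∀ k → one± (+ 1) (suc k) · invOnePlus k ≈ const (+ 1)
invOnePlus-inverse k = dil-inverse (suc k) (+ 1) alternating
  (geometric (+ 1) {alternating} refl λ j → trans (cong₂ ℤ._+_ (alternating-suc j) (ℤₚ.*-identityˡ (alternating j))) (ℤₚ.+-inverseˡ (alternating j)))

binom-one± : ∀ c d → binom c (suc d) ≈ one± c (suc d)
binom-one± c d = mk λ { zero → sym (one±-0 c d) ; (suc n) → sym (trans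
    (trans (ℤₚ.+-identityˡ _) (trans (const-· c (X^ (suc d)) (suc n)) (cong (c ℤ.*_) (X·-suc (X^ d) n)))) (lem n)) }
  where
  lem : ∀ n → c ℤ.* X^ d n ≡ (if n ≡ᵇ d then c else + 0)
  lem n with n ℕₚ.≟ d
  ... | yes refl = trans (cong (c ℤ.*_) (X^-diag d)) (trans (ℤₚ.*-identityʳ c) (sym (cong (λ b → if b then c else + 0) (eq d))))
    where eq : ∀ d → (d ≡ᵇ d) ≡ true
          eq zero    = refl
          eq (suc d) = eq d
  ... | no  n≢d  = trans (cong (c ℤ.*_) (X^-off d n (λ e → n≢d (sym e)))) (trans (ℤₚ.*-zeroʳ c) (sym (cong (λ b → if b then c else + 0) (eq n d n≢d))))
    where eq : ∀ n d → n ≢ d → (n ≡ᵇ d) ≡ false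
          eq zero    zero    h = ⊥-elim (h refl)
          eq zero    (suc d) h = refl
          eq (suc n) zero    h = refl
          eq (suc n) (suc d) h = eq n d (λ e → h (cong suc e))

factor-relation : ∀ j → let d = suc (2 * j) in
  factor j · (one± (+ 1) (3 * d) · one± (- + 1) d) ≈ one± (+ 1) d · one± (- + 1) (3 * d)
factor-relation j = begin
  binom (+ 1) d · (binom (- + 1) (3 * d) · (P · M)) · (one± (+ 1) (3 * d) · one± (- + 1) d)
    ≈⟨ ·-congˡ (one± (+ 1) (3 * d) · one± (- + 1) d) (·-cong (binom-one± (+ 1) (2 * j))
         (·-congˡ (P · M) (binom-one± (- + 1) _))) ⟩
  one± (+ 1) d · (one± (- + 1) (3 * d) · (P · M)) · (one± (+ 1) (3 * d) · one± (- + 1) d)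
    ≈⟨ solve 6 (λ a b p m u v → a :* (b :* (p :* m)) :* (u :* v) := (a :* b) :* (u :* p) :* (v :* m)) ≈-refl
         (one± (+ 1) d) (one± (- + 1) (3 * d)) P M (one± (+ 1) (3 * d)) (one± (- + 1) d) ⟩
  one± (+ 1) d · one± (- + 1) (3 * d) · (one± (+ 1) (3 * d) · P) · (one± (- + 1) d · M)
    ≈⟨ ·-cong (·-congʳ (one± (+ 1) d · one± (- + 1) (3 * d)) (invOnePlus-inverse (3 * d ∸ 1))) (invOneMinus-inverse (d ∸ 1)) ⟩
  one± (+ 1) d · one± (- + 1) (3 * d) · const (+ 1) · const (+ 1)
    ≈⟨ solve 1 (λ a → a :* con (+ 1) :* con (+ 1) := a) ≈-refl (one± (+ 1) d · one± (- + 1) (3 * d)) ⟩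
  one± (+ 1) d · one± (- + 1) (3 * d) ∎
  where
  open ≈-Reasoning
  d = suc (2 * j)
  P = invOnePlus (3 * d ∸ 1)
  M = invOneMinus (d ∸ 1)

partialProd-1 : ∀ N → partialProd 1 N ≈ prod factor N
partialProd-1 zero    = one≈const1
partialProd-1 (suc N) = ≈-trans (·-cong {factor N · one} {factor N}
    (≈-trans (·-congʳ (factor N) one≈const1) (≈-trans (·-comm (factor N) (const (+ 1))) (·-identityˡ (factor N)))) (partialProd-1 N))
  (·-comm (factor N) (prod factor N))

factor-low : ∀ N → factor N ≈ const (+ 1) [upto N ]
factor-low N = begin
  factor N                        ≈⟨ ≈⇒upto (solve 1 (λ f → f := f :* (con (+ 1) :* con (+ 1))) ≈-refl (factor N)) ⟩
  factor N · (const (+ 1) · const (+ 1)) ≈⟨ ·-congʳ-upto (factor N) (·-cong-upto (one±-low (+ 1) (3 * d) N<3d) (one±-low (- + 1) d N<d)) ⟨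
  factor N · (one± (+ 1) (3 * d) · one± (- + 1) d) ≈⟨ ≈⇒upto (factor-relation N) ⟩
  one± (+ 1) d · one± (- + 1) (3 * d)  ≈⟨ ·-cong-upto (one±-low (+ 1) d N<d) (one±-low (- + 1) (3 * d) N<3d) ⟩
  const (+ 1) · const (+ 1)       ≈⟨ ≈⇒upto (·-identityˡ (const (+ 1))) ⟩
  const (+ 1)                     ∎
  where
  open SetoidReasoning (uptoSetoid N)
  d = suc (2 * N)
  N<d : N < d
  N<d = s≤s (ℕₚ.m≤m+n N (N + 0))
  N<3d : N < 3 * d
  N<3d = ℕₚ.<-≤-trans N<d (ℕₚ.m≤n*m d 3)

S : Series
S n = S3bar 1 n

-- The length of the defining product varies with the coefficient. As `factor N` involves d = 2N + 1
-- > N, it changes nothing up to q^N, so one product of length `N` serves all these coefficients.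
S-upto : ∀ N → S ≈ prod factor N [upto N ]
S-upto N = mkUpto λ k k≤N → trans (at (partialProd-1 k) k) (go N k k≤N)
  where
  go : ∀ N k → k ≤ N → prod factor k k ≡ prod factor N k
  go zero    zero    z≤n = refl
  go (suc N) k       k≤N with ℕₚ.m≤n⇒m<n∨m≡n k≤N
  ... | inj₂ refl      = refl
  ... | inj₁ (s≤s k≤N′) = trans (go N k k≤N′) (sym (atUpto
    (upto-trans (·-congʳ-upto (prod factor N) (factor-low N))
      (≈⇒upto (≈-trans (·-comm (prod factor N) (const (+ 1))) (·-identityˡ (prod factor N))))) k k≤N′))

-- S is the quotient of `odd-quotient` at q by `odd-quotient` at q³, here cleared of denominators.
S-φ⁻ : S · (φ⁻ · dil 6 φ⁻) ≈ dil 2 φ⁻ · dil 3 φ⁻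
S-φ⁻ = upto-all λ N → let
    G = odd± (+ 1) N
    H = odd± (- + 1) N
    G₃ = dil 3 G
    H₃ = dil 3 H
    φ₂ = dil 2 φ⁻
    φ₃ = dil 3 φ⁻
    φ₆ = dil 6 φ⁻
    base : φ₂ · H ≈ φ⁻ · G [upto N ]
    base = upto-≤ (ℕₚ.m≤m+n N N) (odd-quotient N)
    tripled : φ₆ · H₃ ≈ φ₃ · G₃ [upto N ]
    tripled = upto-trans (≈⇒upto (≈-trans (·-congˡ H₃ (≈-sym (dil-dil 3 2 φ⁻))) (≈-sym (dil-· 3 φ₂ H))))
      (upto-trans (dil-upto 3 (s≤s (ℕₚ.≤-trans (ℕₚ.m≤m*n N 3) (ℕₚ.m≤n+m (N * 3) 2))) base) (≈⇒upto (dil-· 3 φ⁻ G)))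
    finite : S · (G₃ · H) ≈ G · H₃ [upto N ]
    finite = upto-trans (·-congˡ-upto (G₃ · H) (S-upto N)) (≈⇒upto (≈-trans
      (·-congʳ (prod factor N) (·-congˡ H (prod-dil 3 {λ j → one± (+ 1) (suc (j + j))} triple N)))
      (≈-trans (≈-trans (·-congʳ (prod factor N) (prod-· {λ j → one± (+ 1) (3 * suc (2 * j))} {λ j → one± (- + 1) (suc (j + j))} (λ j → ≈-refl) N))
        (≈-trans (prod-· {factor} relation N)
          (≈-sym (prod-· {λ j → one± (+ 1) (suc (j + j))} {λ j → one± (- + 1) (3 * suc (2 * j))} (λ j → ≈-refl) N))))
        (·-congʳ G (≈-sym (prod-dil 3 {λ j → one± (- + 1) (suc (j + j))} triple⁻ N))))))
    open SetoidReasoning (uptoSetoid N)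
  in upto-cancel (G₃ · H) (cong₂ ℤ._*_ (prod-0 (λ j → one±-0 (+ 1) (j + j)) N) (prod-0 (λ j → one±-0 (- + 1) (j + j)) N)) (begin
    S · (φ⁻ · φ₆) · (G₃ · H)
      ≈⟨ ≈⇒upto (solve 4 (λ s a b g → s :* (a :* b) :* g := s :* g :* (a :* b)) ≈-refl S φ⁻ φ₆ (G₃ · H)) ⟩
    S · (G₃ · H) · (φ⁻ · φ₆)
      ≈⟨ ·-congˡ-upto (φ⁻ · φ₆) finite ⟩
    G · H₃ · (φ⁻ · φ₆)
      ≈⟨ ≈⇒upto (solve 4 (λ g h a b → g :* h :* (a :* b) := a :* g :* (b :* h)) ≈-refl G H₃ φ⁻ φ₆) ⟩
    φ⁻ · G · (φ₆ · H₃)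
      ≈⟨ ·-cong-upto (upto-sym base) tripled ⟩
    φ₂ · H · (φ₃ · G₃)
      ≈⟨ ≈⇒upto (solve 4 (λ a h b g → a :* h :* (b :* g) := a :* b :* (g :* h)) ≈-refl φ₂ H φ₃ G₃) ⟩
    φ₂ · φ₃ · (G₃ · H) ∎)
  where
  idx : ∀ j → suc (j + j) ≡ suc (2 * j)
  idx = ℕ-ring
  idx₃ : ∀ j → suc (j + j) * 3 ≡ 3 * suc (2 * j)
  idx₃ = ℕ-ring
  one±-cong : ∀ c {m n} → m ≡ n → one± c m ≈ one± c n
  one±-cong c refl = ≈-refl
  triple : ∀ j → dil 3 (one± (+ 1) (suc (j + j))) ≈ one± (+ 1) (3 * suc (2 * j))
  triple j = ≈-trans (one±-dil 3 (+ 1) (suc (j + j))) (one±-cong (+ 1) (idx₃ j))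
  triple⁻ : ∀ j → dil 3 (one± (- + 1) (suc (j + j))) ≈ one± (- + 1) (3 * suc (2 * j))
  triple⁻ j = ≈-trans (one±-dil 3 (- + 1) (suc (j + j))) (one±-cong (- + 1) (idx₃ j))
  relation : ∀ j → factor j · (one± (+ 1) (3 * suc (2 * j)) · one± (- + 1) (suc (j + j)))
    ≈ one± (+ 1) (suc (j + j)) · one± (- + 1) (3 * suc (2 * j))
  relation j = ≈-trans (·-congʳ (factor j) (·-congʳ (one± (+ 1) (3 * suc (2 * j))) (one±-cong (- + 1) (idx j))))
    (≈-trans (factor-relation j) (·-congˡ (one± (- + 1) (3 * suc (2 * j))) (one±-cong (+ 1) (sym (idx j)))))

-- Dissection of S

U-X : ∀ d .{{_ : NonZero d}} → U d 1 X ≈ const (+ 1)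
U-X d = mk λ { zero → refl ; (suc n) → lem n }
  where lem : ∀ n → X (suc (suc n * d)) ≡ + 0
        lem n with suc n * d | ℕₚ.m*n≢0 (suc n) d
        ... | suc _ | _ = refl

U-X·dil : ∀ d .{{_ : NonZero d}} f → 1 < d → U d 1 (X · dil d f) ≈ f
U-X·dil d f 1<d = ≈-trans (U-cong d 1 (·-comm X (dil d f))) (≈-trans (U-dil· d f X 1<d)
  (≈-trans (·-congʳ f (U-X d)) (≈-trans (·-comm f (const (+ 1))) (·-identityˡ f))))

U₁-dissected : ∀ d .{{_ : NonZero d}} → 1 < d → ∀ {f} a b → f ≈ dil d a ⊕ X · dil d b → U d 1 f ≈ b
U₁-dissected d 1<d a b p = ≈-trans (U-cong d 1 p)
  (≈-trans (⊕-cong (Uᵣ-dil d a 1<d (λ ())) (U-X·dil d b 1<d)) (solve 1 (λ b → con (+ 0) :+ b := b) ≈-refl b))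

U₀-dissected : ∀ {f} a b → f ≈ dil 2 a ⊕ X · dil 2 b → U 2 0 f ≈ a
U₀-dissected a b p = ≈-trans (U-cong 2 0 p) (≈-trans (⊕-cong (U₀-dil 2 a) odd)
    (solve 1 (λ a → a :+ con (+ 0) := a) ≈-refl a))
  where
  odd : U 2 0 (X · dil 2 b) ≈ const (+ 0)
  odd = ≈-trans (U-cong 2 0 (·-comm X (dil 2 b))) (≈-trans (U-dil· 2 b X (s≤s z≤n))
    (≈-trans (·-congʳ b {U 2 0 X} {const (+ 0)} (mk λ { zero → refl ; (suc n) → refl })) (·-zeroʳ b)))

U₁-dissected₃ : ∀ {f} a b c → f ≈ dil 3 a ⊕ X · dil 3 b ⊕ X · X · dil 3 c → U 3 1 f ≈ b
U₁-dissected₃ a b c p = ≈-trans (U-cong 3 1 p) (≈-trans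
  (⊕-cong (U₁-dissected 3 (s≤s (s≤s z≤n)) a b ≈-refl) last)
    (solve 1 (λ a → a :+ con (+ 0) := a) ≈-refl b))
  where
  X²-off : ∀ n → X^ 2 (1 + n * 3) ≡ const (+ 0) n
  X²-off n = trans (X^-off 2 (1 + n * 3) (lem n)) (sym (const-zero n))
    where lem : ∀ n → 2 ≢ suc (n * 3)
          lem zero    ()
          lem (suc n) ()
  last : U 3 1 (X · X · dil 3 c) ≈ const (+ 0)
  last = ≈-trans (U-cong 3 1 (solve 2 (λ x c → x :* x :* c := c :* (x :* (x :* con (+ 1)))) ≈-refl X (dil 3 c)))
    (≈-trans (U-dil· 3 c (X^ 2) (s≤s (s≤s z≤n))) (≈-trans (·-congʳ c (mk X²-off)) (·-zeroʳ c)))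

-- The constant terms rule out f = -g: f + g starts with 2 and cancels from (f - g)(f + g) = 0.
square-injective : ∀ {f g} → f 0 ≡ + 1 → g 0 ≡ + 1 → f · f ≈ g · g → f ≈ g
square-injective {f} {g} f0 g0 p = mk λ n → ℤₚ.i-j≡0⇒i≡j _ _ (·-zero-cancel {f ⊕ ⊖ g} (f ⊕ g)
  (λ z → 2≢0 (trans (sym (cong₂ ℤ._+_ f0 g0)) z))
  (λ n → trans (at (solve 2 (λ f g → (f :+ (:- g)) :* (f :+ g) := f :* f :+ (:- (g :* g))) ≈-refl f g) n)
    (trans (cong (ℤ._- (g · g) n) (at p n)) (ℤₚ.+-inverseʳ ((g · g) n)))) n)
  where 2≢0 : + 2 ≢ + 0
        2≢0 ()

sgn-even : ∀ d n → sgn (n * (d * 2)) ≡ + 1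
sgn-even d n = trans (cong sgn (sym (ℕₚ.*-assoc n d 2))) (sgn-*2 (n * d))

neg-dil₂ : ∀ f → neg (dil 2 f) ≈ dil 2 f
neg-dil₂ f = neg-dil-even 2 f (sgn-even 1)

neg-dil₃ : ∀ f → neg (dil 3 f) ≈ dil 3 (neg f)
neg-dil₃ f = neg-dil-odd 3 f (λ n → sgn-*-odd n 1)

φ-two-parts : φ ≈ dil 2 (dil 2 φ) ⊕ X · dil 2 (const (+ 2) · dil 4 ψ)
φ-two-parts = ≈-trans φ-dissect₂ (⊕-cong (≈-sym (dil-dil 2 2 φ)) (≈-trans
  (solve 3 (λ c x p → c :* x :* p := x :* (c :* p)) ≈-refl (const (+ 2)) X (dil 8 ψ))
  (·-congʳ X (≈-sym (≈-trans (dil-· 2 (const (+ 2)) (dil 4 ψ)) (·-cong (dil-const 2 (+ 2)) (dil-dil 2 4 ψ)))))))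

φ⁻-two-parts : φ⁻ ≈ dil 2 (dil 2 φ) ⊕ X · dil 2 (const (- + 2) · dil 4 ψ)
φ⁻-two-parts = begin
  neg φ
    ≈⟨ neg-cong φ-two-parts ⟩
  neg (dil 2 (dil 2 φ) ⊕ X · dil 2 (const (+ 2) · dil 4 ψ))
    ≈⟨ ≈-trans (neg-⊕ (dil 2 (dil 2 φ)) (X · dil 2 (const (+ 2) · dil 4 ψ))) (⊕-cong (neg-dil₂ (dil 2 φ))
         (≈-trans (neg-· X (dil 2 (const (+ 2) · dil 4 ψ))) (·-cong neg-X (neg-dil₂ (const (+ 2) · dil 4 ψ))))) ⟩
  dil 2 (dil 2 φ) ⊕ ⊖ X · dil 2 (const (+ 2) · dil 4 ψ)
    ≈⟨ ⊕-congʳ (dil 2 (dil 2 φ)) (≈-trans (solve 2 (λ x a → (:- x) :* a := x :* (:- a)) ≈-refl X (dil 2 (const (+ 2) · dil 4 ψ)))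
         (·-congʳ X (≈-trans (≈-sym (dil-⊖ 2 (const (+ 2) · dil 4 ψ)))
           (dil-cong 2 (solve 1 (λ p → :- (con (+ 2) :* p) := con (- + 2) :* p) ≈-refl (dil 4 ψ)))))) ⟩
  dil 2 (dil 2 φ) ⊕ X · dil 2 (const (- + 2) · dil 4 ψ) ∎
  where open ≈-Reasoning

-- Trades φ(-q) in the cofactor of S for φ(-q²), using φ(q)φ(-q) = φ(-q²)². The cofactor is then a
-- series in q², and the odd part can be taken on the right alone.
S-φφ₃ : S · (dil 2 φ⁻ · dil 6 φ⁻) ≈ φ · dil 3 φ⁻
S-φφ₃ = ·-cancel (dil 2 φ⁻) (λ ()) (begin
  S · (dil 2 φ⁻ · dil 6 φ⁻) · dil 2 φ⁻
    ≈⟨ solve 3 (λ s a b → s :* (a :* b) :* a := s :* b :* (a :* a)) ≈-refl S (dil 2 φ⁻) (dil 6 φ⁻) ⟩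
  S · dil 6 φ⁻ · (dil 2 φ⁻ · dil 2 φ⁻)
    ≈⟨ ·-congʳ (S · dil 6 φ⁻) (≈-trans (≈-sym (dil-· 2 φ⁻ φ⁻)) (≈-sym φφ⁻)) ⟩
  S · dil 6 φ⁻ · (φ · φ⁻)
    ≈⟨ solve 4 (λ s b p m → s :* b :* (p :* m) := s :* (m :* b) :* p) ≈-refl S (dil 6 φ⁻) φ φ⁻ ⟩
  S · (φ⁻ · dil 6 φ⁻) · φ
    ≈⟨ ·-congˡ φ S-φ⁻ ⟩
  dil 2 φ⁻ · dil 3 φ⁻ · φ
    ≈⟨ solve 3 (λ a b p → a :* b :* p := p :* b :* a) ≈-refl (dil 2 φ⁻) (dil 3 φ⁻) φ ⟩
  φ · dil 3 φ⁻ · dil 2 φ⁻ ∎)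
  where open ≈-Reasoning

D : Series
D = φ⁻ · dil 3 φ⁻

dil₂-D : dil 2 D ≈ dil 2 φ⁻ · dil 6 φ⁻
dil₂-D = ≈-trans (dil-· 2 φ⁻ (dil 3 φ⁻)) (·-congʳ (dil 2 φ⁻) (dil-dil 2 3 φ⁻))

U-times-dil : ∀ d .{{_ : NonZero d}} r f g → r < d → U d r (f · dil d g) ≈ U d r f · g
U-times-dil d r f g r<d = ≈-trans (U-cong d r (·-comm f (dil d g))) (≈-trans (U-dil· d g f r<d) (·-comm g (U d r f)))

S₁ S₃ S₇ ψ⁻ : Series
S₁ = U 2 1 S
S₃ = U 2 1 S₁
S₇ = U 3 1 S₃
ψ⁻ = neg ψ

neg-ψψ₃ : ψ⁻ · dil 3 ψ⁻ ≈ dil 4 ψ · dil 6 φ ⊕ ⊖ (X · (dil 2 φ · dil 12 ψ))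
neg-ψψ₃ = begin
  ψ⁻ · dil 3 ψ⁻
    ≈⟨ ≈-sym (≈-trans (neg-· ψ (dil 3 ψ)) (·-congʳ ψ⁻ (neg-dil₃ ψ))) ⟩
  neg (ψ · dil 3 ψ)
    ≈⟨ neg-cong ψψ₃ ⟩
  neg (dil 4 ψ · dil 6 φ ⊕ X · (dil 2 φ · dil 12 ψ))
    ≈⟨ ≈-trans (neg-⊕ (dil 4 ψ · dil 6 φ) (X · (dil 2 φ · dil 12 ψ)))
         (⊕-cong (≈-trans (neg-· (dil 4 ψ) (dil 6 φ)) (·-cong (neg-dil-even 4 ψ (sgn-even 2)) (neg-dil-even 6 φ (sgn-even 3))))
           (≈-trans (neg-· X (dil 2 φ · dil 12 ψ)) (·-cong neg-X
             (≈-trans (neg-· (dil 2 φ) (dil 12 ψ)) (·-cong (neg-dil₂ φ) (neg-dil-even 12 ψ (sgn-even 6))))))) ⟩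
  dil 4 ψ · dil 6 φ ⊕ ⊖ X · (dil 2 φ · dil 12 ψ)
    ≈⟨ solve 3 (λ a x b → a :+ (:- x) :* b := a :+ (:- (x :* b))) ≈-refl (dil 4 ψ · dil 6 φ) X (dil 2 φ · dil 12 ψ) ⟩
  dil 4 ψ · dil 6 φ ⊕ ⊖ (X · (dil 2 φ · dil 12 ψ)) ∎
  where open ≈-Reasoning

dil-X : ∀ d .{{_ : NonZero d}} → dil d X ≈ X^ d
dil-X d = ≈-trans (dil-cong d (solve 1 (λ x → x := x :* con (+ 1)) ≈-refl X))
  (≈-trans (dil-X^ d 1) (X^-cong (ℕₚ.*-identityˡ d)))

-- Up to the factor 2, the odd section of φ(q)φ(-q³) is the right side of `ψψ₃` with its second term
-- negated, and that sign is the effect of q ↦ -q.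
S₁-ψ⁻ψ₃⁻ : S₁ · D ≈ const (+ 2) · (ψ⁻ · dil 3 ψ⁻)
S₁-ψ⁻ψ₃⁻ = begin
  S₁ · D               ≈⟨ U-times-dil 2 1 S D (s≤s (s≤s z≤n)) ⟨
  U 2 1 (S · dil 2 D)  ≈⟨ U-cong 2 1 (≈-trans (·-congʳ S dil₂-D) S-φφ₃) ⟩
  U 2 1 (φ · dil 3 φ⁻) ≈⟨ U₁-dissected 2 (s≤s (s≤s z≤n)) even odd dissection ⟩
  odd                  ≈⟨ solve 5 (λ a b x c d → con (+ 2) :* a :* b :+ x :* c :* (con (- + 2) :* d) := con (+ 2) :* (a :* b :+ (:- (x :* (c :* d))))) ≈-refl
                            (dil 4 ψ) (dil 6 φ) X (dil 2 φ) (dil 12 ψ) ⟩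
  const (+ 2) · (dil 4 ψ · dil 6 φ ⊕ ⊖ (X · (dil 2 φ · dil 12 ψ))) ≈⟨ ·-congʳ (const (+ 2)) neg-ψψ₃ ⟨
  const (+ 2) · (ψ⁻ · dil 3 ψ⁻) ∎
  where
  open ≈-Reasoning
  a = dil 2 φ
  b = const (+ 2) · dil 4 ψ
  a₃ = dil 6 φ
  b₃ = const (- + 2) · dil 12 ψ
  even odd : Series
  even = a · a₃ ⊕ X · X · b · b₃
  odd  = b · a₃ ⊕ X · a · b₃
  φ₃-parts : dil 3 φ⁻ ≈ dil 2 a₃ ⊕ X · dil 2 (X · b₃)
  φ₃-parts = begin
    dil 3 φ⁻
      ≈⟨ dil-cong 3 φ⁻-two-parts ⟩
    dil 3 (dil 2 (dil 2 φ) ⊕ X · dil 2 (const (- + 2) · dil 4 ψ))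
      ≈⟨ ≈-trans (dil-⊕ 3 (dil 2 (dil 2 φ)) (X · dil 2 (const (- + 2) · dil 4 ψ)))
           (⊕-congʳ (dil 3 (dil 2 (dil 2 φ))) (dil-· 3 X (dil 2 (const (- + 2) · dil 4 ψ)))) ⟩
    dil 3 (dil 2 (dil 2 φ)) ⊕ dil 3 X · dil 3 (dil 2 (const (- + 2) · dil 4 ψ))
      ≈⟨ ⊕-cong (≈-trans (dil-dil 3 2 (dil 2 φ)) (≈-trans (≈-sym (dil-dil 2 3 (dil 2 φ))) (dil-cong 2 (dil-dil 3 2 φ))))
           (·-cong (dil-X 3) (≈-trans (dil-dil 3 2 (const (- + 2) · dil 4 ψ)) (≈-trans (≈-sym (dil-dil 2 3 (const (- + 2) · dil 4 ψ)))
             (dil-cong 2 (≈-trans (dil-· 3 (const (- + 2)) (dil 4 ψ)) (·-cong (dil-const 3 (- + 2)) (dil-dil 3 4 ψ))))))) ⟩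
    dil 2 a₃ ⊕ X^ 3 · dil 2 b₃
      ≈⟨ ⊕-congʳ (dil 2 a₃) (≈-trans (·-assoc X (X^ 2) (dil 2 b₃))
           (·-congʳ X (≈-sym (≈-trans (dil-· 2 X b₃) (·-congˡ (dil 2 b₃) (dil-X 2)))))) ⟩
    dil 2 a₃ ⊕ X · dil 2 (X · b₃) ∎
  dissection : φ · dil 3 φ⁻ ≈ dil 2 even ⊕ X · dil 2 odd
  dissection = begin
    φ · dil 3 φ⁻
      ≈⟨ ·-cong φ-two-parts φ₃-parts ⟩
    (dil 2 a ⊕ X · dil 2 b) · (dil 2 a₃ ⊕ X · dil 2 (X · b₃))
      ≈⟨ ·-congʳ (dil 2 a ⊕ X · dil 2 b) (⊕-congʳ (dil 2 a₃) (·-congʳ X (dil-· 2 X b₃))) ⟩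
    (dil 2 a ⊕ X · dil 2 b) · (dil 2 a₃ ⊕ X · (dil 2 X · dil 2 b₃))
      ≈⟨ ·-congʳ (dil 2 a ⊕ X · dil 2 b) (⊕-congʳ (dil 2 a₃) (·-congʳ X (·-congˡ (dil 2 b₃) X₂))) ⟩
    (dil 2 a ⊕ X · dil 2 b) · (dil 2 a₃ ⊕ X · ((X · X) · dil 2 b₃))
      ≈⟨ solve 5 (λ a b c d x → (a :+ x :* b) :* (c :+ x :* ((x :* x) :* d))
           := (a :* c :+ (x :* x) :* (x :* x) :* b :* d) :+ x :* (b :* c :+ (x :* x) :* a :* d)) ≈-refl (dil 2 a) (dil 2 b) (dil 2 a₃) (dil 2 b₃) X ⟩
    (dil 2 a · dil 2 a₃ ⊕ (X · X) · (X · X) · dil 2 b · dil 2 b₃) ⊕ X · (dil 2 b · dil 2 a₃ ⊕ (X · X) · dil 2 a · dil 2 b₃)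
      ≈⟨ ⊕-cong (≈-sym (≈-trans (dil-⊕ 2 (a · a₃) (X · X · b · b₃)) (⊕-cong (dil-· 2 a a₃)
           (≈-trans (dil-· 2 (X · X · b) b₃) (·-congˡ (dil 2 b₃) (≈-trans (dil-· 2 (X · X) b) (·-congˡ (dil 2 b)
             (≈-trans (dil-· 2 X X) (·-cong X₂ X₂)))))))))
         (·-congʳ X (≈-sym (≈-trans (dil-⊕ 2 (b · a₃) (X · a · b₃)) (⊕-cong (dil-· 2 b a₃)
           (≈-trans (dil-· 2 (X · a) b₃) (·-congˡ (dil 2 b₃) (≈-trans (dil-· 2 X a) (·-congˡ (dil 2 a) X₂)))))))) ⟩
    dil 2 even ⊕ X · dil 2 odd ∎
    where
    X₂ : dil 2 X ≈ X · X
    X₂ = ≈-trans (dil-X 2) (solve 1 (λ x → x :* (x :* con (+ 1)) := x :* x) ≈-refl X)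

ψ⁻² : ψ⁻ · ψ⁻ ≈ dil 2 ψ · φ⁻
ψ⁻² = ≈-trans (≈-sym (neg-· ψ ψ)) (≈-trans (neg-cong ψ²) (≈-trans (neg-· (dil 2 ψ) φ) (·-congˡ φ⁻ (neg-dil₂ ψ))))

-- The squares agree: both equal ψ(q²)φ(q)φ(-q)², by `ψ²`, `ψ⁻²` and `φφ⁻`. This is the exchange
-- that turns the cofactor of `S₁` into a series in q².
ψ⁻φ⁻₂ : ψ⁻ · dil 2 φ⁻ ≈ ψ · φ⁻
ψ⁻φ⁻₂ = square-injective refl refl (begin
  ψ⁻ · dil 2 φ⁻ · (ψ⁻ · dil 2 φ⁻)
    ≈⟨ solve 2 (λ a b → a :* b :* (a :* b) := (a :* a) :* (b :* b)) ≈-refl ψ⁻ (dil 2 φ⁻) ⟩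
  ψ⁻ · ψ⁻ · (dil 2 φ⁻ · dil 2 φ⁻)
    ≈⟨ ·-cong ψ⁻² (≈-trans (≈-sym (dil-· 2 φ⁻ φ⁻)) (≈-sym φφ⁻)) ⟩
  dil 2 ψ · φ⁻ · (φ · φ⁻)
    ≈⟨ solve 3 (λ p m f → p :* m :* (f :* m) := p :* f :* (m :* m)) ≈-refl (dil 2 ψ) φ⁻ φ ⟩
  dil 2 ψ · φ · (φ⁻ · φ⁻)
    ≈⟨ ·-congˡ (φ⁻ · φ⁻) ψ² ⟨
  ψ · ψ · (φ⁻ · φ⁻)
    ≈⟨ solve 2 (λ a b → (a :* a) :* (b :* b) := a :* b :* (a :* b)) ≈-refl ψ φ⁻ ⟩
  ψ · φ⁻ · (ψ · φ⁻) ∎)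
  where open ≈-Reasoning

S₁-ψψ₃ : S₁ · dil 2 D ≈ const (+ 2) · (ψ · dil 3 ψ)
S₁-ψψ₃ = ·-cancel D (λ ()) (begin
  S₁ · dil 2 D · D
    ≈⟨ ≈-trans (·-congˡ D (·-congʳ S₁ dil₂-D)) (solve 3 (λ s a b → s :* a :* b := s :* b :* a) ≈-refl S₁ (dil 2 φ⁻ · dil 6 φ⁻) D) ⟩
  S₁ · D · (dil 2 φ⁻ · dil 6 φ⁻)
    ≈⟨ ·-congˡ (dil 2 φ⁻ · dil 6 φ⁻) S₁-ψ⁻ψ₃⁻ ⟩
  const (+ 2) · (ψ⁻ · dil 3 ψ⁻) · (dil 2 φ⁻ · dil 6 φ⁻)
    ≈⟨ solve 4 (λ a b c d → con (+ 2) :* (a :* b) :* (c :* d) := con (+ 2) :* ((a :* c) :* (b :* d))) ≈-refl ψ⁻ (dil 3 ψ⁻) (dil 2 φ⁻) (dil 6 φ⁻) ⟩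
  const (+ 2) · (ψ⁻ · dil 2 φ⁻ · (dil 3 ψ⁻ · dil 6 φ⁻))
    ≈⟨ ·-congʳ (const (+ 2)) (·-cong ψ⁻φ⁻₂ (≈-trans (·-congʳ (dil 3 ψ⁻) (≈-sym (dil-dil 3 2 φ⁻)))
         (≈-trans (≈-sym (dil-· 3 ψ⁻ (dil 2 φ⁻))) (≈-trans (dil-cong 3 ψ⁻φ⁻₂) (dil-· 3 ψ φ⁻))))) ⟩
  const (+ 2) · (ψ · φ⁻ · (dil 3 ψ · dil 3 φ⁻))
    ≈⟨ solve 4 (λ a b c d → con (+ 2) :* (a :* b :* (c :* d)) := con (+ 2) :* (a :* c) :* (b :* d)) ≈-refl ψ φ⁻ (dil 3 ψ) (dil 3 φ⁻) ⟩
  const (+ 2) · (ψ · dil 3 ψ) · D ∎)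
  where open ≈-Reasoning

S₃-φψ₆ : S₃ · D ≈ const (+ 2) · (φ · dil 6 ψ)
S₃-φψ₆ = begin
  S₃ · D                 ≈⟨ U-times-dil 2 1 S₁ D (s≤s (s≤s z≤n)) ⟨
  U 2 1 (S₁ · dil 2 D)   ≈⟨ U₁-dissected 2 (s≤s (s≤s z≤n)) even (const (+ 2) · (φ · dil 6 ψ)) (≈-trans S₁-ψψ₃ dissection) ⟩
  const (+ 2) · (φ · dil 6 ψ) ∎
  where
  open ≈-Reasoning
  even : Series
  even = const (+ 2) · (dil 2 ψ · dil 3 φ)
  dil-2· : ∀ f g → dil 2 (const (+ 2) · (f · g)) ≈ const (+ 2) · (dil 2 f · dil 2 g)
  dil-2· f g = ≈-trans (dil-· 2 (const (+ 2)) (f · g)) (·-cong (dil-const 2 (+ 2)) (dil-· 2 f g))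
  dissection : const (+ 2) · (ψ · dil 3 ψ) ≈ dil 2 even ⊕ X · dil 2 (const (+ 2) · (φ · dil 6 ψ))
  dissection = begin
    const (+ 2) · (ψ · dil 3 ψ)
      ≈⟨ ·-congʳ (const (+ 2)) ψψ₃ ⟩
    const (+ 2) · (dil 4 ψ · dil 6 φ ⊕ X · (dil 2 φ · dil 12 ψ))
      ≈⟨ solve 3 (λ a x b → con (+ 2) :* (a :+ x :* b) := con (+ 2) :* a :+ x :* (con (+ 2) :* b)) ≈-refl (dil 4 ψ · dil 6 φ) X (dil 2 φ · dil 12 ψ) ⟩
    const (+ 2) · (dil 4 ψ · dil 6 φ) ⊕ X · (const (+ 2) · (dil 2 φ · dil 12 ψ))
      ≈⟨ ⊕-cong (·-congʳ (const (+ 2)) (·-cong (≈-sym (dil-dil 2 2 ψ)) (≈-sym (dil-dil 2 3 φ))))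
           (·-congʳ X (·-congʳ (const (+ 2)) (·-congʳ (dil 2 φ) (≈-sym (dil-dil 2 6 ψ))))) ⟩
    const (+ 2) · (dil 2 (dil 2 ψ) · dil 2 (dil 3 φ)) ⊕ X · (const (+ 2) · (dil 2 φ · dil 2 (dil 6 ψ)))
      ≈⟨ ⊕-cong (dil-2· (dil 2 ψ) (dil 3 φ)) (·-congʳ X (dil-2· φ (dil 6 ψ))) ⟨
    dil 2 even ⊕ X · dil 2 (const (+ 2) · (φ · dil 6 ψ)) ∎

φ⁻-three-parts : φ⁻ ≈ dil 3 (dil 3 φ⁻) ⊕ ⊖ (const (+ 2) · X · dil 3 Ω⁻)
φ⁻-three-parts = begin
  neg φ
    ≈⟨ neg-cong φ-dissect₃ ⟩
  neg (dil 9 φ ⊕ const (+ 2) · X · dil 3 Ω)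
    ≈⟨ ≈-trans (neg-⊕ (dil 9 φ) (const (+ 2) · X · dil 3 Ω)) (⊕-cong
         (≈-trans (neg-dil-odd 9 φ (λ n → sgn-*-odd n 4)) (≈-sym (dil-dil 3 3 φ⁻)))
         (≈-trans (neg-· (const (+ 2) · X) (dil 3 Ω)) (·-cong
           (≈-trans (neg-· (const (+ 2)) X) (·-cong (neg-const (+ 2)) neg-X)) (neg-dil₃ Ω)))) ⟩
  dil 3 (dil 3 φ⁻) ⊕ const (+ 2) · ⊖ X · dil 3 Ω⁻
    ≈⟨ solve 3 (λ p x w → p :+ con (+ 2) :* (:- x) :* w := p :+ (:- (con (+ 2) :* x :* w))) ≈-refl (dil 3 (dil 3 φ⁻)) X (dil 3 Ω⁻) ⟩
  dil 3 (dil 3 φ⁻) ⊕ ⊖ (const (+ 2) · X · dil 3 Ω⁻) ∎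
  where open ≈-Reasoning

-- At q³ the first factor is the norm of φ(-q), its product over the substitutions q ↦ ωq with ω³ =
-- 1; the second factor becomes the φ(-q³) of `D`.
Δ : Series
Δ = (dil 3 φ⁻ · dil 3 φ⁻ · dil 3 φ⁻ ⊕ ⊖ (const (+ 8) · X · Ω⁻ · Ω⁻ · Ω⁻)) · φ⁻

W : Series
W = dil 2 ψ · dil 3 φ⁻ · dil 4 (E · E)

-- φ(-q) divides p³ - 8q³w³ when φ(-q) = p - 2qw is its 3-dissection; this clears the denominator.
S₇-relation : S₇ · Δ ≈ const (+ 8) · W
S₇-relation = begin
  S₇ · Δ
    ≈⟨ U-times-dil 3 1 S₃ Δ (s≤s (s≤s z≤n)) ⟨
  U 3 1 (S₃ · dil 3 Δ)
    ≈⟨ U₁-dissected₃ (g · A₀) (g · A₁) (g · A₂) dissection ⟩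
  g · A₁
    ≈⟨ solve 5 (λ s p m o v → con (+ 2) :* s :* (con (+ 2) :* p :* m :* v :+ con (+ 2) :* o :* m :* m)
         := con (+ 4) :* s :* m :* (v :* p :+ o :* m)) ≈-refl (dil 2 ψ) (dil 3 φ) (dil 3 φ⁻) Ω Ω⁻ ⟩
  -- The part of (p + 2qo)(m² + 2qmv + 4q²v²) with exponents 1 mod 3 is 2qm(pv + om), and pv + om is
  -- the symmetrised sum of `φΩ-E²` at q³. That identity yields the last factor 2.
  const (+ 4) · dil 2 ψ · dil 3 φ⁻ · (Ω⁻ · dil 3 φ ⊕ Ω · dil 3 φ⁻)
    ≈⟨ ·-congʳ (const (+ 4) · dil 2 ψ · dil 3 φ⁻) φΩ-E² ⟩
  const (+ 4) · dil 2 ψ · dil 3 φ⁻ · (dil 4 (E · E) ⊕ dil 4 (E · E))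
    ≈⟨ solve 3 (λ s m e → con (+ 4) :* s :* m :* (e :+ e) := con (+ 8) :* (s :* m :* e)) ≈-refl (dil 2 ψ) (dil 3 φ⁻) (dil 4 (E · E)) ⟩
  const (+ 8) · W ∎
  where
  open ≈-Reasoning
  P = dil 3 φ
  M = dil 3 φ⁻
  g A₀ A₁ A₂ : Series
  g  = const (+ 2) · dil 2 ψ
  A₀ = P · M · M ⊕ const (+ 8) · X · Ω · Ω⁻ · Ω⁻
  A₁ = const (+ 2) · P · M · Ω⁻ ⊕ const (+ 2) · Ω · M · M
  A₂ = const (+ 4) · P · Ω⁻ · Ω⁻ ⊕ const (+ 4) · Ω · M · Ω⁻
  p m o v x₃ : Series
  p = dil 3 P
  m = dil 3 M
  o = dil 3 Ω
  v = dil 3 Ω⁻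
  x₃ = dil 3 X
  dil₃ : ∀ f g h k l → dil 3 (f · g · h ⊕ k · l) ≈ dil 3 f · dil 3 g · dil 3 h ⊕ dil 3 k · dil 3 l
  dil₃ f g h k l = ≈-trans (dil-⊕ 3 (f · g · h) (k · l)) (⊕-cong
    (≈-trans (dil-· 3 (f · g) h) (·-congˡ (dil 3 h) (dil-· 3 f g))) (dil-· 3 k l))
  dil₃-const : ∀ c f → dil 3 (const c · f) ≈ const c · dil 3 f
  dil₃-const c f = ≈-trans (dil-· 3 (const c) f) (·-congˡ (dil 3 f) (dil-const 3 c))
  x₃-X : X · X · X ≈ x₃
  x₃-X = ≈-sym (≈-trans (dil-X 3) (solve 1 (λ x → x :* (x :* (x :* con (+ 1))) := x :* x :* x) ≈-refl X))
  dil-Δ : dil 3 Δ ≈ (m · m · m ⊕ ⊖ (const (+ 8) · x₃ · v · v · v)) · dil 3 φ⁻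
  dil-Δ = ≈-trans (dil-· 3 (M · M · M ⊕ ⊖ (const (+ 8) · X · Ω⁻ · Ω⁻ · Ω⁻)) φ⁻) (·-congˡ (dil 3 φ⁻)
    (≈-trans (dil-⊕ 3 (M · M · M) (⊖ (const (+ 8) · X · Ω⁻ · Ω⁻ · Ω⁻))) (⊕-cong
      (≈-trans (dil-· 3 (M · M) M) (·-congˡ m (dil-· 3 M M)))
      (≈-trans (dil-⊖ 3 (const (+ 8) · X · Ω⁻ · Ω⁻ · Ω⁻)) (⊖-cong
        (≈-trans (dil-· 3 (const (+ 8) · X · Ω⁻ · Ω⁻) Ω⁻) (·-congˡ v
          (≈-trans (dil-· 3 (const (+ 8) · X · Ω⁻) Ω⁻) (·-congˡ v
            (≈-trans (dil-· 3 (const (+ 8) · X) Ω⁻) (·-congˡ v (dil₃-const (+ 8) X))))))))))))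
  dil-g : dil 3 g ≈ const (+ 2) · dil 6 ψ
  dil-g = ≈-trans (dil₃-const (+ 2) (dil 2 ψ)) (·-congʳ (const (+ 2)) (dil-dil 3 2 ψ))
  dil-A₀ : dil 3 A₀ ≈ p · m · m ⊕ const (+ 8) · x₃ · o · v · v
  dil-A₀ = ≈-trans (dil₃ P M M (const (+ 8) · X · Ω · Ω⁻) Ω⁻) (⊕-congʳ (p · m · m) (·-congˡ v
    (≈-trans (dil-· 3 (const (+ 8) · X · Ω) Ω⁻) (·-congˡ v
      (≈-trans (dil-· 3 (const (+ 8) · X) Ω) (·-congˡ o (dil₃-const (+ 8) X)))))))
  dil-A₁ : dil 3 A₁ ≈ const (+ 2) · p · m · v ⊕ const (+ 2) · o · m · m
  dil-A₁ = ≈-trans (dil₃ (const (+ 2) · P) M Ω⁻ (const (+ 2) · Ω · M) M) (⊕-cong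
    (·-congˡ v (·-congˡ m (dil₃-const (+ 2) P)))
    (·-congˡ m (≈-trans (dil-· 3 (const (+ 2) · Ω) M) (·-congˡ m (dil₃-const (+ 2) Ω)))))
  dil-A₂ : dil 3 A₂ ≈ const (+ 4) · p · v · v ⊕ const (+ 4) · o · m · v
  dil-A₂ = ≈-trans (dil₃ (const (+ 4) · P) Ω⁻ Ω⁻ (const (+ 4) · Ω · M) Ω⁻) (⊕-cong
    (·-congˡ v (·-congˡ v (dil₃-const (+ 4) P)))
    (·-congˡ v (≈-trans (dil-· 3 (const (+ 4) · Ω) M) (·-congˡ m (dil₃-const (+ 4) Ω)))))
  -- The cofactor in m³ - (2qv)³ = (m - 2qv) · `K`.
  K : Series
  K = m · m ⊕ const (+ 2) · X · m · v ⊕ const (+ 4) · X · X · v · v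
  dissection : S₃ · dil 3 Δ ≈ dil 3 (g · A₀) ⊕ X · dil 3 (g · A₁) ⊕ X · X · dil 3 (g · A₂)
  dissection = begin
    S₃ · dil 3 Δ
      ≈⟨ ·-congʳ S₃ dil-Δ ⟩
    S₃ · ((m · m · m ⊕ ⊖ (const (+ 8) · x₃ · v · v · v)) · dil 3 φ⁻)
      ≈⟨ ·-congʳ S₃ (·-congˡ (dil 3 φ⁻) (⊕-congʳ (m · m · m) (⊖-cong (·-congˡ v (·-congˡ v (·-congˡ v (·-congʳ (const (+ 8)) (≈-sym x₃-X)))))))) ⟩
    S₃ · ((m · m · m ⊕ ⊖ (const (+ 8) · (X · X · X) · v · v · v)) · dil 3 φ⁻)
      ≈⟨ solve 5 (λ s m v x f → s :* ((m :* m :* m :+ (:- (con (+ 8) :* (x :* x :* x) :* v :* v :* v))) :* f)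
           := s :* ((m :+ (:- (con (+ 2) :* x :* v))) :* f) :* (m :* m :+ con (+ 2) :* x :* m :* v :+ con (+ 4) :* x :* x :* v :* v)) ≈-refl S₃ m v X (dil 3 φ⁻) ⟩
    S₃ · ((m ⊕ ⊖ (const (+ 2) · X · v)) · dil 3 φ⁻) · K
      ≈⟨ ·-congˡ K (·-congʳ S₃ (·-congˡ (dil 3 φ⁻) φ⁻-three-parts)) ⟨
    S₃ · D · K
      ≈⟨ ·-congˡ K S₃-φψ₆ ⟩
    const (+ 2) · (φ · dil 6 ψ) · K
      ≈⟨ ·-congˡ K (·-congʳ (const (+ 2)) (·-congˡ (dil 6 ψ) (≈-trans φ-dissect₃
           (⊕-congˡ (const (+ 2) · X · o) (≈-sym (dil-dil 3 3 φ)))))) ⟩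
    const (+ 2) · ((p ⊕ const (+ 2) · X · o) · dil 6 ψ) · K
      ≈⟨ solve 6 (λ p m o v x s →
           con (+ 2) :* ((p :+ con (+ 2) :* x :* o) :* s) :* (m :* m :+ con (+ 2) :* x :* m :* v :+ con (+ 4) :* x :* x :* v :* v)
           := con (+ 2) :* s :* (p :* m :* m :+ con (+ 8) :* (x :* x :* x) :* o :* v :* v)
              :+ x :* (con (+ 2) :* s :* (con (+ 2) :* p :* m :* v :+ con (+ 2) :* o :* m :* m))
              :+ x :* x :* (con (+ 2) :* s :* (con (+ 4) :* p :* v :* v :+ con (+ 4) :* o :* m :* v))) ≈-refl p m o v X (dil 6 ψ) ⟩
    const (+ 2) · dil 6 ψ · (p · m · m ⊕ const (+ 8) · (X · X · X) · o · v · v)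
      ⊕ X · (const (+ 2) · dil 6 ψ · (const (+ 2) · p · m · v ⊕ const (+ 2) · o · m · m))
      ⊕ X · X · (const (+ 2) · dil 6 ψ · (const (+ 4) · p · v · v ⊕ const (+ 4) · o · m · v))
      ≈⟨ ⊕-cong (⊕-cong
           (≈-sym (≈-trans (dil-· 3 g A₀) (·-cong dil-g (≈-trans dil-A₀
             (⊕-congʳ (p · m · m) (·-congˡ v (·-congˡ v (·-congˡ o (·-congʳ (const (+ 8)) (≈-sym x₃-X))))))))))
           (·-congʳ X (≈-sym (≈-trans (dil-· 3 g A₁) (·-cong dil-g dil-A₁)))))
           (·-congʳ (X · X) (≈-sym (≈-trans (dil-· 3 g A₂) (·-cong dil-g dil-A₂)))) ⟩
    dil 3 (g · A₀) ⊕ X · dil 3 (g · A₁) ⊕ X · X · dil 3 (g · A₂) ∎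

-- Reduction modulo 4 and 32

·-congˡ-mod : ∀ {M} g {f f′} → f ≈ f′ [mod M ] → f · g ≈ f′ · g [mod M ]
·-congˡ-mod g p = ·-cong-mod {g = g} p mod-refl

·-congʳ-mod : ∀ {M} f {g g′} → g ≈ g′ [mod M ] → f · g ≈ f · g′ [mod M ]
·-congʳ-mod f p = ·-cong-mod {f = f} mod-refl p

const-* : ∀ a b → const a · const b ≈ const (a ℤ.* b)
const-* a b = mk λ { zero → refl ; (suc n) → trans (const-· a (const b) (suc n)) (ℤₚ.*-zeroʳ a) }

-- (1 + 2kh)² = 1 + 4k(h + kh²), so squaring gains one factor 2 in the modulus.
square-mod : ∀ k {f} → f ≈ const (+ 1) [mod + 2 ℤ.* k ] → f · f ≈ const (+ 1) [mod + 4 ℤ.* k ]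
square-mod k {f} p with mod⇒multiple p
... | h , e = multiple⇒mod (+ 4 ℤ.* k) (h ⊕ const k · h · h) (≈-trans (·-cong e e) (≈-trans
      (·-cong expand expand)
      (≈-trans (solve 2 (λ k h → (con (+ 1) :+ con (+ 2) :* k :* h) :* (con (+ 1) :+ con (+ 2) :* k :* h)
                 := con (+ 1) :+ (con (+ 4) :* k) :* (h :+ k :* h :* h)) ≈-refl (const k) h)
        (⊕-congʳ (const (+ 1)) (·-congˡ (h ⊕ const k · h · h) (const-* (+ 4) k))))))
  where
  expand : const (+ 1) ⊕ const (+ 2 ℤ.* k) · h ≈ const (+ 1) ⊕ const (+ 2) · const k · h
  expand = ⊕-congʳ (const (+ 1)) (·-congˡ h (≈-sym (const-* (+ 2) k)))

mod-scale : ∀ c {M f g} → f ≈ g [mod M ] → const c · f ≈ const c · g [mod c ℤ.* M ]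
mod-scale c {M} {f} {g} p with mod⇒multiple p
... | h , e = multiple⇒mod (c ℤ.* M) h (≈-trans (·-congʳ (const c) e)
      (≈-trans (solve 4 (λ c g m h → c :* (g :+ m :* h) := c :* g :+ (c :* m) :* h) ≈-refl (const c) g (const M) h)
        (⊕-congʳ (const c · g) (·-congˡ h (const-* c M)))))

dil-cong-mod : ∀ d .{{_ : NonZero d}} {M f g} → f ≈ g [mod M ] → dil d f ≈ dil d g [mod M ]
dil-cong-mod d {M} {f} {g} p = mkMod λ n → lem (n DM.% d ≡ᵇ 0) (n DM./ d)
  where lem : ∀ b m → M ∣ˢ ((if b then f m else + 0) ℤ.- (if b then g m else + 0))
        lem true  m = atMod p m
        lem false m = ∣0

neg-cong-mod : ∀ {M f g} → f ≈ g [mod M ] → neg f ≈ neg g [mod M ]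
neg-cong-mod {M} {f} {g} p = mkMod λ n → subst (M ∣ˢ_) (lem (sgn n) (f n) (g n)) (Sgn.∣n⇒∣m*n (sgn n) (atMod p n))
  where lem : ∀ s a b → s ℤ.* (a ℤ.- b) ≡ s ℤ.* a ℤ.- s ℤ.* b
        lem = ℤ-ring

-- The indices m and -m pair off, leaving m = 0; this is why φ ≡ 1 (mod 2).
sumℤ-even : ∀ B {g} → (∀ m → g (- m) ≡ g m) → + 2 ∣ˢ (sumℤ B g ℤ.- g (+ 0))
sumℤ-even zero    {g} e = ≡⇒∣- {a = g (+ 0)} refl
sumℤ-even (suc B) {g} e = subst (+ 2 ∣ˢ_) (trans (lem (sumℤ B g) (g (+ 0)) (g (+ suc B)))
    (cong (λ z → sumℤ B g ℤ.+ (g (+ suc B) ℤ.+ z) ℤ.- g (+ 0)) (sym (e (+ suc B)))))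
  (Sgn.∣m∣n⇒∣m+n (sumℤ-even B e) (divides (g (+ suc B)) refl))
  where lem : ∀ s a b → s ℤ.- a ℤ.+ b ℤ.* + 2 ≡ s ℤ.+ (b ℤ.+ b) ℤ.- a
        lem = ℤ-ring

φ-mod2 : φ ≈ const (+ 1) [mod + 2 ]
φ-mod2 = mkMod λ n → subst (λ z → + 2 ∣ˢ (φ n ℤ.- z)) (ℤₚ.*-identityˡ (const (+ 1) n))
  (sumℤ-even n λ m → cong (λ k → + 1 ℤ.* X^ k n) (sq-neg m))

φ⁻-mod2 : φ⁻ ≈ const (+ 1) [mod + 2 ]
φ⁻-mod2 = mod-trans (neg-cong-mod φ-mod2) (≈⇒mod (neg-const (+ 1)))

φ⁻²-mod4 : φ⁻ · φ⁻ ≈ const (+ 1) [mod + 4 ]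
φ⁻²-mod4 = square-mod (+ 1) φ⁻-mod2

dil-φ⁻²-mod4 : ∀ d .{{_ : NonZero d}} → dil d φ⁻ · dil d φ⁻ ≈ const (+ 1) [mod + 4 ]
dil-φ⁻²-mod4 d = mod-trans (≈⇒mod (≈-sym (dil-· d φ⁻ φ⁻))) (mod-trans (dil-cong-mod d φ⁻²-mod4) (≈⇒mod (dil-const d (+ 1))))

-- Both sides satisfy y² = (φ(-q)² y)(q²), an equation that determines y from its constant term.
ψE : ψ · E ≈ dil 2 (E · E)
ψE = mk λ n → ℤₚ.i-j≡0⇒i≡j _ _ (<-rec (λ n → d n ≡ + 0) step n)
  where
  a b d m : Series
  a = ψ · E
  b = dil 2 (E · E)
  d = a ⊕ ⊖ b
  m = φ⁻ · φ⁻
  a² : a · a ≈ dil 2 (m · a)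
  a² = begin
    ψ · E · (ψ · E)                ≈⟨ solve 2 (λ a b → a :* b :* (a :* b) := (a :* a) :* (b :* b)) ≈-refl ψ E ⟩
    ψ · ψ · (E · E)                ≈⟨ ·-cong ψ² E² ⟩
    dil 2 ψ · φ · (φ⁻ · dil 2 E)   ≈⟨ solve 4 (λ a b c d → a :* b :* (c :* d) := (b :* c) :* (a :* d)) ≈-refl (dil 2 ψ) φ φ⁻ (dil 2 E) ⟩
    φ · φ⁻ · (dil 2 ψ · dil 2 E)   ≈⟨ ·-cong φφ⁻ (≈-sym (dil-· 2 ψ E)) ⟩
    dil 2 m · dil 2 a              ≈⟨ dil-· 2 m a ⟨
    dil 2 (m · a)                  ∎
    where open ≈-Reasoning
  b² : b · b ≈ dil 2 (m · b)
  b² = begin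
    b · b                          ≈⟨ dil-· 2 (E · E) (E · E) ⟨
    dil 2 (E · E · (E · E))        ≈⟨ dil-cong 2 (≈-trans (·-cong E² E²)
        (solve 2 (λ p e → p :* e :* (p :* e) := p :* p :* (e :* e)) ≈-refl φ⁻ (dil 2 E))) ⟩
    dil 2 (m · (dil 2 E · dil 2 E)) ≈⟨ dil-cong 2 (·-congʳ m (≈-sym (dil-· 2 E E))) ⟩
    dil 2 (m · b)                  ∎
    where open ≈-Reasoning
  relation : d · (a ⊕ b) ≈ dil 2 (d · m)
  relation = begin
    d · (a ⊕ b)                    ≈⟨ solve 2 (λ a b → (a :+ (:- b)) :* (a :+ b) := a :* a :+ (:- (b :* b))) ≈-refl a b ⟩
    a · a ⊕ ⊖ (b · b)              ≈⟨ ⊕-cong a² (⊖-cong b²) ⟩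
    dil 2 (m · a) ⊕ ⊖ dil 2 (m · b) ≈⟨ ≈-trans (⊕-congʳ (dil 2 (m · a)) (≈-sym (dil-⊖ 2 (m · b)))) (≈-sym (dil-⊕ 2 (m · a) (⊖ (m · b)))) ⟩
    dil 2 (m · a ⊕ ⊖ (m · b))      ≈⟨ dil-cong 2 (solve 3 (λ m a b → m :* a :+ (:- (m :* b)) := (a :+ (:- b)) :* m) ≈-refl m a b) ⟩
    dil 2 (d · m)                  ∎
    where open ≈-Reasoning
  vanish : ∀ n → (∀ k → k ≤ n → d k ≡ + 0) → (d · m) n ≡ + 0
  vanish n h = trans (·-cong-≤ {d} {const (+ 0)} {m} {m} n (λ k k≤n → trans (h k k≤n) (sym (const-zero k))) (λ _ _ → refl))
    (const-· (+ 0) m n)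
  step : ∀ n → (∀ {k} → k < n → d k ≡ + 0) → d n ≡ + 0
  step zero    ih = refl
  -- Coefficient n + 1 of d(a + b) is 2d(n + 1), as a and b have constant term 1. On the right it is
  -- 0 or sits at index (n + 1)/2 < n + 1, where the induction hypothesis applies.
  step (suc n) ih = ℤₚ.*-cancelʳ-≡ (d (suc n)) (+ 0) (+ 2) (trans
    (sym (ℤₚ.i-j≡0⇒i≡j _ _ (Sgn.0∣⇒≡0 (·-leading (+ 0) {d} (a ⊕ b) (suc n) λ k k<n → subst (+ 0 ∣ˢ_) (sym (ih k<n)) ∣0))))
    (trans (at relation (suc n)) (lem (suc n DM.% 2 ≡ᵇ 0))))
    where
    lem : ∀ c → (if c then (d · m) (suc n DM./ 2) else + 0) ≡ + 0
    lem true  = vanish (suc n DM./ 2) λ k k≤ → ih (ℕₚ.≤-<-trans k≤ (DM.m/n<m (suc n) 2 (s≤s (s≤s z≤n))))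
    lem false = refl

abstract
 -- `Δ` has constant term 1, so 8 divides `S₇` because it divides 8`W`. Dividing over ℤ leaves only
 -- a congruence mod 4 to prove. `abstract` keeps the chosen quotients from unfolding.
 S₇-multiple : ∃ λ V → S₇ ≈ const (+ 8) · V × V · Δ ≈ W
 S₇-multiple = V , S₇V , mk λ n → ℤₚ.*-cancelˡ-≡ (+ 8) _ _
     (trans (sym (const-· (+ 8) (V · Δ) n)) (trans (at (≈-trans (≈-sym (·-assoc (const (+ 8)) V Δ))
       (≈-trans (·-congˡ Δ (≈-sym S₇V)) S₇-relation)) n) (const-· (+ 8) W n)))
   where
   8∣S₇ : ∀ n → + 8 ∣ˢ S₇ n
   8∣S₇ = ∣-unit-cancel (+ 8) {S₇} Δ refl λ n →
     subst (+ 8 ∣ˢ_) (sym (trans (at S₇-relation n) (const-· (+ 8) W n))) (divides (W n) (ℤₚ.*-comm (+ 8) (W n)))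
   V : Series
   V n = Sgn._∣_.quotient (8∣S₇ n)
   S₇V : S₇ ≈ const (+ 8) · V
   S₇V = mk λ n → trans (Sgn._∣_.equality (8∣S₇ n)) (trans (ℤₚ.*-comm (V n) (+ 8)) (sym (const-· (+ 8) V n)))

V : Series
V = proj₁ S₇-multiple

-- The second term of `Δ` has coefficient 8 and drops out, leaving φ(-q³)³φ(-q); here φ(-q³)² ≡ 1.
-- Inserting φ(-q)² ≡ 1 on the other side gives both sides the factor φ(-q³)φ(-q), which cancels.
V-mod4 : V ≈ φ⁻ · dil 2 (ψ · dil 2 (E · E)) [mod + 4 ]
V-mod4 = mod-cancel (M · φ⁻) refl (begin
  V · (M · φ⁻)
    ≈⟨ ≈⇒mod (solve 3 (λ v m p → v :* (m :* p) := v :* ((con (+ 1) :* m) :* p)) ≈-refl V M φ⁻) ⟩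
  V · (const (+ 1) · M · φ⁻)
    ≈⟨ ·-congʳ-mod V (·-congˡ-mod φ⁻ (·-congˡ-mod M (dil-φ⁻²-mod4 3))) ⟨
  V · (M · M · M · φ⁻)
    ≈⟨ ·-congʳ-mod V (multiple⇒mod {M · M · M · φ⁻} {Δ} (+ 4) (const (+ 2) · X · Ω⁻ · Ω⁻ · Ω⁻ · φ⁻)
         (solve 4 (λ m x w p → m :* m :* m :* p := (m :* m :* m :+ (:- (con (+ 8) :* x :* w :* w :* w))) :* p
            :+ con (+ 4) :* (con (+ 2) :* x :* w :* w :* w :* p)) ≈-refl M X Ω⁻ φ⁻)) ⟩
  V · Δ
    ≈⟨ ≈⇒mod (proj₂ (proj₂ S₇-multiple)) ⟩
  dil 2 ψ · M · dil 4 (E · E)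
    ≈⟨ ≈⇒mod (≈-trans (·-congʳ (dil 2 ψ · M) (≈-sym (dil-dil 2 2 (E · E))))
         (solve 3 (λ s m e → s :* m :* e := s :* e :* m :* con (+ 1)) ≈-refl (dil 2 ψ) M (dil 2 (dil 2 (E · E))))) ⟩
  dil 2 ψ · dil 2 (dil 2 (E · E)) · M · const (+ 1)
    ≈⟨ ·-congʳ-mod (dil 2 ψ · dil 2 (dil 2 (E · E)) · M) φ⁻²-mod4 ⟨
  dil 2 ψ · dil 2 (dil 2 (E · E)) · M · (φ⁻ · φ⁻)
    ≈⟨ ≈⇒mod (solve 4 (λ s e m p → s :* e :* m :* (p :* p) := p :* (s :* e) :* (m :* p)) ≈-refl (dil 2 ψ) (dil 2 (dil 2 (E · E))) M φ⁻) ⟩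
  φ⁻ · (dil 2 ψ · dil 2 (dil 2 (E · E))) · (M · φ⁻)
    ≈⟨ ≈⇒mod (·-congˡ (M · φ⁻) (·-congʳ φ⁻ (≈-sym (dil-· 2 ψ (dil 2 (E · E)))))) ⟩
  φ⁻ · dil 2 (ψ · dil 2 (E · E)) · (M · φ⁻) ∎)
  where
  open SetoidReasoning (modSetoid (+ 4))
  M = dil 3 φ⁻

dil₂E² : dil 2 (E · E) ≈ dil 2 φ⁻ · dil 4 E
dil₂E² = ≈-trans (dil-cong 2 E²) (≈-trans (dil-· 2 φ⁻ (dil 2 E)) (·-congʳ (dil 2 φ⁻) (dil-dil 2 2 E)))

-- The even part of φ(-q) and the factor φ(-q²) of E(q²)² combine to φ(q²)φ(-q²) = φ(-q⁴)² ≡ 1 (mod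
-- 4).
V-even : U 2 0 V ≈ ψ · dil 4 E [mod + 4 ]
V-even = begin
  U 2 0 V
    ≈⟨ U-cong-mod 2 0 V-mod4 ⟩
  U 2 0 (φ⁻ · dil 2 (ψ · dil 2 (E · E)))
    ≈⟨ ≈⇒mod (≈-trans (U-times-dil 2 0 φ⁻ (ψ · dil 2 (E · E)) (s≤s z≤n))
         (·-cong (U₀-dissected (dil 2 φ) (const (- + 2) · dil 4 ψ) φ⁻-two-parts) (·-congʳ ψ dil₂E²))) ⟩
  dil 2 φ · (ψ · (dil 2 φ⁻ · dil 4 E))
    ≈⟨ ≈⇒mod (solve 4 (λ f s m e → f :* (s :* (m :* e)) := s :* e :* (f :* m)) ≈-refl (dil 2 φ) ψ (dil 2 φ⁻) (dil 4 E)) ⟩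
  ψ · dil 4 E · (dil 2 φ · dil 2 φ⁻)
    ≈⟨ ·-congʳ-mod (ψ · dil 4 E) (mod-trans (≈⇒mod (≈-trans (≈-sym (dil-· 2 φ φ⁻)) (≈-trans (dil-cong 2 φφ⁻)
         (≈-trans (dil-dil 2 2 (φ⁻ · φ⁻)) (dil-· 4 φ⁻ φ⁻))))) (dil-φ⁻²-mod4 4)) ⟩
  ψ · dil 4 E · const (+ 1)
    ≈⟨ ≈⇒mod (≈-trans (·-comm (ψ · dil 4 E) (const (+ 1))) (·-identityˡ (ψ · dil 4 E))) ⟩
  ψ · dil 4 E ∎
  where open SetoidReasoning (modSetoid (+ 4))

-- The odd part of φ(-q) brings a factor -2, so the rest matters only mod 2. There φ(-q²) and φ(-q⁸)
-- are 1, and ψ(q⁴)E(q⁴) = E(q⁸)² = φ(-q⁸)E(q¹⁶).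
V-odd : U 2 1 V ≈ const (- + 2) · (ψ · dil 16 E) [mod + 4 ]
V-odd = begin
  U 2 1 V
    ≈⟨ U-cong-mod 2 1 V-mod4 ⟩
  U 2 1 (φ⁻ · dil 2 (ψ · dil 2 (E · E)))
    ≈⟨ ≈⇒mod (≈-trans (U-times-dil 2 1 φ⁻ (ψ · dil 2 (E · E)) (s≤s (s≤s z≤n)))
         (·-cong (U₁-dissected 2 (s≤s (s≤s z≤n)) (dil 2 φ) (const (- + 2) · dil 4 ψ) φ⁻-two-parts) (·-congʳ ψ dil₂E²))) ⟩
  const (- + 2) · dil 4 ψ · (ψ · (dil 2 φ⁻ · dil 4 E))
    ≈⟨ ≈⇒mod (solve 4 (λ f s m e → con (- + 2) :* f :* (s :* (m :* e)) := con (+ 2) :* (m :* ((:- f) :* s :* e)))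
         ≈-refl (dil 4 ψ) ψ (dil 2 φ⁻) (dil 4 E)) ⟩
  const (+ 2) · (dil 2 φ⁻ · (⊖ dil 4 ψ · ψ · dil 4 E))
    ≈⟨ mod-scale (+ 2) (·-congˡ-mod (⊖ dil 4 ψ · ψ · dil 4 E) (dil-φ⁻-mod2 2)) ⟩
  const (+ 2) · (const (+ 1) · (⊖ dil 4 ψ · ψ · dil 4 E))
    ≈⟨ ≈⇒mod (≈-trans (solve 3 (λ f s e → con (+ 2) :* (con (+ 1) :* ((:- f) :* s :* e)) := con (+ 2) :* ((:- s) :* (f :* e))) ≈-refl (dil 4 ψ) ψ (dil 4 E))
         (·-congʳ (const (+ 2)) (·-congʳ (⊖ ψ) ψE₄))) ⟩
  const (+ 2) · (⊖ ψ · (dil 8 φ⁻ · dil 16 E))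
    ≈⟨ mod-scale (+ 2) (·-congʳ-mod (⊖ ψ) (·-congˡ-mod (dil 16 E) (dil-φ⁻-mod2 8))) ⟩
  const (+ 2) · (⊖ ψ · (const (+ 1) · dil 16 E))
    ≈⟨ ≈⇒mod (solve 2 (λ s e → con (+ 2) :* ((:- s) :* (con (+ 1) :* e)) := con (- + 2) :* (s :* e)) ≈-refl ψ (dil 16 E)) ⟩
  const (- + 2) · (ψ · dil 16 E) ∎
  where
  open SetoidReasoning (modSetoid (+ 4))
  dil-φ⁻-mod2 : ∀ d .{{_ : NonZero d}} → dil d φ⁻ ≈ const (+ 1) [mod + 2 ]
  dil-φ⁻-mod2 d = mod-trans (dil-cong-mod d φ⁻-mod2) (≈⇒mod (dil-const d (+ 1)))
  ψE₄ : dil 4 ψ · dil 4 E ≈ dil 8 φ⁻ · dil 16 E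
  ψE₄ = ≈-trans (≈-sym (dil-· 4 ψ E)) (≈-trans (dil-cong 4 (≈-trans ψE dil₂E²))
    (≈-trans (dil-· 4 (dil 2 φ⁻) (dil 4 E)) (·-cong (dil-dil 4 2 φ⁻) (dil-dil 4 4 E))))

S-index : ∀ n → S₇ n ≡ S (12 * n + 7)
S-index n = cong S (lem n)
  where lem : ∀ n → 1 + (1 + (1 + n * 3) * 2) * 2 ≡ 12 * n + 7
        lem = ℕ-ring

32∣S : ∀ n → + 4 ∣ˢ V n → + 32 ∣ˢ S (12 * n + 7)
32∣S n p = subst (+ 32 ∣ˢ_) (trans (sym (trans (at (proj₁ (proj₂ S₇-multiple)) n) (const-· (+ 8) V n))) (S-index n))
  (Sgn.*-monoʳ-∣ (+ 8) p)

∣-of-zero : ∀ {M} a {b} → b ≡ + 0 → M ∣ˢ (a ℤ.- b) → M ∣ˢ a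
∣-of-zero a refl p = subst (_ ∣ˢ_) (ℤₚ.+-identityʳ a) p

S-24n+7 : ∀ n → (ψ · dil 4 E) n ≡ + 0 → + 32 ∣ˢ S (24 * n + 7)
S-24n+7 n z = subst (λ k → + 32 ∣ˢ S k) (lem n) (32∣S (0 + n * 2) (∣-of-zero _ z (atMod V-even n)))
  where lem : ∀ n → 12 * (0 + n * 2) + 7 ≡ 24 * n + 7
        lem = ℕ-ring

S-24n+19 : ∀ n → (ψ · dil 16 E) n ≡ + 0 → + 32 ∣ˢ S (24 * n + 19)
S-24n+19 n z = subst (λ k → + 32 ∣ˢ S k) (lem n) (32∣S (1 + n * 2)
    (∣-of-zero _ (trans (const-· (- + 2) (ψ · dil 16 E) n) (cong (λ z → - + 2 ℤ.* z) z)) (atMod V-odd n)))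
  where lem : ∀ n → 12 * (1 + n * 2) + 7 ≡ 24 * n + 19
        lem = ℕ-ring

-- Reduction of the exponent 16m + 1 to 1.

^ˢ-+ : ∀ f m n → f ^ˢ (m + n) ≈ f ^ˢ m · f ^ˢ n
^ˢ-+ f zero    n = ≈-sym (≈-trans (·-congˡ (f ^ˢ n) one≈const1) (·-identityˡ (f ^ˢ n)))
^ˢ-+ f (suc m) n = ≈-trans (·-congʳ f (^ˢ-+ f m n)) (≈-sym (·-assoc f (f ^ˢ m) (f ^ˢ n)))

^ˢ-double-mod : ∀ k {f} n → f ^ˢ n ≈ const (+ 1) [mod + 2 ℤ.* k ] → f ^ˢ (n + n) ≈ const (+ 1) [mod + 4 ℤ.* k ]
^ˢ-double-mod k {f} n p = mod-trans (≈⇒mod (^ˢ-+ f n n)) (square-mod k p)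

-- Four squarings raise the modulus from 2 to 32, which is the origin of the 16 in 16m + 1.
^16-mod32 : ∀ {f} → f ≈ const (+ 1) [mod + 2 ] → f ^ˢ 16 ≈ const (+ 1) [mod + 32 ]
^16-mod32 {f} p = ^ˢ-double-mod (+ 8) {f} 8 (^ˢ-double-mod (+ 4) {f} 4 (^ˢ-double-mod (+ 2) {f} 2 (^ˢ-double-mod (+ 1) {f} 1
  (mod-trans (≈⇒mod (≈-trans (·-congʳ f one≈const1) (≈-trans (·-comm f (const (+ 1))) (·-identityˡ f)))) p))))

^16m-mod32 : ∀ {f} m → f ≈ const (+ 1) [mod + 2 ] → f ^ˢ (16 * m) ≈ const (+ 1) [mod + 32 ]
^16m-mod32 {f} zero    p = ≈⇒mod one≈const1
^16m-mod32 {f} (suc m) p = mod-trans (≈⇒mod (≈-trans (mk λ k → cong (λ r → (f ^ˢ r) k) (ℕₚ.*-suc 16 m)) (^ˢ-+ f 16 (16 * m))))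
  (mod-trans (·-cong-mod {f = f ^ˢ 16} (^16-mod32 p) (^16m-mod32 m p)) (≈⇒mod (·-identityˡ (const (+ 1)))))

-- Modulo 2 the signs in 1 + q^d and 1 - q^d do not matter, so numerator and denominator agree.
factor-mod2 : ∀ j → factor j ≈ const (+ 1) [mod + 2 ]
factor-mod2 j = mod-cancel B B0 (mod-trans (≈⇒mod (factor-relation j)) (multiple⇒mod (+ 2) (⊖ const (+ 1) · (y ⊕ ⊖ x))
    (solve 2 (λ x y → (con (+ 1) :+ con (+ 1) :* x) :* (con (+ 1) :+ con (- + 1) :* y)
      := con (+ 1) :* ((con (+ 1) :+ con (+ 1) :* y) :* (con (+ 1) :+ con (- + 1) :* x)) :+ con (+ 2) :* ((:- con (+ 1)) :* (y :+ (:- x)))) ≈-refl x y)))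
  where
  d = suc (2 * j)
  x = X^ d
  y = X^ (3 * d)
  B : Series
  B = one± (+ 1) (3 * d) · one± (- + 1) d
  B0 : B 0 ≡ + 1
  B0 = cong₂ ℤ._*_ (one±-0 (+ 1) (3 * d ∸ 1)) (one±-0 (- + 1) (2 * j))

-- `partialProd r` raises each factor to the power r separately, so the congruence is proved factor
-- by factor rather than for S itself.
S3bar-16m+1 : ∀ m n → + 32 ∣ˢ (S3bar (16 * m + 1) n ℤ.- S n)
S3bar-16m+1 m n = atMod (go n) n
  where
  go : ∀ N → partialProd (16 * m + 1) N ≈ partialProd 1 N [mod + 32 ]
  go zero    = mod-refl
  go (suc N) = ·-cong-mod {f = factor N ^ˢ (16 * m + 1)} {factor N ^ˢ 1} (mod-trans (≈⇒mod (^ˢ-+ (factor N) (16 * m) 1))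
    (mod-trans (·-congˡ-mod (factor N ^ˢ 1) (^16m-mod32 m (factor-mod2 N))) (≈⇒mod (·-identityˡ (factor N ^ˢ 1))))) (go N)

-- Numbers of the form 3x² + 4y²

binomial-theorem : ∀ a n → (+ 1 ℤ.+ a) ℤ.^ n ≡ sumTo (λ k → + (choose n k) ℤ.* a ℤ.^ k) n
binomial-theorem a zero    = refl
binomial-theorem a (suc n) = begin
  (+ 1 ℤ.+ a) ℤ.* (+ 1 ℤ.+ a) ℤ.^ n
    ≡⟨ cong ((+ 1 ℤ.+ a) ℤ.*_) (binomial-theorem a n) ⟩
  (+ 1 ℤ.+ a) ℤ.* Σ₀
    ≡⟨ ℤₚ.*-distribʳ-+ Σ₀ (+ 1) a ⟩
  + 1 ℤ.* Σ₀ ℤ.+ a ℤ.* Σ₀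
    ≡⟨ cong₂ ℤ._+_ (trans (ℤₚ.*-identityˡ Σ₀) extend) (sym (sumTo-* a (λ k → + (choose n k) ℤ.* a ℤ.^ k) n)) ⟩
  f 0 ℤ.+ sumTo (λ k → f (suc k)) n ℤ.+ sumTo (λ k → a ℤ.* f k) n
    ≡⟨ ℤₚ.+-assoc (f 0) (sumTo (λ k → f (suc k)) n) (sumTo (λ k → a ℤ.* f k) n) ⟩
  f 0 ℤ.+ (sumTo (λ k → f (suc k)) n ℤ.+ sumTo (λ k → a ℤ.* f k) n)
    ≡⟨ cong (λ z → f 0 ℤ.+ z) (sym (sumTo-+ (λ k → f (suc k)) (λ k → a ℤ.* f k) n)) ⟩
  f 0 ℤ.+ sumTo (λ k → f (suc k) ℤ.+ a ℤ.* f k) n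
    ≡⟨ cong (λ z → f 0 ℤ.+ z) (sumTo-cong n λ k _ → trans (pascal (+ (choose n (suc k))) (+ (choose n k)) a (a ℤ.^ k))
         (cong (λ c → + c ℤ.* (a ℤ.* a ℤ.^ k)) (nCk+nC[k+1]≡[n+1]C[k+1] n k))) ⟩
  f 0 ℤ.+ sumTo (λ k → g (suc k)) n
    ≡⟨ sym (sumTo-first g n) ⟩
  sumTo g (suc n) ∎
  where
  open ≡-Reasoning
  f g : ℕ → ℤ
  f k = + (choose n k) ℤ.* a ℤ.^ k
  g k = + (choose (suc n) k) ℤ.* a ℤ.^ k
  Σ₀ = sumTo f n
  pascal : ∀ x y a b → x ℤ.* (a ℤ.* b) ℤ.+ a ℤ.* (y ℤ.* b) ≡ (y ℤ.+ x) ℤ.* (a ℤ.* b)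
  pascal = ℤ-ring
  extend : Σ₀ ≡ f 0 ℤ.+ sumTo (λ k → f (suc k)) n
  extend = trans (sym (trans (cong (λ c → Σ₀ ℤ.+ + c ℤ.* a ℤ.^ suc n) (k>n⇒nCk≡0 (ℕₚ.n<1+n n))) (ℤₚ.+-identityʳ Σ₀))) (sumTo-first f n)

absorption : ∀ n k → suc k * (choose (suc n) (suc k)) ≡ suc n * (choose n k)
absorption zero    zero    = refl
absorption zero    (suc k) = ℕₚ.*-zeroʳ (suc (suc k))
absorption (suc n) zero    = trans (ℕₚ.*-identityˡ (choose (suc (suc n)) 1)) (trans (nC1≡n (suc (suc n))) (sym (ℕₚ.*-identityʳ (suc (suc n)))))
absorption (suc n) (suc k) = begin
  suc (suc k) * (choose (suc (suc n)) (suc (suc k)))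
    ≡⟨ cong (suc (suc k) ℕ.*_) (sym (nCk+nC[k+1]≡[n+1]C[k+1] (suc n) (suc k))) ⟩
  suc (suc k) * (A + B)
    ≡⟨ e₁ k A B ⟩
  A + (suc k * A + suc (suc k) * B)
    ≡⟨ cong (A ℕ.+_) (cong₂ ℕ._+_ (absorption n k) (absorption n (suc k))) ⟩
  A + (suc n * (choose n k) + suc n * (choose n (suc k)))
    ≡⟨ cong (A ℕ.+_) (sym (ℕₚ.*-distribˡ-+ (suc n) (choose n k) (choose n (suc k)))) ⟩
  A + suc n * (choose n k + choose n (suc k))
    ≡⟨ cong (λ z → A + suc n * z) (nCk+nC[k+1]≡[n+1]C[k+1] n k) ⟩
  suc (suc n) * A ∎
  where
  open ≡-Reasoning
  A = choose (suc n) (suc k)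
  B = choose (suc n) (suc (suc k))
  e₁ : ∀ k A B → suc (suc k) * (A + B) ≡ A + (suc k * A + suc (suc k) * B)
  e₁ = ℕ-ring

-- By `absorption` the prime divides (k + 1) times the binomial coefficient, and it cannot divide
-- the smaller number k + 1.
prime∣choose : ∀ {n} → Prime (suc n) → ∀ k → k < n → suc n ℕ∣.∣ (choose (suc n) (suc k))
prime∣choose {n} pr k k<n with euclidsLemma (suc k) (choose (suc n) (suc k)) pr
  (subst (suc n ℕ∣.∣_) (sym (absorption n k)) (ℕ∣.m∣m*n (choose n k)))
... | inj₁ d = ⊥-elim (ℕₚ.<-irrefl refl (ℕₚ.<-≤-trans (s≤s k<n) (ℕ∣.∣⇒≤ d)))
... | inj₂ d = d

fermat-step : ∀ {p} → Prime p → ∀ a → + p ∣ˢ ((+ 1 ℤ.+ a) ℤ.^ p ℤ.- (+ 1 ℤ.+ a ℤ.^ p))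
fermat-step {zero}  pr a = ⊥-elim (¬prime[0] pr)
fermat-step {suc n} pr a = subst (+ suc n ∣ˢ_) eq (inner n ℕₚ.≤-refl)
  where
  f : ℕ → ℤ
  f k = + (choose (suc n) k) ℤ.* a ℤ.^ k
  inner : ∀ j → j ≤ n → + suc n ∣ˢ (sumTo f j ℤ.- + 1)
  inner zero    _   = ≡⇒∣- {a = + 1} refl
  inner (suc j) j<n = subst (+ suc n ∣ˢ_) (lem (sumTo f j) (f (suc j)))
      (Sgn.∣m∣n⇒∣m+n (inner j (ℕₚ.<⇒≤ j<n)) (Sgn.∣m⇒∣m*n {m = + (choose (suc n) (suc j))} (a ℤ.^ suc j) (Sgn.∣ᵤ⇒∣ (prime∣choose pr j j<n))))
    where lem : ∀ s t → s ℤ.- + 1 ℤ.+ t ≡ s ℤ.+ t ℤ.- + 1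
          lem = ℤ-ring
  lem : ∀ s x → s ℤ.- + 1 ≡ (s ℤ.+ + 1 ℤ.* x) ℤ.- (+ 1 ℤ.+ x)
  lem = ℤ-ring
  eq : sumTo f n ℤ.- + 1 ≡ (+ 1 ℤ.+ a) ℤ.^ suc n ℤ.- (+ 1 ℤ.+ a ℤ.^ suc n)
  eq = trans (lem (sumTo f n) (a ℤ.^ suc n)) (cong (ℤ._- (+ 1 ℤ.+ a ℤ.^ suc n))
    (trans (cong (λ c → sumTo f n ℤ.+ + c ℤ.* a ℤ.^ suc n) (sym (nCn≡1 (suc n)))) (sym (binomial-theorem a (suc n)))))

-- Induction in both directions from 0: `fermat-step` read backwards reaches the negative integers.
fermat : ∀ {p} → Prime p → ∀ a → + p ∣ˢ (a ℤ.^ p ℤ.- a)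
fermat {p} pr = go
  where
  up : ∀ x y a → (x ℤ.- (+ 1 ℤ.+ y)) ℤ.+ (y ℤ.- a) ≡ x ℤ.- (+ 1 ℤ.+ a)
  up = ℤ-ring
  down : ∀ x y a → (x ℤ.- (+ 1 ℤ.+ a)) ℤ.- (x ℤ.- (+ 1 ℤ.+ y)) ≡ y ℤ.- a
  down = ℤ-ring
  0^p : ∀ {p} → Prime p → (+ 0) ℤ.^ p ≡ + 0
  0^p {zero}  pr = ⊥-elim (¬prime[0] pr)
  0^p {suc _} pr = refl
  pred : ∀ a → + p ∣ˢ ((+ 1 ℤ.+ a) ℤ.^ p ℤ.- (+ 1 ℤ.+ a)) → + p ∣ˢ (a ℤ.^ p ℤ.- a)
  pred a h = subst (+ p ∣ˢ_) (down ((+ 1 ℤ.+ a) ℤ.^ p) (a ℤ.^ p) a) (Sgn.∣m∣n⇒∣m-n h (fermat-step pr a))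
  go : ∀ a → + p ∣ˢ (a ℤ.^ p ℤ.- a)
  go (+ zero)     = ≡⇒∣- (0^p pr)
  go (+ suc n)    = subst (+ p ∣ˢ_) (up ((+ 1 ℤ.+ + n) ℤ.^ p) ((+ n) ℤ.^ p) (+ n)) (Sgn.∣m∣n⇒∣m+n (fermat-step pr (+ n)) (go (+ n)))
  go -[1+ zero ]  = pred -[1+ zero ] (go (+ 0))
  go -[1+ suc n ] = pred -[1+ suc n ] (go -[1+ n ])

euclid : ∀ {p} → Prime p → ∀ a b → + p ∣ˢ a ℤ.* b → + p ∣ˢ a ⊎ + p ∣ˢ b
euclid {p} pr a b d with euclidsLemma ∣ a ∣ ∣ b ∣ pr (subst (p ℕ∣.∣_) (ℤₚ.abs-* a b) (Sgn.∣⇒∣ᵤ d))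
... | inj₁ e = inj₁ (Sgn.∣ᵤ⇒∣ e)
... | inj₂ e = inj₂ (Sgn.∣ᵤ⇒∣ e)

euclid² : ∀ {p} → Prime p → ∀ a → + p ∣ˢ a ℤ.* a → + p ∣ˢ a
euclid² pr a d with euclid pr a a d
... | inj₁ e = e
... | inj₂ e = e

∣-diff-^ : ∀ {M a b} n → M ∣ˢ (a ℤ.- b) → M ∣ˢ (a ℤ.^ n ℤ.- b ℤ.^ n)
∣-diff-^         zero    d = ≡⇒∣- {a = + 1} refl
∣-diff-^ {M} {a} {b} (suc n) d = subst (M ∣ˢ_) (lem a b (a ℤ.^ n) (b ℤ.^ n))
  (Sgn.∣m∣n⇒∣m+n (Sgn.∣m⇒∣m*n (a ℤ.^ n) d) (Sgn.∣n⇒∣m*n b (∣-diff-^ n d)))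
  where lem : ∀ a b x y → (a ℤ.- b) ℤ.* x ℤ.+ b ℤ.* (x ℤ.- y) ≡ a ℤ.* x ℤ.- b ℤ.* y
        lem = ℤ-ring

-- Primes p ≡ 5 (mod 6) and the form 3x² + 4y².

module Inert {p} (pr : Prime p) (p%6≡5 : p DM.% 6 ≡ 5) where

  s : ℕ
  s = p DM./ 6

  p≡6s+5 : p ≡ 5 + s * 6
  p≡6s+5 = trans (DM.m≡m%n+[m/n]*n p 6) (cong (ℕ._+ s * 6) p%6≡5)

  5≤p : 5 ≤ p
  5≤p = subst (5 ℕ.≤_) (sym p≡6s+5) (ℕₚ.m≤m+n 5 (s * 6))

  p∤small : ∀ k → suc k < 5 → ¬ (+ p ∣ˢ + suc k)
  p∤small k k<5 d = ℕₚ.<-irrefl refl (ℕₚ.<-≤-trans k<5 (ℕₚ.≤-trans 5≤p (ℕ∣.∣⇒≤ (Sgn.∣⇒∣ᵤ d))))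

  cancel-small : ∀ k a → suc k < 5 → + p ∣ˢ + suc k ℤ.* a → + p ∣ˢ a
  cancel-small k a k<5 d with euclid pr (+ suc k) a d
  ... | inj₁ e = ⊥-elim (p∤small k k<5 e)
  ... | inj₂ e = e

  -- Modulo p ≡ 2 (mod 3) cubing is injective, so u³ ≡ v³ forces u ≡ v.
  eisenstein : ∀ u v → + p ∣ˢ (u ℤ.* u ℤ.+ u ℤ.* v ℤ.+ v ℤ.* v) → + p ∣ˢ v
  eisenstein u v d = finish (euclid pr (c ℤ.* (u ℤ.* v)) (u ℤ.- v) product)
    where
    -- Chosen so that 3t + 2 = p. Then (w³)^t w² = w^p ≡ w, and as u³ ≡ v³ the same `c` serves both:
    -- cu² ≡ u and cv² ≡ v.
    t = suc (s + s)
    c = (u ℤ.^ 3) ℤ.^ t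
    c′ = (v ℤ.^ 3) ℤ.^ t
    exponent : ∀ w → (w ℤ.^ 3) ℤ.^ t ℤ.* w ℤ.^ 2 ≡ w ℤ.^ p
    exponent w = trans (cong (ℤ._* w ℤ.^ 2) (ℤₚ.^-*-assoc w 3 t)) (trans (sym (ℤₚ.^-distribˡ-+-* w (3 * t) 2))
      (cong (w ℤ.^_) (trans (lem s) (sym p≡6s+5))))
      where lem : ∀ s → 3 * suc (s + s) + 2 ≡ 5 + s * 6
            lem = ℕ-ring
    cubes : + p ∣ˢ (u ℤ.^ 3 ℤ.- v ℤ.^ 3)
    cubes = subst (+ p ∣ˢ_) (lem u v) (Sgn.∣n⇒∣m*n (u ℤ.- v) d)
      where lem : ∀ u v → (u ℤ.- v) ℤ.* (u ℤ.* u ℤ.+ u ℤ.* v ℤ.+ v ℤ.* v) ≡ u ℤ.* (u ℤ.* (u ℤ.* + 1)) ℤ.- v ℤ.* (v ℤ.* (v ℤ.* + 1))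
            lem = ℤ-ring
    cu² : + p ∣ˢ (c ℤ.* u ℤ.^ 2 ℤ.- u)
    cu² = subst (λ z → + p ∣ˢ (z ℤ.- u)) (sym (exponent u)) (fermat pr u)
    cv² : + p ∣ˢ (c ℤ.* v ℤ.^ 2 ℤ.- v)
    cv² = subst (+ p ∣ˢ_) (lem c c′ (v ℤ.^ 2) v) (Sgn.∣m∣n⇒∣m+n (Sgn.∣m⇒∣m*n (v ℤ.^ 2) (∣-diff-^ {a = u ℤ.^ 3} {v ℤ.^ 3} t cubes))
        (subst (λ z → + p ∣ˢ (z ℤ.- v)) (sym (exponent v)) (fermat pr v)))
      where lem : ∀ c c′ w v → (c ℤ.- c′) ℤ.* w ℤ.+ (c′ ℤ.* w ℤ.- v) ≡ c ℤ.* w ℤ.- v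
            lem = ℤ-ring
    -- v(cu²) - u(cv²) ≡ vu - uv = 0, and its left side factors. The case u ≡ v turns the hypothesis
    -- into 3v² ≡ 0.
    product : + p ∣ˢ c ℤ.* (u ℤ.* v) ℤ.* (u ℤ.- v)
    product = subst (+ p ∣ˢ_) (lem c u v) (Sgn.∣m∣n⇒∣m-n (Sgn.∣n⇒∣m*n v cu²) (Sgn.∣n⇒∣m*n u cv²))
      where lem : ∀ c u v → v ℤ.* (c ℤ.* (u ℤ.* (u ℤ.* + 1)) ℤ.- u) ℤ.- u ℤ.* (c ℤ.* (v ℤ.* (v ℤ.* + 1)) ℤ.- v) ≡ c ℤ.* (u ℤ.* v) ℤ.* (u ℤ.- v)
            lem = ℤ-ring
    from-u : + p ∣ˢ u → + p ∣ˢ v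
    from-u e = euclid² pr v (subst (+ p ∣ˢ_) (lem u v) (Sgn.∣m∣n⇒∣m-n d (Sgn.∣m⇒∣m*n (u ℤ.+ v) e)))
      where lem : ∀ u v → u ℤ.* u ℤ.+ u ℤ.* v ℤ.+ v ℤ.* v ℤ.- u ℤ.* (u ℤ.+ v) ≡ v ℤ.* v
            lem = ℤ-ring
    from-c : + p ∣ˢ c → + p ∣ˢ v
    from-c e = subst (+ p ∣ˢ_) (lem (c ℤ.* v ℤ.^ 2) v) (Sgn.∣m∣n⇒∣m-n (Sgn.∣m⇒∣m*n (v ℤ.^ 2) e) cv²)
      where lem : ∀ a v → a ℤ.- (a ℤ.- v) ≡ v
            lem = ℤ-ring
    from-diff : + p ∣ˢ (u ℤ.- v) → + p ∣ˢ v
    from-diff e = euclid² pr v (cancel-small 2 (v ℤ.* v) (s≤s (s≤s (s≤s (s≤s z≤n))))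
        (subst (+ p ∣ˢ_) (lem u v) (Sgn.∣m∣n⇒∣m-n d (Sgn.∣m⇒∣m*n (u ℤ.+ + 2 ℤ.* v) e))))
      where lem : ∀ u v → u ℤ.* u ℤ.+ u ℤ.* v ℤ.+ v ℤ.* v ℤ.- (u ℤ.- v) ℤ.* (u ℤ.+ + 2 ℤ.* v) ≡ + 3 ℤ.* (v ℤ.* v)
            lem = ℤ-ring
    finish : + p ∣ˢ c ℤ.* (u ℤ.* v) ⊎ + p ∣ˢ (u ℤ.- v) → + p ∣ˢ v
    finish (inj₂ e) = from-diff e
    finish (inj₁ e) with euclid pr c (u ℤ.* v) e
    ... | inj₁ e₁ = from-c e₁
    ... | inj₂ e₂ with euclid pr u v e₂
    ...   | inj₁ e₃ = from-u e₃
    ...   | inj₂ e₃ = e₃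

  form : ℤ → ℤ → ℤ
  form x y = + 3 ℤ.* (x ℤ.* x) ℤ.+ + 4 ℤ.* (y ℤ.* y)

  -- With u = 2y - x and v = 2x the form becomes u² + uv + v², the norm form of ℤ[ω], in which p
  -- stays prime.
  anisotropic : ∀ x y → + p ∣ˢ form x y → + p ∣ˢ x × + p ∣ˢ y
  anisotropic x y d = p∣x , euclid² pr y (cancel-small 3 (y ℤ.* y) (s≤s (s≤s (s≤s (s≤s (s≤s z≤n)))))
      (Sgn.∣m+n∣m⇒∣n {m = + 3 ℤ.* (x ℤ.* x)} d (Sgn.∣n⇒∣m*n (+ 3) (Sgn.∣n⇒∣m*n x p∣x))))
    where
    lem : ∀ x y → + 3 ℤ.* (x ℤ.* x) ℤ.+ + 4 ℤ.* (y ℤ.* y)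
      ≡ (+ 2 ℤ.* y ℤ.- x) ℤ.* (+ 2 ℤ.* y ℤ.- x) ℤ.+ (+ 2 ℤ.* y ℤ.- x) ℤ.* (+ 2 ℤ.* x) ℤ.+ + 2 ℤ.* x ℤ.* (+ 2 ℤ.* x)
    lem = ℤ-ring
    p∣x : + p ∣ˢ x
    p∣x = cancel-small 1 x (s≤s (s≤s (s≤s z≤n))) (eisenstein (+ 2 ℤ.* y ℤ.- x) (+ 2 ℤ.* x) (subst (+ p ∣ˢ_) (lem x y) d))

  instance
    p≢0 : ℤ.NonZero (+ p)
    p≢0 = ℕ.>-nonZero (ℕₚ.≤-trans (s≤s z≤n) 5≤p)

  square-out : ∀ {x y} → + p ∣ˢ x × + p ∣ˢ y → ∃ λ a → ∃ λ b → form x y ≡ form a b ℤ.* + p ℤ.* + p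
  square-out {x} {y} (divides a x≡ap , divides b y≡bp) = a , b , trans (cong₂ form x≡ap y≡bp) (lem a b (+ p))
    where lem : ∀ a b p → + 3 ℤ.* (a ℤ.* p ℤ.* (a ℤ.* p)) ℤ.+ + 4 ℤ.* (b ℤ.* p ℤ.* (b ℤ.* p)) ≡ (+ 3 ℤ.* (a ℤ.* a) ℤ.+ + 4 ℤ.* (b ℤ.* b)) ℤ.* p ℤ.* p
          lem = ℤ-ring

  -- Descent: `anisotropic` lets p² be taken out of the form, which lowers α by one. At α = 0 it
  -- would make p divide u.
  odd-valuation : ∀ α {u} → ¬ (+ p ∣ˢ u) → ∀ x y → u ℤ.* (+ p) ℤ.^ suc (α + α) ≢ form x y
  odd-valuation α {u} p∤u x y e = descend α (square-out (anisotropic x y p∣form)) e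
    where
    p∣form : + p ∣ˢ form x y
    p∣form = subst (+ p ∣ˢ_) e (Sgn.∣n⇒∣m*n u (Sgn.∣m⇒∣m*n {m = + p} ((+ p) ℤ.^ (α + α)) Sgn.∣-refl))
    lem : ∀ u p r → u ℤ.* (p ℤ.* r) ≡ u ℤ.* r ℤ.* p
    lem = ℤ-ring
    cancel : ∀ s t → s ℤ.* + p ≡ t ℤ.* + p → s ≡ t
    cancel s t = ℤₚ.*-cancelʳ-≡ s t (+ p)
    descend : ∀ α → (∃ λ a → ∃ λ b → form x y ≡ form a b ℤ.* + p ℤ.* + p) → u ℤ.* (+ p) ℤ.^ suc (α + α) ≢ form x y
    descend zero    (a , b , eq) e = p∤u (divides (form a b) (trans (sym (ℤₚ.*-identityʳ u))
      (cancel (u ℤ.* + 1) (form a b ℤ.* + p) (trans (sym (lem u (+ p) (+ 1))) (trans e eq)))))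
    descend (suc α) (a , b , eq) e = odd-valuation α p∤u a b (cancel (u ℤ.* (+ p) ℤ.^ suc (α + α)) (form a b)
      (trans (sym (lem u (+ p) ((+ p) ℤ.^ suc (α + α))))
      (trans (cong (λ k → u ℤ.* (+ p) ℤ.^ suc k) (sym (ℕₚ.+-suc α α)))
        (cancel (u ℤ.* (+ p) ℤ.^ suc (α + suc α)) (form a b ℤ.* + p) (trans (sym (lem u (+ p) ((+ p) ℤ.^ suc (α + suc α)))) (trans e eq))))))

  -- The parity of `s` separates p ≡ 5 and p ≡ 11 (mod 12); each witness is (p² - 1)/24 written as a
  -- polynomial in `r`.
  p²-mod24 : ∃ λ b → p * p ≡ 24 * b + 1
  p²-mod24 = from-parity (s DM.% 2) (DM.m%n<n s 2) (DM.m≡m%n+[m/n]*n s 2)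
    where
    r = s DM./ 2
    even : ∀ r → (5 + (0 + r * 2) * 6) * (5 + (0 + r * 2) * 6) ≡ 24 * (6 * (r * r) + 5 * r + 1) + 1
    even = ℕ-ring
    odd : ∀ r → (5 + (1 + r * 2) * 6) * (5 + (1 + r * 2) * 6) ≡ 24 * (6 * (r * r) + 11 * r + 5) + 1
    odd = ℕ-ring
    from-parity : ∀ ε → ε < 2 → s ≡ ε + r * 2 → ∃ λ b → p * p ≡ 24 * b + 1
    from-parity zero       _ e = 6 * (r * r) + 5 * r + 1 , trans (cong (λ z → z * z) (trans p≡6s+5 (cong (λ z → 5 + z * 6) e))) (even r)
    from-parity (suc zero) _ e = 6 * (r * r) + 11 * r + 5 , trans (cong (λ z → z * z) (trans p≡6s+5 (cong (λ z → 5 + z * 6) e))) (odd r)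
    from-parity (suc (suc _)) (s≤s (s≤s ())) e

  p^even-mod24 : ∀ α → ∃ λ b → p ^ (2 * α) ≡ 24 * b + 1
  p^even-mod24 zero    = 0 , refl
  p^even-mod24 (suc α) with p^even-mod24 α | p²-mod24
  ... | b , e | c , e₂ = 24 * (b * c) + b + c , trans (cong (p ℕ.^_) (ℕₚ.*-suc 2 α)) (trans (sym (ℕₚ.*-assoc p p (p ^ (2 * α))))
      (trans (cong₂ ℕ._*_ e₂ e) (lem b c)))
    where lem : ∀ b c → (24 * c + 1) * (24 * b + 1) ≡ 24 * (24 * (b * c) + b + c) + 1
          lem = ℕ-ring

  module Progression (c α n i : ℕ) (1≤i : 1 ≤ i) (i≤p-1 : i ≤ p ∸ 1) where

    index : ℕ
    index = 24 * p ^ (2 * α + 2) * n + (24 * i + c * p) * p ^ (2 * α + 1)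

    unit : ℕ
    unit = 24 * p * n + (24 * i + c * p)

    p^ : p ^ (2 * α + 2) ≡ p * p ^ (2 * α + 1)
    p^ = cong (p ℕ.^_) (lem α)
      where lem : ∀ α → 2 * α + 2 ≡ suc (2 * α + 1)
            lem = ℕ-ring

    index-factored : index ≡ unit * p ^ (2 * α + 1)
    index-factored = trans (cong (λ z → 24 * z * n + (24 * i + c * p) * p ^ (2 * α + 1)) p^)
        (lem p n (24 * i + c * p) (p ^ (2 * α + 1)))
      where lem : ∀ p n a r → 24 * (p * r) * n + a * r ≡ (24 * p * n + a) * r
            lem = ℕ-ring

    -- Modulo p the unit is 24i, where 0 < i < p. The factor 24 = 4 · 2 · 3 is removed in three
    -- steps, each within reach of `cancel-small` because p ≥ 5.
    p∤unit : ¬ (+ p ∣ˢ + unit)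
    p∤unit d = p∤i (cancel (cancel-small 3 (+ (6 * i)) (s≤s (s≤s (s≤s (s≤s (s≤s z≤n))))) (subst (+ p ∣ˢ_) (trans (cong +_ (lem₂ i)) (ℤₚ.pos-* 4 (6 * i))) p∣24i)))
      where
      lem₁ : ∀ p n i c → 24 * p * n + (24 * i + c * p) ≡ p * (24 * n + c) + 24 * i
      lem₁ = ℕ-ring
      lem₂ : ∀ i → 24 * i ≡ 4 * (6 * i)
      lem₂ = ℕ-ring
      lem₃ : ∀ i → 6 * i ≡ 2 * (3 * i)
      lem₃ = ℕ-ring
      p∣24i : + p ∣ˢ + (24 * i)
      p∣24i = Sgn.∣ᵤ⇒∣ (ℕ∣.∣m+n∣m⇒∣n (subst (p ℕ∣.∣_) (lem₁ p n i c) (Sgn.∣⇒∣ᵤ d)) (ℕ∣.m∣m*n (24 * n + c)))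
      cancel : + p ∣ˢ + (6 * i) → + p ∣ˢ + i
      cancel e = cancel-small 2 (+ i) (s≤s (s≤s (s≤s (s≤s z≤n)))) (subst (+ p ∣ˢ_) (ℤₚ.pos-* 3 i)
        (cancel-small 1 (+ (3 * i)) (s≤s (s≤s (s≤s z≤n))) (subst (+ p ∣ˢ_) (trans (cong +_ (lem₃ i)) (ℤₚ.pos-* 2 (3 * i))) e)))
      p∤i : ¬ (+ p ∣ˢ + i)
      p∤i e = ℕₚ.<-irrefl refl (ℕₚ.<-≤-trans
        (ℕₚ.m≤pred[n]⇒suc[m]≤n {{ℕ.>-nonZero (ℕₚ.≤-trans (s≤s z≤n) 5≤p)}} i≤p-1)
        (ℕ∣.∣⇒≤ {{ℕ.>-nonZero 1≤i}} (Sgn.∣⇒∣ᵤ e)))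

    not-represented : ∀ x y → + index ≢ form x y
    not-represented x y e = odd-valuation α p∤unit x y (trans (sym lem) e)
      where
      pos-^ : ∀ a k → + (a ^ k) ≡ (+ a) ℤ.^ k
      pos-^ a zero    = refl
      pos-^ a (suc k) = trans (ℤₚ.pos-* a (a ^ k)) (cong (+ a ℤ.*_) (pos-^ a k))
      exp : ∀ α → 2 * α + 1 ≡ suc (α + α)
      exp = ℕ-ring
      lem : + index ≡ + unit ℤ.* (+ p) ℤ.^ suc (α + α)
      lem = trans (cong +_ index-factored) (trans (ℤₚ.pos-* unit (p ^ (2 * α + 1)))
        (cong (+ unit ℤ.*_) (trans (pos-^ p (2 * α + 1)) (cong (λ j → (+ p) ℤ.^ j) (exp α)))))

    -- Only c p^{2α+2} survives modulo 24, and p² ≡ 1. For c = 7 and c = 19 this is the class to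
    -- which `S-24n+7` or `S-24n+19` applies.
    index-mod24 : ∃ λ k → index ≡ 24 * k + c
    index-mod24 = reduce (p^even-mod24 (suc α))
      where
      P Q : ℕ
      P = p ^ (2 * α + 2)
      Q = p ^ (2 * α + 1)
      lem₁ : ∀ P n i c p r → 24 * P * n + (24 * i + c * p) * r ≡ 24 * (P * n + i * r) + c * (p * r)
      lem₁ = ℕ-ring
      lem₂ : ∀ a c b → 24 * a + c * (24 * b + 1) ≡ 24 * (a + c * b) + c
      lem₂ = ℕ-ring
      lem₃ : ∀ α → 2 * α + 2 ≡ 2 * suc α
      lem₃ = ℕ-ring
      reduce : (∃ λ b → p ^ (2 * suc α) ≡ 24 * b + 1) → ∃ λ k → index ≡ 24 * k + c
      reduce (b , e) = P * n + i * Q + c * b , (begin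
        index                                              ≡⟨ lem₁ P n i c p Q ⟩
        24 * (P * n + i * Q) + c * (p * Q)   ≡⟨ cong (λ z → 24 * (P * n + i * Q) + c * z)
                                                                (trans (sym p^) (trans (cong (p ℕ.^_) (lem₃ α)) e)) ⟩
        24 * (P * n + i * Q) + c * (24 * b + 1) ≡⟨ lem₂ (P * n + i * Q) c b ⟩
        24 * (P * n + i * Q + c * b) + c     ∎)
        where open ≡-Reasoning

-- Supports of the theta products, and the conclusion.

ψE-support : ∀ d .{{_ : NonZero d}} N → (∀ m n → ψe m + pent n * d ≢ N) → (ψ · dil d E) N ≡ + 0
ψE-support d N h = trans (at (·-congʳ ψ (Θ-dil d σ pent-proper)) N)
  (HasSum₂-unique (Θ·Θ (λ _ → + 1) σ ψe-proper (scale-proper d pent-proper) N)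
    (HasSum₂-0 λ m n → trans (cong (λ z → + 1 ℤ.* σ n ℤ.* z) (X^-off (ψe m + pent n * d) N (h m n))) (ℤₚ.*-zeroʳ (+ 1 ℤ.* σ n))))

-- 24m(2m + 1) = 3((4m + 1)² - 1) and 24(6n² - 2n) = 4((6n - 1)² - 1); the constants lost add up to
-- 3 + 4 = 7.
represent₇ : ∀ m n → + (24 * (ψe m + pent n * 4) + 7)
  ≡ + 3 ℤ.* ((+ 4 ℤ.* m ℤ.+ + 1) ℤ.* (+ 4 ℤ.* m ℤ.+ + 1)) ℤ.+ + 4 ℤ.* ((+ 6 ℤ.* n ℤ.- + 1) ℤ.* (+ 6 ℤ.* n ℤ.- + 1))
represent₇ m n = trans (cong (ℤ._+ + 7) (trans (ℤₚ.pos-* 24 (ψe m + pent n * 4)) (cong (+ 24 ℤ.*_) (+ψe m +⁺ 4pent n)))) (lem m n)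
  where lem : ∀ m n → + 24 ℤ.* (m ℤ.* (+ 2 ℤ.* m ℤ.+ + 1) ℤ.+ (+ 6 ℤ.* (n ℤ.* n) ℤ.- + 2 ℤ.* n)) ℤ.+ + 7
          ≡ + 3 ℤ.* ((+ 4 ℤ.* m ℤ.+ + 1) ℤ.* (+ 4 ℤ.* m ℤ.+ + 1)) ℤ.+ + 4 ℤ.* ((+ 6 ℤ.* n ℤ.- + 1) ℤ.* (+ 6 ℤ.* n ℤ.- + 1))
        lem = ℤ-ring

-- Completing the square now gives 16(6n - 1)² = 4(12n - 2)², so the same form serves, with 19 = 3 +
-- 16.
represent₁₉ : ∀ m n → + (24 * (ψe m + pent n * 16) + 19)
  ≡ + 3 ℤ.* ((+ 4 ℤ.* m ℤ.+ + 1) ℤ.* (+ 4 ℤ.* m ℤ.+ + 1)) ℤ.+ + 4 ℤ.* ((+ 12 ℤ.* n ℤ.- + 2) ℤ.* (+ 12 ℤ.* n ℤ.- + 2))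
represent₁₉ m n = trans (cong (ℤ._+ + 19) (trans (ℤₚ.pos-* 24 (ψe m + pent n * 16)) (cong (+ 24 ℤ.*_) (+ψe m +⁺ 16pent)))) (lem m n)
  where
  16pent : + (pent n * 16) ≡ (+ 6 ℤ.* (n ℤ.* n) ℤ.- + 2 ℤ.* n) ℤ.* + 4
  16pent = trans (cong +_ (sym (ℕₚ.*-assoc (pent n) 4 4))) (4pent n *⁺ 4)
  lem : ∀ m n → + 24 ℤ.* (m ℤ.* (+ 2 ℤ.* m ℤ.+ + 1) ℤ.+ (+ 6 ℤ.* (n ℤ.* n) ℤ.- + 2 ℤ.* n) ℤ.* + 4) ℤ.+ + 19
          ≡ + 3 ℤ.* ((+ 4 ℤ.* m ℤ.+ + 1) ℤ.* (+ 4 ℤ.* m ℤ.+ + 1)) ℤ.+ + 4 ℤ.* ((+ 12 ℤ.* n ℤ.- + 2) ℤ.* (+ 12 ℤ.* n ℤ.- + 2))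
  lem = ℤ-ring

theorem4p5 : (p : ℕ) → Prime p → p % 6 ≡ 5 → (m α n i : ℕ) → 1 ≤ i → i ≤ p ∸ 1 →
    ((+ 32) ∣ S3bar 1 (24 * p ^ (2 * α + 2) * n + (24 * i + 7 * p) * p ^ (2 * α + 1)))
    × ((+ 32) ∣ S3bar (16 * m + 1) (24 * p ^ (2 * α + 2) * n + (24 * i + 19 * p) * p ^ (2 * α + 1)))
theorem4p5 p pr p%6≡5 m α n i 1≤i i≤p-1 = Sgn.∣⇒∣ᵤ {+ 32} {S P₇.index} (coefficient₇ P₇.index-mod24) , Sgn.∣⇒∣ᵤ {+ 32} {S3bar (16 * m + 1) P₁₉.index} second
  where
  open Inert pr p%6≡5
  module P₇ = Progression 7 α n i 1≤i i≤p-1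
  module P₁₉ = Progression 19 α n i 1≤i i≤p-1
  coefficient₇ : (∃ λ k → P₇.index ≡ 24 * k + 7) → + 32 ∣ˢ S P₇.index
  coefficient₇ (k , e) = subst (λ N → + 32 ∣ˢ S N) (sym e) (S-24n+7 k (ψE-support 4 k λ x y r →
    P₇.not-represented (+ 4 ℤ.* x ℤ.+ + 1) (+ 6 ℤ.* y ℤ.- + 1)
      (trans (cong +_ (trans e (cong (λ z → 24 * z + 7) (sym r)))) (represent₇ x y))))
  coefficient₁₉ : (∃ λ k → P₁₉.index ≡ 24 * k + 19) → + 32 ∣ˢ S P₁₉.index
  coefficient₁₉ (k , e) = subst (λ N → + 32 ∣ˢ S N) (sym e) (S-24n+19 k (ψE-support 16 k λ x y r →
    P₁₉.not-represented (+ 4 ℤ.* x ℤ.+ + 1) (+ 12 ℤ.* y ℤ.- + 2)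
      (trans (cong +_ (trans e (cong (λ z → 24 * z + 19) (sym r)))) (represent₁₉ x y))))
  second : + 32 ∣ˢ S3bar (16 * m + 1) P₁₉.index
  second = subst (+ 32 ∣ˢ_) (lem (S3bar (16 * m + 1) P₁₉.index) (S P₁₉.index)) (Sgn.∣m∣n⇒∣m+n (S3bar-16m+1 m P₁₉.index) (coefficient₁₉ P₁₉.index-mod24))
    where lem : ∀ a b → a ℤ.- b ℤ.+ b ≡ a
          lem = ℤ-ring
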